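{- Let $\mathcal G$ be a class of (finite, undirected) graphs. The following four statements are equivalent. (1) $\mathcal G$ has structurally bounded treewidth, i.e., there exist a graph class $\mathcal G'$ of bounded treewidth and a first-order transduction $\tau$ such that $\mathcal G \subseteq \tau(\mathcal G')$. (2) There exists a number $t$ such that every graph in $\mathcal G$ has a lacon-decomposition $(L,\pi)$ with $\mathrm{col}_\infty(L,\pi)\le t-1$. (3) There exist a number $t$ and a signature $S$ such that every graph in $\mathcal G$ has a shrub-decomposition $(F,S)$ with one color, diameter at most $t$, and such that $F$ has treewidth at most $t$. (4) There exist a number $d$ and a graph class $\mathcal G'$ of bounded treewidth such that every graph in $\mathcal G$ has a parity-decomposition $P\in\mathcal G'$ of target-degree at most $d$.
   Context: A linear order on the vertices of a graph is an injective map $\pi: V\to\mathbb N$. A vertex $u$ is $r$-reachable from $v$ (w.r.t. $\pi$) if $\pi(u)\le\pi(v)$ and there is a path of length at most $r$ from $v$ to $u$ all of whose vertices $w$ satisfy $w=u$ or $\pi(w)\ge\pi(v)$; $\mathrm{col}_r(G,\pi)$ is the maximum over $v$ of the number of vertices $r$-reachable from $v$, and $\mathrm{col}_\infty(G,\pi)$ is the same quantity with no bound on the path length. Lacon-decomposition: a pair $(L,\pi)$ where $L$ is a bipartite graph with sides $T$ (target vertices) and $H$ (hidden vertices), each hidden vertex is labeled "0" or "1", $\pi$ is a linear order on $V(L)$ with $\pi(h)<\pi(t)$ for all $h\in H,t\in T$, and for all $t,t'\in T$ we have $N(t)\cap N(t')\neq\emptyset$; the $\pi$-largest vertex of $N(t)\cap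 N(t')$ is the dominant vertex of $t,t'$. It is a lacon-decomposition of a graph $G$ if $V(G)=T$ and for all $t\ne t'\in T$, $tt'\in E(G)$ iff the dominant vertex of $t,t'$ is labeled "1". Shrub-decomposition of $m$ colors and diameter $d$ of a graph $G$: a pair $(F,S)$ with $F$ an undirected graph and $S\subseteq\{1,\dots,m\}^2\times\{1,\dots,d\}$ such that any two vertices of $F$ have distance at most $d$ in $F$, the set of degree-one vertices of $F$ is exactly $V(G)$, each degree-one vertex of $F$ is assigned a color in $\{1,\dots,m\}$, $(i,j,l)\in S$ iff $(j,i,l)\in S$, and for all $u,v\in V(G)$ with colors $i,j$ and $F$-distance $l$, $uv\in E(G)$ iff $(i,j,l)\in S$. Parity-decomposition of target-degree $d$ of a graph $G$: a bipartite graph $P$ with sides $T,H$ in which every vertex of $T$ has degree at most $d$, $T=V(G)$, and for all $t\ne t'\in T$, $tt'\in E(G)$ iff $|N(t)\cap N(t')|$ is odd. First-order transductions: a basic transduction is a triple $\tau_0=(\chi,\nu,\varphi)$ of first-order formulas with $0,1,2$ free variables; $\tau_0(G)$ is undefined if $G\not\models\chi$, otherwise it is the graph with vertex set $\{v: G\models\nu(v)\}$ and edges $uv$ ($u\neq v$) with $G\models\varphi(u,v)\lor\varphi(v,u)$. A $p$-parameter expansion maps $G$ to the set of all graphs obtained by adding $p$ unary predicates to $G$. An $m$-copy operation maps $G$ to the graph with vertex set $V(G)\times\{1,\dots,m\}$, edges $(v,i)(w,i)$ for $vw\in E(G)$, a binary relation $\sim$ with $(u,i)\sim(v,j)$ iff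 $u=v$, and unary predicates $Q_i=V(G)\times\{i\}$. A transduction is $\tau=\tau_0\circ\gamma\circ\varepsilon$ with $\varepsilon$ a parameter expansion, $\gamma$ a copy operation, $\tau_0$ a basic transduction; $\tau(\mathcal G')=\bigcup_{G\in\mathcal G'}\tau(G)$. -}

module Defs where

open import Level using (0ℓ)
open import Data.Nat using (ℕ; zero; suc; _+_; _*_; _≤_; _<_; _∸_; _%_)
open import Data.Fin using (Fin; zero; suc; splitAt; _↑ˡ_; _↑ʳ_; inject₁; fromℕ; _≟_)
open import Data.Fin.Subset using (Subset; ∣_∣; _∩_; _∈_)
open import Data.Bool using (Bool; true; false; _∧_; _∨_; not)
open import Data.List using (List; allFin)
open import Data.Bool.ListAction using (any)
open import Data.Vec using (tabulate)
open import Data.Unit using (⊤)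
open import Data.Product using (Σ; ∃; ∃-syntax; _×_; _,_)
open import Data.Sum using (_⊎_; inj₁; inj₂)
open import Relation.Nullary using (¬_; does)
open import Relation.Binary.PropositionalEquality using (_≡_; _≢_; refl)
open import Function.Definitions using (Injective)
open import Function.Bundles using (_⇔_)

record Graph : Set where
  field
    size : ℕ
    adj  : Fin size → Fin size → Bool
    sym  : ∀ u v → adj u v ≡ adj v u
    irr  : ∀ u → adj u u ≡ false
open Graph public

V : Graph → Set
V G = Fin (size G)

E : (G : Graph) → V G → V G → Set
E G u v = adj G u v ≡ true

GraphClass : Set₁
GraphClass = Graph → Set

data Walk {m : ℕ} (A : Fin m → Fin m → Bool) (P : Fin m → Set)
     : Fin m → Fin m → ℕ → Set where
  stay : ∀ {x} → P x → Walk A P x x 0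
  step : ∀ {x y z l} → P x → A x y ≡ true → Walk A P y z l → Walk A P x z (suc l)

Anywhere : ∀ {m : ℕ} → Fin m → Set
Anywhere _ = ⊤

Dist : (G : Graph) → V G → V G → ℕ → Set
Dist G x y l = Walk (adj G) Anywhere x y l
             × (∀ l' → l' < l → ¬ Walk (adj G) Anywhere x y l')

Connected : Graph → Set
Connected G = ∀ x y → ∃[ l ] Walk (adj G) Anywhere x y l

Acyclic : Graph → Set
Acyclic G = ∀ k (c : Fin (suc (suc (suc k))) → V G) → Injective _≡_ _≡_ c
          → (∀ (i : Fin (suc (suc k))) → E G (c (inject₁ i)) (c (suc i)))
          → ¬ E G (c (fromℕ (suc (suc k)))) (c zero)

IsTree : Graph → Set
IsTree T = (1 ≤ size T) × Connected T × Acyclic T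

record TreeDecomposition (G : Graph) (k : ℕ) : Set where
  field
    T        : Graph
    isTree   : IsTree T
    bag      : V T → Subset (size G)
    covers   : ∀ v → ∃[ i ] (v ∈ bag i)
    edgeIn   : ∀ u v → E G u v → ∃[ i ] (u ∈ bag i × v ∈ bag i)
    subtree  : ∀ v i j → v ∈ bag i → v ∈ bag j
             → ∃[ l ] Walk (adj T) (λ w → v ∈ bag w) i j l
    width    : ∀ i → ∣ bag i ∣ ≤ suc k

TW≤ : Graph → ℕ → Set
TW≤ G k = TreeDecomposition G k

BoundedTreewidth : GraphClass → Set
BoundedTreewidth 𝒢 = ∃[ k ] (∀ G → 𝒢 G → TW≤ G k)

module _ {m : ℕ} (A : Fin m → Fin m → Bool) (π : Fin m → ℕ) where

  Allowed : Fin m → Fin m → Fin m → Set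
  Allowed v u w = (w ≡ u) ⊎ (π v ≤ π w)

  Reachable : ℕ → Fin m → Fin m → Set
  Reachable r v u = π u ≤ π v × ∃[ l ] (l ≤ r × Walk A (Allowed v u) v u l)

  Reachable∞ : Fin m → Fin m → Set
  Reachable∞ v u = π u ≤ π v × ∃[ l ] Walk A (Allowed v u) v u l

  Col≤ : ℕ → ℕ → Set
  Col≤ r c = ∀ v (S : Subset m) → (∀ u → u ∈ S → Reachable r v u) → ∣ S ∣ ≤ c

  Col∞≤ : ℕ → Set
  Col∞≤ c = ∀ v (S : Subset m) → (∀ u → u ∈ S → Reachable∞ v u) → ∣ S ∣ ≤ c

-- Bipartite graphs with hidden side Fin h (first) and target side Fin n

bipAdj′ : {h n : ℕ} (N : Fin n → Fin h → Bool) → Fin h ⊎ Fin n → Fin h ⊎ Fin n → Bool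
bipAdj′ N (inj₁ a) (inj₂ t) = N t a
bipAdj′ N (inj₂ t) (inj₁ a) = N t a
bipAdj′ N _        _        = false

bipAdj : (h n : ℕ) (N : Fin n → Fin h → Bool) → Fin (h + n) → Fin (h + n) → Bool
bipAdj h n N x y = bipAdj′ N (splitAt h x) (splitAt h y)

private
  bipSym′ : {h n : ℕ} (N : Fin n → Fin h → Bool) (s s' : Fin h ⊎ Fin n)
          → bipAdj′ N s s' ≡ bipAdj′ N s' s
  bipSym′ N (inj₁ a) (inj₁ b) = refl
  bipSym′ N (inj₁ a) (inj₂ t) = refl
  bipSym′ N (inj₂ t) (inj₁ a) = refl
  bipSym′ N (inj₂ t) (inj₂ t') = refl

  bipIrr′ : {h n : ℕ} (N : Fin n → Fin h → Bool) (s : Fin h ⊎ Fin n)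
          → bipAdj′ N s s ≡ false
  bipIrr′ N (inj₁ a) = refl
  bipIrr′ N (inj₂ t) = refl

-- the bipartite graph with hidden vertices a ↑ˡ n and target vertices h ↑ʳ t
bipGraph : (h n : ℕ) (N : Fin n → Fin h → Bool) → Graph
bipGraph h n N = record
  { size = h + n
  ; adj  = bipAdj h n N
  ; sym  = λ x y → bipSym′ N (splitAt h x) (splitAt h y)
  ; irr  = λ x → bipIrr′ N (splitAt h x)
  }

Dominant : {h n : ℕ} (N : Fin n → Fin h → Bool) (πH : Fin h → ℕ)
         → Fin n → Fin n → Fin h → Set
Dominant N πH t t' a = N t a ≡ true × N t' a ≡ true
                     × (∀ b → N t b ≡ true → N t' b ≡ true → πH b ≤ πH a)

record LaconDecomposition (G : Graph) : Set where
  field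
    h      : ℕ
    N      : V G → Fin h → Bool
    label  : Fin h → Bool                    -- true = "1", false = "0"
    π      : Fin (h + size G) → ℕ            -- linear order on V(L)
    π-inj  : Injective _≡_ _≡_ π
    π-H<T  : ∀ a t → π (a ↑ˡ size G) < π (h ↑ʳ t)
    common : ∀ t t' → ∃[ a ] (N t a ≡ true × N t' a ≡ true)
    edges  : ∀ t t' → t ≢ t'
           → E G t t' ⇔ (∃[ a ] (Dominant N (λ b → π (b ↑ˡ size G)) t t' a × label a ≡ true))

  L : Graph
  L = bipGraph h (size G) N

record ShrubDecomposition (m d : ℕ) (G : Graph) (S : Fin m → Fin m → ℕ → Bool) : Set where
  field
    F        : Graph
    diam     : ∀ x y → ∃[ l ] (l ≤ d × Walk (adj F) Anywhere x y l)
    ι        : V G → V F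
    ι-inj    : Injective _≡_ _≡_ ι
    leaves   : ∀ x → ∣ tabulate (adj F x) ∣ ≡ 1 ⇔ (∃[ v ] (ι v ≡ x))
    colour   : V G → Fin m
    S-range  : ∀ i j l → S i j l ≡ true → (1 ≤ l × l ≤ d)
    S-sym    : ∀ i j l → S i j l ≡ S j i l
    edges    : ∀ u v l → u ≢ v → Dist F (ι u) (ι v) l
             → E G u v ⇔ (S (colour u) (colour v) l ≡ true)

record ParityDecomposition (d : ℕ) (G : Graph) : Set where
  field
    h      : ℕ
    N      : V G → Fin h → Bool
    degree : ∀ t → ∣ tabulate (N t) ∣ ≤ d
    parity : ∀ t t' → t ≢ t'
           → E G t t' ⇔ (∣ tabulate (N t) ∩ tabulate (N t') ∣ % 2 ≡ 1)

  P : Graph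
  P = bipGraph h (size G) N

data Formula (q : ℕ) : ℕ → Set where
  _≐_   : ∀ {k} → Fin k → Fin k → Formula q k
  edge  : ∀ {k} → Fin k → Fin k → Formula q k
  sim   : ∀ {k} → Fin k → Fin k → Formula q k
  unary : ∀ {k} → Fin q → Fin k → Formula q k
  neg   : ∀ {k} → Formula q k → Formula q k
  _and_ : ∀ {k} → Formula q k → Formula q k → Formula q k
  ex    : ∀ {k} → Formula q (suc k) → Formula q k

extend : {k : ℕ} {D : Set} → D → (Fin k → D) → Fin (suc k) → D
extend a ρ zero    = a
extend a ρ (suc i) = ρ i

-- Satisfaction in the structure obtained from G by a p-parameter expansion
-- (parameters U) followed by an m-copy operation.  The domain is V(G) × Fin m;
-- unary predicates 0..p-1 are the (copied) parameters, p..p+m-1 are Q_1..Q_m.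
CDom : Graph → ℕ → Set
CDom G m = V G × Fin m

cnoVars : {G : Graph} {m : ℕ} → Fin 0 → CDom G m
cnoVars ()

module CopyStructure (G : Graph) (p m : ℕ) (U : Fin p → V G → Bool) where

  Dom : Set
  Dom = CDom G m

  ⌊_≟_⌋ : {n : ℕ} → Fin n → Fin n → Bool
  ⌊ x ≟ y ⌋ = does (x ≟ y)

  eqB : Dom → Dom → Bool
  eqB (v , i) (w , j) = ⌊ v ≟ w ⌋ ∧ ⌊ i ≟ j ⌋

  edgeB : Dom → Dom → Bool
  edgeB (v , i) (w , j) = adj G v w ∧ ⌊ i ≟ j ⌋

  simB : Dom → Dom → Bool
  simB (v , i) (w , j) = ⌊ v ≟ w ⌋

  unaryB′ : Fin p ⊎ Fin m → Dom → Bool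
  unaryB′ (inj₁ a) (v , i) = U a v
  unaryB′ (inj₂ j) (v , i) = ⌊ i ≟ j ⌋

  unaryB : Fin (p + m) → Dom → Bool
  unaryB c x = unaryB′ (splitAt p c) x

  eval : ∀ {k} → Formula (p + m) k → (Fin k → Dom) → Bool
  eval (x ≐ y)     ρ = eqB (ρ x) (ρ y)
  eval (edge x y)  ρ = edgeB (ρ x) (ρ y)
  eval (sim x y)   ρ = simB (ρ x) (ρ y)
  eval (unary c x) ρ = unaryB c (ρ x)
  eval (neg φ)     ρ = not (eval φ ρ)
  eval (φ and ψ)   ρ = eval φ ρ ∧ eval ψ ρ
  eval (ex φ)      ρ = any (λ v → any (λ i → eval φ (extend (v , i) ρ)) (allFin m)) (allFin (size G))

-- A transduction τ = τ₀ ∘ γ ∘ ε : p parameters, m copies, basic τ₀ = (χ, ν, φ)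
record Transduction : Set where
  field
    p m : ℕ
    χ   : Formula (p + m) 0
    ν   : Formula (p + m) 1
    φ   : Formula (p + m) 2

-- H ∈ τ(G) (up to isomorphism): for some choice of parameters, χ holds and
-- H is isomorphic to the graph τ₀(γ(ε(G))), via f : V(H) → {x | ν(x)}.
_∈τ_ : Graph → Transduction × Graph → Set
H ∈τ (τ , G) =
  ∃[ U ] (eval U χ noVars ≡ true
         × Σ (V H → Dom) λ f →
             Injective _≡_ _≡_ f
           × (∀ u → eval U ν (λ _ → f u) ≡ true)
           × (∀ x → eval U ν (λ _ → x) ≡ true → ∃[ u ] (f u ≡ x))
           × (∀ u v → u ≢ v → E H u v ⇔
                (eval U φ (pair (f u) (f v)) ∨ eval U φ (pair (f v) (f u)) ≡ true)))
  where
  open Transduction τ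
  Dom = CDom G m
  noVars = cnoVars {G} {m}
  eval : (U : Fin p → V G → Bool) → ∀ {k} → Formula (p + m) k → (Fin k → Dom) → Bool
  eval U = CopyStructure.eval G p m U
  pair : Dom → Dom → Fin 2 → Dom
  pair x y zero = x
  pair x y (suc zero) = y

StructurallyBoundedTreewidth : GraphClass → Set₁
StructurallyBoundedTreewidth 𝒢 =
  Σ GraphClass λ 𝒢' → BoundedTreewidth 𝒢' ×
  Σ Transduction λ τ → ∀ G → 𝒢 G → ∃[ G' ] (𝒢' G' × G ∈τ (τ , G'))

LaconCondition : GraphClass → Set
LaconCondition 𝒢 = ∃[ t ] (∀ G → 𝒢 G →
  Σ (LaconDecomposition G) λ D →
    Col∞≤ (adj (LaconDecomposition.L D)) (LaconDecomposition.π D) (t ∸ 1))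

ShrubCondition : GraphClass → Set
ShrubCondition 𝒢 = ∃[ t ] Σ (Fin 1 → Fin 1 → ℕ → Bool) λ S → (∀ G → 𝒢 G →
  Σ (ShrubDecomposition 1 t G S) λ D → TW≤ (ShrubDecomposition.F D) t)

ParityCondition : GraphClass → Set₁
ParityCondition 𝒢 = Σ ℕ λ d → Σ GraphClass λ 𝒢' → BoundedTreewidth 𝒢' ×
  (∀ G → 𝒢 G → Σ (ParityDecomposition d G) λ D → 𝒢' (ParityDecomposition.P D))

{-# OPTIONS --safe #-}
-- From (1) to (2): a graph of bounded treewidth has a perfect elimination ordering whose closed
-- up-sets are small cliques.  A back-and-forth argument, in which the ordering is squared at every
-- step and colours record membership in representative families, shows that the truth of a
-- first-order formula on two vertices depends only on their colours and on the largest common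
-- element of their up-sets, which thus can serve as dominant vertex.  Conversely, a small
-- colouring number yields an elimination ordering by fill-in.  Dominant vertices are turned into
-- distances (3) by making paths to larger hidden vertices shorter, and into parities (4) by
-- taking sets of hidden vertices, labelled by their least element, as new hidden vertices.  Both
-- decompositions are undone by simple first-order formulas.
module Submission where

open import Defs hiding (sym)
open import Data.Nat using (ℕ; zero; suc; _+_; _*_; _^_; _∸_; _%_; _⊓_; _⊔_; _≤_; _<_; z≤n; s≤s)
import Data.Nat as ℕ
import Data.Nat.Properties as ℕ
import Data.Nat.DivMod as ℕ
open import Data.Nat.Tactic.RingSolver using (solve-∀)
open import Data.Fin using (Fin; zero; suc; toℕ; fromℕ; fromℕ<; inject₁; combine; remQuot; funToFin; finToFun; splitAt; _↑ˡ_; _↑ʳ_; punchIn; punchOut; _≟_)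
import Data.Fin.Properties as Fin
open import Data.Fin.Properties using (any?; all?)
open import Data.Fin.Subset using (Subset; ∣_∣; _∩_; _∈_)
import Data.Fin.Subset.Properties as Subset
open import Data.Fin.Relation.Unary.Top using (view; ‵fromℕ; ‵inject₁)
open import Data.Vec using (Vec; []; _∷_; tabulate; lookup; here; there)
import Data.Vec as Vec
import Data.Vec.Properties as Vec
open import Data.Bool using (Bool; true; false; _∧_; _∨_; not; _xor_; if_then_else_)
import Data.Bool.Properties as Bool
open import Data.List using (List; allFin)
import Data.List as List
open import Data.List.Membership.Propositional using () renaming (_∈_ to _∈ˡ_)
open import Data.List.Membership.Propositional.Properties using (∈-map⁺; ∈-map⁻)
open import Data.List.Relation.Unary.Any using (here; there)
open import Data.Bool.ListAction using (any)
open import Data.Maybe using (Maybe; just; nothing)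
import Data.Maybe.Properties as Maybe
open import Data.Unit using (⊤; tt)
open import Data.Empty using (⊥; ⊥-elim)
open import Data.Product using (Σ; ∃; ∃-syntax; ∃₂; _×_; _,_; proj₁; proj₂; uncurry)
open import Data.Sum using (_⊎_; inj₁; inj₂; [_,_]′)
open import Relation.Nullary using (¬_; Dec; yes; no; does; contradiction)
open import Relation.Nullary.Decidable using (map′; _×-dec_; _⊎-dec_; _→-dec_; ¬?; dec-true; dec-false)
open import Relation.Binary.PropositionalEquality
open import Relation.Binary.Definitions using (tri<; tri≈; tri>)
open import Relation.Binary.Construct.Closure.ReflexiveTransitive using (Star; ε; _◅_)
open import Function using (_∘_; id)
open import Function.Definitions using (Injective)
open import Function.Bundles using (_⇔_; mk⇔; module Equivalence)

-- The number of colours must stay bounded, so a colour cannot mention a vertex. It mentions names,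
-- and a name identifies a vertex only among the members of one up-set. Vertices of different
-- up-sets are therefore compared through a common member; the root is added so that one always
-- exists. Up-sets are not transitive: for `a` in `Up v`, a member of `Up a` need not lie in `Up v`.
-- When a new vertex `y` is played against a tuple, everything that it shares with the tuple lies in
-- `Up a` for the highest shared vertex `a`, hence two steps below a vertex of the tuple. This is
-- why each quantifier costs one squaring. The answer to `y` must share nothing with the other tuple
-- above the partner of `a`. This is a negative condition, which the colour of the answer alone
-- cannot guarantee. It is met by taking the answer from a bounded family of candidates attached to
-- the partner of `a`, because the colours of the tuple record which vertices these candidates see.
-- Anchoring also shapes the last construction: a set of names determines a set of hidden vertices
-- only once its largest element is fixed.

does⇒ : {P : Set} (d : Dec P) → does d ≡ true → P
does⇒ (yes p) _ = p

does-cong : {P Q : Set} (d : Dec P) (e : Dec Q) → (P → Q) → (Q → P) → does d ≡ does e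
does-cong (yes p) (yes q) _ _ = refl
does-cong (yes p) (no ¬q) f _ = contradiction (f p) ¬q
does-cong (no ¬p) (yes q) _ g = contradiction (g q) ¬p
does-cong (no ¬p) (no ¬q) _ _ = refl

bool-ext : {a b : Bool} → (a ≡ true → b ≡ true) → (b ≡ true → a ≡ true) → a ≡ b
bool-ext {true}  {b}     f g = sym (f refl)
bool-ext {false} {true}  f g = g refl
bool-ext {false} {false} f g = refl

true≢false : {b : Bool} → b ≡ true → b ≡ false → ⊥
true≢false refl ()

-- Cardinalities of subsets

select : ∀ {n} {P : Fin n → Set} → (∀ x → Dec (P x)) → Subset n
select P? = tabulate (λ x → does (P? x))

∈-tabulate⇒ : ∀ {n} {f : Fin n → Bool} {x} → x ∈ tabulate f → f x ≡ true
∈-tabulate⇒ {f = f} {x} x∈ = trans (sym (Vec.lookup∘tabulate f x)) (Vec.[]=⇒lookup x∈)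

⇒∈-tabulate : ∀ {n} {f : Fin n → Bool} {x} → f x ≡ true → x ∈ tabulate f
⇒∈-tabulate {f = f} {x} e = Vec.lookup⇒[]= x _ (trans (Vec.lookup∘tabulate f x) e)

∈-select⇒ : ∀ {n} {P : Fin n → Set} (P? : ∀ x → Dec (P x)) {x} → x ∈ select P? → P x
∈-select⇒ P? {x} x∈ = does⇒ (P? x) (∈-tabulate⇒ x∈)

⇒∈-select : ∀ {n} {P : Fin n → Set} (P? : ∀ x → Dec (P x)) {x} → P x → x ∈ select P?
⇒∈-select P? {x} p = ⇒∈-tabulate (dec-true (P? x) p)

nth : ∀ {n} (S : Subset n) → Fin ∣ S ∣ → Fin n
nth (true  ∷ S) zero    = zero
nth (true  ∷ S) (suc i) = suc (nth S i)
nth (false ∷ S) i       = suc (nth S i)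

nth-∈ : ∀ {n} (S : Subset n) i → nth S i ∈ S
nth-∈ (true  ∷ S) zero    = here
nth-∈ (true  ∷ S) (suc i) = there (nth-∈ S i)
nth-∈ (false ∷ S) i       = there (nth-∈ S i)

nth-injective : ∀ {n} (S : Subset n) {i j} → nth S i ≡ nth S j → i ≡ j
nth-injective (true  ∷ S) {zero}  {zero}  e = refl
nth-injective (true  ∷ S) {suc i} {suc j} e = cong suc (nth-injective S (Fin.suc-injective e))
nth-injective (false ∷ S) e = nth-injective S (Fin.suc-injective e)

position : ∀ {n} (S : Subset n) {x} → x ∈ S → Fin ∣ S ∣
position (true  ∷ S) {zero}  _         = zero
position (true  ∷ S) {suc x} (there p) = suc (position S p)
position (false ∷ S) {suc x} (there p) = position S p

position-injective : ∀ {n} (S : Subset n) {x y} (p : x ∈ S) (q : y ∈ S) →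
                     position S p ≡ position S q → x ≡ y
position-injective (true  ∷ S) {zero}  {zero}  _ _ _ = refl
position-injective (true  ∷ S) {zero}  {suc y} _ (there q) ()
position-injective (true  ∷ S) {suc x} {zero}  (there p) _ ()
position-injective (true  ∷ S) {suc x} {suc y} (there p) (there q) e =
  cong suc (position-injective S p q (Fin.suc-injective e))
position-injective (false ∷ S) {suc x} {suc y} (there p) (there q) e =
  cong suc (position-injective S p q e)

injectiveOn⇒∣∣≤ : ∀ {n c} (S : Subset n) (f : Fin n → Fin c) →
  (∀ x y → x ∈ S → y ∈ S → f x ≡ f y → x ≡ y) → ∣ S ∣ ≤ c
injectiveOn⇒∣∣≤ S f inj = Fin.injective⇒≤ {f = f ∘ nth S}
  λ e → nth-injective S (inj _ _ (nth-∈ S _) (nth-∈ S _) e)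

injectiveInto⇒≤∣∣ : ∀ {n c} (S : Subset n) (g : Fin c → Fin n) → Injective _≡_ _≡_ g →
  (∀ i → g i ∈ S) → c ≤ ∣ S ∣
injectiveInto⇒≤∣∣ S g inj g∈ = Fin.injective⇒≤ {f = λ i → position S (g∈ i)}
  λ e → inj (position-injective S (g∈ _) (g∈ _) e)

∣∣≡1⇒ : ∀ {n} (S : Subset n) → ∣ S ∣ ≡ 1 → ∃[ x ] (x ∈ S × ∀ y → y ∈ S → y ≡ x)
∣∣≡1⇒ S e = x , nth-∈ S _ , λ y y∈ → position-injective S y∈ (nth-∈ S _) (one (position S y∈) (position S (nth-∈ S _)))
  where
  x = nth S (subst Fin (sym e) zero)
  one : (i j : Fin ∣ S ∣) → i ≡ j
  one = subst (λ n → (i j : Fin n) → i ≡ j) (sym e) λ { zero zero → refl }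

⇒∣∣≡1 : ∀ {n} (S : Subset n) x → x ∈ S → (∀ y → y ∈ S → y ≡ x) → ∣ S ∣ ≡ 1
⇒∣∣≡1 S x x∈ only = ℕ.≤-antisym
  (injectiveOn⇒∣∣≤ S (λ _ → zero {0}) λ y z y∈ z∈ _ → trans (only y y∈) (sym (only z z∈)))
  (injectiveInto⇒≤∣∣ {c = 1} S (λ _ → x) (λ { {zero} {zero} _ → refl }) (λ _ → x∈))

-- Extremal elements

argmax : ∀ {n} {P : Fin n → Set} → (∀ x → Dec (P x)) → (f : Fin n → ℕ) → ∃ P →
         ∃[ m ] (P m × ∀ x → P x → f x ≤ f m)
argmax {suc n} {P} P? f w with any? (P? ∘ suc)
... | no ¬s with w
...   | suc x , px = contradiction (x , px) ¬s
...   | zero , p0 = zero , p0 , λ { zero _ → ℕ.≤-refl ; (suc x) px → contradiction (x , px) ¬s }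
argmax {suc n} {P} P? f w | yes s with argmax (P? ∘ suc) (f ∘ suc) s | P? zero
... | m , pm , mx | no ¬0 = suc m , pm , λ { zero p → contradiction p ¬0 ; (suc x) px → mx x px }
... | m , pm , mx | yes p0 with ℕ.≤-total (f zero) (f (suc m))
...   | inj₁ le = suc m , pm , λ { zero _ → le ; (suc x) px → mx x px }
...   | inj₂ ge = zero , p0 , λ { zero _ → ℕ.≤-refl ; (suc x) px → ℕ.≤-trans (mx x px) ge }

upperBound : ∀ {n} (f : Fin n → ℕ) → ∃[ M ] (∀ x → f x < M)
upperBound {zero}  f = 0 , λ ()
upperBound {suc n} f with upperBound (f ∘ suc)
... | M , h = suc (f zero) ⊔ M ,
  λ { zero → ℕ.m≤m⊔n _ M ; (suc x) → ℕ.≤-trans (h x) (ℕ.m≤n⊔m (suc (f zero)) M) }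

argmin : ∀ {n} {P : Fin n → Set} → (∀ x → Dec (P x)) → (f : Fin n → ℕ) → ∃ P →
         ∃[ m ] (P m × ∀ x → P x → f m ≤ f x)
argmin P? f w with upperBound f
... | M , f<M with argmax P? (λ x → M ∸ f x) w
...   | m , pm , mx = m , pm , λ x px →
        ℕ.≮⇒≥ λ fx<fm → ℕ.<⇒≱ (ℕ.∸-monoʳ-< fx<fm (ℕ.<⇒≤ (f<M m))) (mx x px)

lex-< : ∀ {K a a' b b'} → a < a' → b < K → a * K + b < a' * K + b'
lex-< {K} {a} {a'} {b} {b'} a<a' b<K = begin-strict
  a * K + b  <⟨ ℕ.+-monoʳ-< (a * K) b<K ⟩
  a * K + K  ≡⟨ ℕ.+-comm (a * K) K ⟩
  suc a * K  ≤⟨ ℕ.*-monoˡ-≤ K a<a' ⟩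
  a' * K     ≤⟨ ℕ.m≤m+n (a' * K) b' ⟩
  a' * K + b' ∎
  where open ℕ.≤-Reasoning

lex-≤⇒≤ : ∀ {K a a' b b'} → b' < K → a * K + b ≤ a' * K + b' → a ≤ a'
lex-≤⇒≤ b'<K le = ℕ.≮⇒≥ λ a'<a → ℕ.<⇒≱ (lex-< a'<a b'<K) le

lex-injective : ∀ {K a a' b b'} → b < K → b' < K → a * K + b ≡ a' * K + b' → a ≡ a' × b ≡ b'
lex-injective {K} {a} {a'} b< b'< e
  with ℕ.≤-antisym (lex-≤⇒≤ {K} {a} {a'} b'< (ℕ.≤-reflexive e)) (lex-≤⇒≤ {K} {a'} {a} b< (ℕ.≤-reflexive (sym e)))
... | refl = refl , ℕ.+-cancelˡ-≡ (a * K) _ _ e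

-- Finite codes

bit : {P : Set} → Dec P → Fin 2
bit (yes _) = suc zero
bit (no _)  = zero

bit-transfer : {P Q : Set} (d : Dec P) (e : Dec Q) → bit d ≡ bit e → P → Q
bit-transfer (yes p) (yes q) _ _ = q
bit-transfer (no ¬p) _       _ p = contradiction p ¬p

combine-injectiveˡ : ∀ {m n} {i k : Fin m} {j l : Fin n} → combine i j ≡ combine k l → i ≡ k
combine-injectiveˡ {i = i} {k} {j} {l} e = proj₁ (Fin.combine-injective i j k l e)

combine-injectiveʳ : ∀ {m n} {i k : Fin m} {j l : Fin n} → combine i j ≡ combine k l → j ≡ l
combine-injectiveʳ {i = i} {k} {j} {l} e = proj₂ (Fin.combine-injective i j k l e)

-- Abstract, because the sizes explode when unfolded.
module Codes where

  abstract
    functions : ℕ → ℕ → ℕ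
    functions a m = m ^ a

    code : ∀ {a m} → (Fin a → Fin m) → Fin (functions a m)
    code = funToFin

    code-injective : ∀ {a m} {f g : Fin a → Fin m} → code f ≡ code g → ∀ i → f i ≡ g i
    code-injective {f = f} {g} e i =
      trans (sym (Fin.finToFun-funToFin f i)) (trans (cong (λ c → finToFun c i) e) (Fin.finToFun-funToFin g i))

    pairs : ℕ → ℕ → ℕ
    pairs m n = m * n

    pair : ∀ {m n} → Fin m → Fin n → Fin (pairs m n)
    pair = combine

    pair-injective : ∀ {m n} {i k : Fin m} {j l : Fin n} → pair i j ≡ pair k l → i ≡ k × j ≡ l
    pair-injective {i = i} {k} {j} {l} = Fin.combine-injective i j k l

open Codes public

-- Walks

walk-map : ∀ {m} {A : Fin m → Fin m → Bool} {P Q : Fin m → Set} → (∀ x → P x → Q x) →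
           ∀ {x y l} → Walk A P x y l → Walk A Q x y l
walk-map f (stay p)     = stay (f _ p)
walk-map f (step p e w) = step (f _ p) e (walk-map f w)

walk-head : ∀ {m} {A : Fin m → Fin m → Bool} {P : Fin m → Set} {x y l} → Walk A P x y l → P x
walk-head (stay p)     = p
walk-head (step p _ _) = p

_++ʷ_ : ∀ {m} {A : Fin m → Fin m → Bool} {P : Fin m → Set} {x y z l k} →
        Walk A P x y l → Walk A P y z k → Walk A P x z (l + k)
stay _     ++ʷ v = v
step p e w ++ʷ v = step p e (w ++ʷ v)

walk-snoc : ∀ {m} {A : Fin m → Fin m → Bool} {P : Fin m → Set} {x y z l} →
            Walk A P x y l → A y z ≡ true → P z → Walk A P x z (suc l)
walk-snoc (stay p)     e q = step p e (stay q)
walk-snoc (step p e w) f q = step p e (walk-snoc w f q)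

walk-reverse : ∀ {m} {A : Fin m → Fin m → Bool} {P : Fin m → Set} → (∀ x y → A x y ≡ A y x) →
               ∀ {x y l} → Walk A P x y l → Walk A P y x l
walk-reverse A-sym (stay p)     = stay p
walk-reverse A-sym (step p e w) = walk-snoc (walk-reverse A-sym w) (trans (A-sym _ _) e) p

-- Elimination structures

-- Up v is the closed up-set of v in a perfect elimination ordering: v together with its
-- neighbours of smaller rank.  The names form a colouring that is injective on cliques.
record Elim (N B : ℕ) : Set₁ where
  field
    rank      : Fin N → ℕ
    rank-inj  : ∀ {u v} → rank u ≡ rank v → u ≡ v
    Up        : Fin N → Fin N → Set
    up?       : ∀ v u → Dec (Up v u)
    up-refl   : ∀ {v} → Up v v
    up-≤      : ∀ {v u} → Up v u → rank u ≤ rank v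
    up-closed : ∀ {v y z} → Up v y → Up v z → rank y ≤ rank z → Up z y
    name      : Fin N → Fin B
    name-inj  : ∀ {v y z} → Up v y → Up v z → name y ≡ name z → y ≡ z

record RootedElim (N B : ℕ) : Set₁ where
  field
    elim    : Elim N B
    root    : Fin N
  open Elim elim public
  field
    up-root : ∀ {v} → Up v root

module _ {N B : ℕ} (R : Elim N B) where
  open Elim R

  -- A lowest vertex lying in all up-sets makes any two of them meet, so that largest common
  -- elements exist, and it turns the elimination forest into a tree.
  addRoot : RootedElim (suc N) (suc B)
  addRoot = record
    { elim = record
      { rank = rank⁺ ; rank-inj = λ {u} {v} → inj u v ; Up = Up⁺ ; up? = up⁺?
      ; up-refl = λ {v} → refl⁺ v ; up-≤ = λ {v} {u} → ≤⁺ v u ; up-closed = λ {v} {y} {z} → closed⁺ v y z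
      ; name = name⁺ ; name-inj = λ {v} {y} {z} → name-inj⁺ v y z }
    ; root = zero
    ; up-root = λ {v} → root⁺ v }
    where
    rank⁺ : Fin (suc N) → ℕ
    rank⁺ zero    = 0
    rank⁺ (suc v) = suc (rank v)
    inj : ∀ u v → rank⁺ u ≡ rank⁺ v → u ≡ v
    inj zero    zero    _ = refl
    inj (suc u) (suc v) e = cong suc (rank-inj (ℕ.suc-injective e))
    Up⁺ : Fin (suc N) → Fin (suc N) → Set
    Up⁺ _       zero    = ⊤
    Up⁺ zero    (suc u) = ⊥
    Up⁺ (suc v) (suc u) = Up v u
    up⁺? : ∀ v u → Dec (Up⁺ v u)
    up⁺? zero    zero    = yes tt
    up⁺? (suc v) zero    = yes tt
    up⁺? zero    (suc u) = no λ ()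
    up⁺? (suc v) (suc u) = up? v u
    refl⁺ : ∀ v → Up⁺ v v
    refl⁺ zero    = tt
    refl⁺ (suc v) = up-refl
    root⁺ : ∀ v → Up⁺ v zero
    root⁺ _ = tt
    ≤⁺ : ∀ v u → Up⁺ v u → rank⁺ u ≤ rank⁺ v
    ≤⁺ v       zero    _ = z≤n
    ≤⁺ (suc v) (suc u) p = s≤s (up-≤ p)
    closed⁺ : ∀ v y z → Up⁺ v y → Up⁺ v z → rank⁺ y ≤ rank⁺ z → Up⁺ z y
    closed⁺ v       zero    z       p q le = tt
    closed⁺ (suc v) (suc y) zero    p q ()
    closed⁺ (suc v) (suc y) (suc z) p q le = up-closed p q (ℕ.s≤s⁻¹ le)
    name⁺ : Fin (suc N) → Fin (suc B)
    name⁺ zero    = zero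
    name⁺ (suc v) = suc (name v)
    name-inj⁺ : ∀ v y z → Up⁺ v y → Up⁺ v z → name⁺ y ≡ name⁺ z → y ≡ z
    name-inj⁺ v       zero    zero    p q e = refl
    name-inj⁺ (suc v) (suc y) (suc z) p q e = cong suc (name-inj p q (Fin.suc-injective e))

-- Greedy naming: a name for v is chosen once all vertices of smaller rank have theirs.
module Greedy {N : ℕ} (rank : Fin N → ℕ) (rank-inj : ∀ {u v} → rank u ≡ rank v → u ≡ v)
              (Up : Fin N → Fin N → Set) (up? : ∀ v u → Dec (Up v u))
              (up-refl : ∀ {v} → Up v v) (up-≤ : ∀ {v u} → Up v u → rank u ≤ rank v)
              (up-closed : ∀ {v y z} → Up v y → Up v z → rank y ≤ rank z → Up z y)
              (c : ℕ) (few : ∀ v → ∣ select (up? v) ∣ ≤ c) where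

  Proper : ℕ → (Fin N → Fin (suc c)) → Set
  Proper r f = ∀ v u → rank v < r → Up v u → u ≢ v → f u ≢ f v

  -- Pigeonhole: if all `suc c` names were taken, one bearer for each would give an injection into
  -- an up-set of at most `c` elements.
  free : (f : Fin N → Fin (suc c)) (v : Fin N) → ∃[ b ] (∀ u → Up v u → u ≢ v → f u ≢ b)
  free f v with any? (λ b → ¬? (any? (λ u → up? v u ×-dec (¬? (u ≟ v) ×-dec (f u ≟ b)))))
  ... | yes (b , none) = b , λ u p u≢v e → none (u , p , u≢v , e)
  ... | no all-used = contradiction (injectiveInto⇒≤∣∣ (select (up? v)) (proj₁ ∘ used) inj (λ b → ⇒∈-select (up? v) (proj₁ (proj₂ (used b)))))
                        (ℕ.<⇒≱ (s≤s (few v)))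
    where
    used : ∀ b → ∃[ u ] (Up v u × u ≢ v × f u ≡ b)
    used b with any? (λ u → up? v u ×-dec (¬? (u ≟ v) ×-dec (f u ≟ b)))
    ... | yes h = h
    ... | no ¬h = contradiction (b , ¬h) all-used
    inj : Injective _≡_ _≡_ (proj₁ ∘ used)
    inj {b} {b'} e = trans (sym (proj₂ (proj₂ (proj₂ (used b))))) (trans (cong f e) (proj₂ (proj₂ (proj₂ (used b')))))

  abstract
    extendNames : ∀ r → ∃ (Proper r)
    extendNames zero = (λ _ → zero) , λ _ _ ()
    extendNames (suc r) with extendNames r | any? (λ v → rank v ℕ.≟ r)
    ... | f , ok | no none = f , λ v u v<r → ok v u (ℕ.≤∧≢⇒< (ℕ.s≤s⁻¹ v<r) (λ e → none (v , e)))
    ... | f , ok | yes (v₀ , refl) = g , proper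
      where
      g : Fin N → Fin (suc c)
      g v with v ≟ v₀
      ... | yes _ = proj₁ (free f v₀)
      ... | no  _ = f v
      proper : Proper (suc r) g
      proper v u v<r p u≢v with v ≟ v₀ | u ≟ v₀
      ... | yes refl | yes refl = contradiction refl u≢v
      ... | yes refl | no _     = proj₂ (free f v₀) u p u≢v
      ... | no v≢    | no _     = ok v u (ℕ.≤∧≢⇒< (ℕ.s≤s⁻¹ v<r) (λ e → v≢ (rank-inj e))) p u≢v
      -- Renaming `v₀` cannot spoil another vertex treated so far: `v₀` in its up-set would force
      -- equal ranks.
      ... | no v≢    | yes refl = contradiction (rank-inj (ℕ.≤-antisym (ℕ.s≤s⁻¹ v<r) (up-≤ p))) v≢

  greedy : Elim N (suc c)
  greedy = record
    { rank = rank ; rank-inj = rank-inj ; Up = Up ; up? = up? ; up-refl = up-refl ; up-≤ = up-≤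
    ; up-closed = up-closed ; name = f ; name-inj = inj }
    where
    <M = proj₂ (upperBound rank)
    f = proj₁ (extendNames (proj₁ (upperBound rank)))
    ok = proj₂ (extendNames (proj₁ (upperBound rank)))
    inj : ∀ {v y z} → Up v y → Up v z → f y ≡ f z → y ≡ z
    inj {v} {y} {z} p q e with y ≟ z | ℕ.≤-total (rank y) (rank z)
    ... | yes y≡z | _ = y≡z
    ... | no y≢z | inj₁ le = contradiction e (ok z y (<M z) (up-closed p q le) y≢z)
    ... | no y≢z | inj₂ ge = contradiction (sym e) (ok y z (<M y) (up-closed q p ge) (y≢z ∘ sym))

-- Tree decompositions from elimination structures

module _ (G : Graph) {k} (c : Fin (suc (suc (suc k))) → V G)
         (edges : ∀ (i : Fin (suc (suc k))) → E G (c (inject₁ i)) (c (suc i)))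
         (close : E G (c (fromℕ (suc (suc k)))) (c zero)) where

  cycle-neighbours : ∀ i → ∃₂ λ j j' → j ≢ j' × E G (c i) (c j) × E G (c i) (c j')
  cycle-neighbours zero = suc zero , fromℕ (suc (suc k)) , (λ ()) , edges zero , trans (Graph.sym G _ _) close
  cycle-neighbours (suc i) with view i
  ... | ‵fromℕ = inject₁ (fromℕ (suc k)) , zero , (λ ()) , trans (Graph.sym G _ _) (edges i) , close
  ... | ‵inject₁ j = inject₁ (inject₁ j) , suc (suc j) , ne , trans (Graph.sym G _ _) (edges i) , edges (suc j)
    where
    ne : inject₁ (inject₁ j) ≢ suc (suc j)
    ne e = ℕ.m≢1+m+n (toℕ j) {1} (trans (sym (trans (Fin.toℕ-inject₁ (inject₁ j)) (Fin.toℕ-inject₁ j)))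
             (trans (cong toℕ e) (cong suc (ℕ.+-comm 1 (toℕ j)))))

module EliminationTree {N B : ℕ} (R : RootedElim N B) where
  open RootedElim R

  parent′ : ∀ v → v ≢ root → ∃[ p ] ((Up v p × p ≢ v) × ∀ u → Up v u × u ≢ v → rank u ≤ rank p)
  parent′ v v≢r = argmax (λ u → up? v u ×-dec ¬? (u ≟ v)) rank (root , up-root , v≢r ∘ sym)

  parent : Fin N → Fin N
  parent v with v ≟ root
  ... | yes _  = root
  ... | no v≢r = proj₁ (parent′ v v≢r)

  up-parent : ∀ v → Up v (parent v)
  up-parent v with v ≟ root
  ... | yes _  = up-root
  ... | no v≢r = proj₁ (proj₁ (proj₂ (parent′ v v≢r)))

  parent-max : ∀ v → v ≢ root → ∀ u → Up v u → u ≢ v → rank u ≤ rank (parent v)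
  parent-max v v≢r u p u≢v with v ≟ root
  ... | yes e  = contradiction e v≢r
  ... | no v≢r = proj₂ (proj₂ (parent′ v v≢r)) u (p , u≢v)

  parent-< : ∀ v → v ≢ root → rank (parent v) < rank v
  parent-< v v≢r = ℕ.≤∧≢⇒< (up-≤ (up-parent v)) (λ e → ≢v (rank-inj e))
    where
    ≢v : parent v ≢ v
    ≢v with v ≟ root
    ... | yes e  = contradiction e v≢r
    ... | no v≢r = proj₂ (proj₁ (proj₂ (parent′ v v≢r)))

  parent-≤ : ∀ v → rank (parent v) ≤ rank v
  parent-≤ v = up-≤ (up-parent v)

  adjacent? : ∀ u v → Dec (u ≢ v × (parent u ≡ v ⊎ parent v ≡ u))
  adjacent? u v = ¬? (u ≟ v) ×-dec ((parent u ≟ v) ⊎-dec (parent v ≟ u))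

  tree : Graph
  tree = record
    { size = N
    ; adj  = λ u v → does (adjacent? u v)
    ; sym  = λ u v → does-cong (adjacent? u v) (adjacent? v u) flip flip
    ; irr  = λ u → dec-false (adjacent? u u) (λ (ne , _) → ne refl)
    }
    where
    flip : ∀ {u v} → u ≢ v × (parent u ≡ v ⊎ parent v ≡ u) → v ≢ u × (parent v ≡ u ⊎ parent u ≡ v)
    flip (ne , inj₁ e) = ne ∘ sym , inj₂ e
    flip (ne , inj₂ e) = ne ∘ sym , inj₁ e

  -- The parent has the highest rank among the proper members of `Up v`, so closedness puts all of
  -- these into `Up (parent v)`. Following parents thus keeps `u` in the up-set until `u` itself is
  -- reached.
  climb′ : ∀ n v u → rank v < n → Up v u → ∃[ l ] Walk (adj tree) (λ w → Up w u) v u l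
  climb′ (suc n) v u <n p with v ≟ u
  ... | yes refl = 0 , stay p
  ... | no v≢u = _ , step p (dec-true (adjacent? v (parent v)) (v≢p , inj₁ refl))
                       (proj₂ (climb′ n (parent v) u (ℕ.≤-trans (parent-< v v≢r) (ℕ.s≤s⁻¹ <n))
                         (up-closed p (up-parent v) (parent-max v v≢r u p (v≢u ∘ sym)))))
    where
    v≢r : v ≢ root
    v≢r refl = v≢u (rank-inj (ℕ.≤-antisym (up-≤ up-root) (up-≤ p)))
    v≢p : v ≢ parent v
    v≢p e = ℕ.<-irrefl (cong rank (sym e)) (parent-< v v≢r)

  climb : ∀ v u → Up v u → ∃[ l ] Walk (adj tree) (λ w → Up w u) v u l
  climb v u = climb′ _ v u ℕ.≤-refl

  -- At the vertex of highest rank on a cycle, both cycle neighbours would have to be its parent.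
  acyclic : Acyclic tree
  acyclic k c inj edges close
    with argmax {P = λ _ → ⊤} (λ _ → yes tt) (rank ∘ c) (zero , tt)
  ... | i , _ , top with cycle-neighbours tree c edges close i
  ...   | j , j' , j≢j' , e , e' = j≢j' (inj (trans (sym (above j e)) (above j' e')))
    where
    above : ∀ j → E tree (c i) (c j) → parent (c i) ≡ c j
    above j e with does⇒ (adjacent? (c i) (c j)) e
    ... | _  , inj₁ q = q
    ... | ne , inj₂ q = contradiction (rank-inj (ℕ.≤-antisym (subst (λ w → rank w ≤ rank (c j)) q (parent-≤ (c j))) (top j tt))) ne

  module _ (F : Graph) {b : ℕ} (home : V F → Fin N) (slot : V F → Fin b)
           (placed : ∀ x y → home x ≡ home y → slot x ≡ slot y → x ≡ y)
           (together : ∀ x y → E F x y → ∃[ i ] (Up i (home x) × Up i (home y))) where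

    private
      inBag? : ∀ i x → Dec (Up i (home x))
      inBag? i x = up? i (home x)

    -- The bag at `i` holds everything whose home lies in `Up i`; there the name of the home and the
    -- slot identify a vertex, which gives the factor `B * b`. Bags containing `x` are connected
    -- because each of their nodes can climb to the home of `x`.
    blowUp : TW≤ F (B * b)
    blowUp = record
      { T = tree
      ; isTree = ℕ.≤-trans (s≤s z≤n) (Fin.toℕ<n root)
               , (λ x y → _ , proj₂ (down x) ++ʷ walk-reverse (Graph.sym tree) (proj₂ (down y)))
               , acyclic
      ; bag = λ i → select (inBag? i)
      ; covers = λ x → home x , ⇒∈-select (inBag? (home x)) up-refl
      ; edgeIn = λ x y e → let (i , p , q) = together x y e in i , ⇒∈-select (inBag? i) p , ⇒∈-select (inBag? i) q
      ; subtree = λ x i j p q → _ , walk-map (λ w → ⇒∈-select (inBag? w))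
          (proj₂ (climb i (home x) (∈-select⇒ (inBag? i) p))
           ++ʷ walk-reverse (Graph.sym tree) (proj₂ (climb j (home x) (∈-select⇒ (inBag? j) q))))
      ; width = λ i → ℕ.m≤n⇒m≤1+n (injectiveOn⇒∣∣≤ (select (inBag? i)) (λ x → combine (name (home x)) (slot x))
          λ x y p q e → placed x y (name-inj (∈-select⇒ (inBag? i) p) (∈-select⇒ (inBag? i) q) (combine-injectiveˡ e)) (combine-injectiveʳ {i = name (home x)} e))
      }
      where
      down : ∀ x → ∃[ l ] Walk (adj tree) Anywhere x root l
      down x = _ , walk-map (λ _ _ → tt) (proj₂ (climb x root up-root))

TW-mono : ∀ {G k k'} → k ≤ k' → TW≤ G k → TW≤ G k'
TW-mono le D = record
  { T = T ; isTree = isTree ; bag = bag ; covers = covers ; edgeIn = edgeIn ; subtree = subtree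
  ; width = λ i → ℕ.≤-trans (width i) (s≤s le) }
  where open TreeDecomposition D

-- Elimination structures from tree decompositions

module AcyclicOrder (T : Graph) (acyclic : Acyclic T) where

  module _ {R : V T → Set} (R? : ∀ x → Dec (R x)) where

    Branching : V T → Set
    Branching i = ∃₂ λ j j' → R j × R j' × E T i j × E T i j' × j ≢ j'

    branching? : ∀ i → Dec (Branching i)
    branching? i = any? λ j → any? λ j' → R? j ×-dec (R? j' ×-dec
      ((adj T i j Bool.≟ true) ×-dec ((adj T i j' Bool.≟ true) ×-dec ¬? (j ≟ j'))))

    module NonBacktracking (branch : ∀ i → R i → Branching i) where

      State : Set
      State = Σ (V T) λ p → Σ (V T) λ c → R c × E T p c

      forth : (p c : V T) → R c → ∃[ z ] (R z × E T c z × z ≢ p)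
      forth p c r with branch c r
      ... | j , j' , rj , rj' , e , e' , j≢j' with j ≟ p
      ...   | no j≢p   = j , rj , e , j≢p
      ...   | yes refl = j' , rj' , e' , j≢j' ∘ sym

      next : State → State
      next (p , c , r , e) = let (z , rz , ez , _) = forth p c r in c , z , rz , ez

      module _ (start : State) where
        state : ℕ → State
        state zero    = start
        state (suc t) = next (state t)

        w : ℕ → V T
        w t = proj₁ (state t)

        w-edge : ∀ t → E T (w t) (w (suc t))
        w-edge t = proj₂ (proj₂ (proj₂ (state t)))

        w-turn : ∀ t → w t ≢ w (suc (suc t))
        w-turn t e = let (p , c , r , _) = state t in proj₂ (proj₂ (proj₂ (forth p c r))) (sym e)

        -- Strong induction on the length of the return, with `n` as fuel. A repetition inside the
        -- stretch is a shorter return; without one, the stretch is a loop, an immediate turn back,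
        -- or a cycle on at least three vertices.
        no-return : ∀ n d s → d < n → w s ≢ w (s + suc d)
        no-return (suc n) d s (s≤s d≤n) e
          with any? {n = suc d} (λ b → any? {n = toℕ b} (λ a → w (s + toℕ a) ≟ w (s + toℕ b)))
        ... | yes (b , a , eq) = no-return n (toℕ b ∸ suc (toℕ a)) (s + toℕ a)
                (ℕ.≤-trans (ℕ.∸-monoʳ-< {o = 0} (s≤s z≤n) (Fin.toℕ<n a)) (ℕ.≤-trans (ℕ.s≤s⁻¹ (Fin.toℕ<n b)) d≤n))
                (trans eq (cong w (sym (trans (ℕ.+-assoc s (toℕ a) _) (cong (s +_)
                  (trans (ℕ.+-suc (toℕ a) _) (ℕ.m+[n∸m]≡n (Fin.toℕ<n a))))))))
        ... | no distinct = absurd d e distinct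
          where
          absurd : ∀ d → w s ≡ w (s + suc d) → ¬ (∃[ b ] ∃[ a ] (w (s + toℕ {toℕ {suc d} b} a) ≡ w (s + toℕ b))) → ⊥
          absurd zero e _ = true≢false (subst (E T (w s)) (sym e) (subst (λ t → E T (w s) (w t)) (ℕ.+-comm 1 s) (w-edge s))) (irr T (w s))
          absurd (suc zero) e _ = w-turn s (trans e (cong w (ℕ.+-comm s 2)))
          absurd (suc (suc k)) e distinct = acyclic k (λ i → w (s + toℕ i)) inj
            (λ i → subst₂ (λ a b → E T (w (s + a)) (w b)) (sym (Fin.toℕ-inject₁ i)) (sym (ℕ.+-suc s (toℕ i))) (w-edge (s + toℕ i)))
            (subst₂ (E T) (cong (λ a → w (s + a)) (sym (Fin.toℕ-fromℕ (suc (suc k)))))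
              (trans (cong w (sym (ℕ.+-suc s (suc (suc k))))) (trans (sym e) (cong w (sym (ℕ.+-identityʳ s)))))
              (w-edge (s + suc (suc k))))
            where
            before : ∀ (a b : Fin (suc (suc (suc k)))) → toℕ a < toℕ b → w (s + toℕ a) ≢ w (s + toℕ b)
            before a b a<b eq = distinct (b , fromℕ< a<b , trans (cong (λ t → w (s + t)) (Fin.toℕ-fromℕ< a<b)) eq)
            inj : Injective _≡_ _≡_ (λ i → w (s + toℕ i))
            inj {a} {b} eq with ℕ.<-cmp (toℕ a) (toℕ b)
            ... | tri< a<b _ _ = contradiction eq (before a b a<b)
            ... | tri≈ _ a≡b _ = Fin.toℕ-injective a≡b
            ... | tri> _ _ b<a = contradiction (sym eq) (before b a b<a)

        repeats : ⊥
        repeats with Fin.pigeonhole (ℕ.n<1+n (size T)) (λ i → w (toℕ i))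
        ... | i , j , i<j , e = no-return _ (toℕ j ∸ suc (toℕ i)) (toℕ i) ℕ.≤-refl
                (trans e (cong w (sym (trans (ℕ.+-suc (toℕ i) _) (ℕ.m+[n∸m]≡n i<j)))))

    endpoint : ∃ R → ∃[ i ] (R i × ¬ Branching i)
    endpoint (r , pr) with any? (λ i → R? i ×-dec ¬? (branching? i))
    ... | yes h = h
    ... | no ¬h = ⊥-elim (repeats (let (j , _ , rj , _ , e , _) = branch r pr in r , j , rj , e))
      where
      branch : ∀ i → R i → Branching i
      branch i p with branching? i
      ... | yes b = b
      ... | no ¬b = contradiction (i , p , ¬b) ¬h
      open NonBacktracking branch

  OneEarlier : (V T → Set) → (V T → ℕ) → Set
  OneEarlier R pos = ∀ i j j' → R i → R j → R j' → E T i j → E T i j' → pos j < pos i → pos j' < pos i → j ≡ j'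

  -- A vertex with at most one neighbour in `R` can safely take the last position, and the rest is
  -- ordered recursively. The earlier neighbour then acts as a parent, without any choice of a root.
  order′ : ∀ s {R : V T → Set} (R? : ∀ x → Dec (R x)) → ∣ select R? ∣ ≤ s →
    Σ (V T → ℕ) λ pos → (∀ i → R i → pos i < s) × (∀ i j → R i → R j → pos i ≡ pos j → i ≡ j) × OneEarlier R pos
  order′ s {R} R? le with any? R?
  ... | no none = (λ _ → 0) , (λ i r → contradiction (i , r) none) , (λ i j r → contradiction (i , r) none)
                  , (λ i j j' r → contradiction (i , r) none)
  ... | yes some with endpoint R? some
  ...   | i₀ , r₀ , end = step-order s le
    where
    R'? : ∀ x → Dec (R x × x ≢ i₀)
    R'? x = R? x ×-dec ¬? (x ≟ i₀)
    smaller : ∣ select R'? ∣ < ∣ select R? ∣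
    smaller = Subset.p⊂q⇒∣p∣<∣q∣ ((λ x∈ → ⇒∈-select R? (proj₁ (∈-select⇒ R'? x∈)))
                , i₀ , ⇒∈-select R? r₀ , λ i∈ → proj₂ (∈-select⇒ R'? i∈) refl)
    step-order : ∀ s → ∣ select R? ∣ ≤ s →
      Σ (V T → ℕ) λ pos → (∀ i → R i → pos i < s) × (∀ i j → R i → R j → pos i ≡ pos j → i ≡ j) × OneEarlier R pos
    step-order zero le = contradiction (ℕ.≤-trans smaller le) λ ()
    step-order (suc s) le with order′ s R'? (ℕ.s≤s⁻¹ (ℕ.≤-trans smaller le))
    ... | pos' , bound' , inj' , one' = pos , bound , inj , one
      where
      pos : V T → ℕ
      pos x with x ≟ i₀
      ... | yes _ = s
      ... | no  _ = pos' x
      bound : ∀ i → R i → pos i < suc s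
      bound i r with i ≟ i₀
      ... | yes _ = ℕ.≤-refl
      ... | no ne = ℕ.m≤n⇒m≤1+n (bound' i (r , ne))
      inj : ∀ i j → R i → R j → pos i ≡ pos j → i ≡ j
      inj i j ri rj e with i ≟ i₀ | j ≟ i₀
      ... | yes refl | yes refl = refl
      ... | yes refl | no ne = contradiction (sym e) (ℕ.<⇒≢ (bound' j (rj , ne)))
      ... | no ne | yes refl = contradiction e (ℕ.<⇒≢ (bound' i (ri , ne)))
      ... | no ni | no nj = inj' i j (ri , ni) (rj , nj) e
      one : OneEarlier R pos
      one i j j' ri rj rj' e e' lt lt' with i ≟ i₀ | j ≟ i₀ | j' ≟ i₀
      ... | yes refl | _ | _ with j ≟ j'
      ...   | yes q = q
      ...   | no q = contradiction (j , j' , rj , rj' , e , e' , q) end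
      one i j j' ri rj rj' e e' lt lt' | no ni | yes refl | _ = contradiction lt (ℕ.<⇒≯ (bound' i (ri , ni)))
      one i j j' ri rj rj' e e' lt lt' | no ni | no nj | yes refl = contradiction lt' (ℕ.<⇒≯ (bound' i (ri , ni)))
      one i j j' ri rj rj' e e' lt lt' | no ni | no nj | no nj' = one' i j j' (ri , ni) (rj , nj) (rj' , nj') e e' lt lt'

  order : Σ (V T → ℕ) λ pos → (∀ i j → pos i ≡ pos j → i ≡ j) ×
            (∀ i j j' → E T i j → E T i j' → pos j < pos i → pos j' < pos i → j ≡ j')
  order with order′ (size T) {λ _ → ⊤} (λ _ → yes tt) (Subset.∣p∣≤n (select {P = λ _ → ⊤} (λ _ → yes tt)))
  ... | pos , _ , inj , one = pos , (λ i j → inj i j tt tt) , (λ i j j' → one i j j' tt tt tt)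

module FromTreeDecomposition {G : Graph} {k : ℕ} (D : TW≤ G k) where
  open TreeDecomposition D

  private
    ordered = AcyclicOrder.order T (proj₂ (proj₂ isTree))

  pos : V T → ℕ
  pos = proj₁ ordered

  pos-inj : ∀ i j → pos i ≡ pos j → i ≡ j
  pos-inj = proj₁ (proj₂ ordered)

  one-earlier : ∀ i j j' → E T i j → E T i j' → pos j < pos i → pos j' < pos i → j ≡ j'
  one-earlier = proj₂ (proj₂ ordered)

  -- A walk to an earlier node has to pass through the only earlier neighbour of `i`. If it first
  -- moves to a later node `i'`, it must come back: the only earlier neighbour of `i'` is `i`, so a
  -- shorter walk from `i` remains.
  descend : ∀ n {P : V T → Set} {i j l} → Walk (adj T) P i j l → pos j < pos i → l < n →
            ∃₂ λ p l' → E T i p × pos p < pos i × Walk (adj T) P p j l' × l' < l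
  descend (suc n) (stay _) lt _ = contradiction refl (ℕ.<⇒≢ lt)
  descend (suc n) {i = i} {j} (step {y = i'} _ e w) lt (s≤s l<n) with ℕ.<-cmp (pos i') (pos i)
  ... | tri< i'<i _ _ = i' , _ , e , i'<i , w , ℕ.≤-refl
  ... | tri≈ _ eq _ = ⊥-elim (true≢false (subst (E T i) (pos-inj i' i eq) e) (irr T i))
  ... | tri> _ _ i<i' with descend n w (ℕ.<-trans lt i<i') l<n
  ...   | p , l' , e' , p<i' , w' , l'<l with one-earlier i' p i e' (trans (Graph.sym T i' i) e) p<i' i<i'
  ...     | refl with descend n w' lt (ℕ.<-trans l'<l l<n)
  ...       | q , l″ , eq , q< , w″ , l″< = q , l″ , eq , q< , w″ , ℕ.<-trans l″< (ℕ.m<n⇒m<1+n l'<l)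

  inBag? : ∀ v i → Dec (v ∈ bag i)
  inBag? v i = Subset._∈?_ v (bag i)

  private
    top′ : ∀ v → ∃[ i ] (v ∈ bag i × ∀ j → v ∈ bag j → pos i ≤ pos j)
    top′ v = argmin (inBag? v) pos (covers v)

  top : V G → V T
  top v = proj₁ (top′ v)

  top-∈ : ∀ v → v ∈ bag (top v)
  top-∈ v = proj₁ (proj₂ (top′ v))

  top-least : ∀ {v j} → v ∈ bag j → pos (top v) ≤ pos j
  top-least {v} = proj₂ (proj₂ (top′ v)) _

  -- As long as `i` is not `top z`, the subtrees of `y` and `z` both contain nodes earlier than `i`,
  -- so both contain its only earlier neighbour. Moving there repeatedly ends at `top z`, with `y`
  -- still in the bag.
  shared : ∀ n {i y z} → pos i < n → y ∈ bag i → z ∈ bag i → pos (top y) ≤ pos (top z) → y ∈ bag (top z)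
  shared (suc n) {i} {y} {z} (s≤s i<n) y∈ z∈ le with i ≟ top z
  ... | yes refl = y∈
  ... | no ne
    with descend _ (proj₂ (subtree z i (top z) z∈ (top-∈ z))) z<i ℕ.≤-refl
       | descend _ (proj₂ (subtree y i (top y) y∈ (top-∈ y))) (ℕ.≤-<-trans le z<i) ℕ.≤-refl
    where
    z<i : pos (top z) < pos i
    z<i = ℕ.≤∧≢⇒< (top-least z∈) (λ e → ne (sym (pos-inj _ _ e)))
  ...   | p , _ , e , p<i , w , _ | p' , _ , e' , p'<i , w' , _ with one-earlier i p p' e e' p<i p'<i
  ...     | refl = shared n (ℕ.<-≤-trans p<i i<n) (walk-head w') (walk-head w) le

  -- Several vertices may share a top bag; the vertex number breaks such ties.
  rank : V G → ℕ
  rank v = pos (top v) * size G + toℕ v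

  rank-≤⇒ : ∀ {u v} → rank u ≤ rank v → pos (top u) ≤ pos (top v)
  rank-≤⇒ {u} {v} = lex-≤⇒≤ (Fin.toℕ<n v)

  Up : V G → V G → Set
  Up v u = u ∈ bag (top v) × rank u ≤ rank v

  up? : ∀ v u → Dec (Up v u)
  up? v u = inBag? u (top v) ×-dec (rank u ℕ.≤? rank v)

  abstract
    elim : Elim (size G) (suc (suc k))
    elim = Greedy.greedy rank (λ {u} {v} e → Fin.toℕ-injective (proj₂ (lex-injective {a = pos (top u)} {pos (top v)} (Fin.toℕ<n u) (Fin.toℕ<n v) e)))
      Up up? (λ {v} → top-∈ v , ℕ.≤-refl) proj₂
      (λ (y∈ , _) (z∈ , _) le → shared _ ℕ.≤-refl y∈ z∈ (rank-≤⇒ le) , le)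
      (suc k) (λ v → ℕ.≤-trans (Subset.p⊆q⇒∣p∣≤∣q∣ (λ u∈ → proj₁ (∈-select⇒ (up? v) u∈))) (width (top v)))

    edge-up : ∀ u v → E G u v → Elim.Up elim v u ⊎ Elim.Up elim u v
    edge-up u v e with edgeIn u v e | ℕ.≤-total (rank u) (rank v)
    ... | i , u∈ , v∈ | inj₁ le = inj₁ (shared _ ℕ.≤-refl u∈ v∈ (rank-≤⇒ le) , le)
    ... | i , u∈ , v∈ | inj₂ ge = inj₂ (shared _ ℕ.≤-refl v∈ u∈ (rank-≤⇒ ge) , ge)

-- Representative families

repSize : ℕ → ℕ → ℕ
repSize B zero    = 1
repSize B (suc s) = suc (B * repSize B s)

-- For every α avoided by some member of C, a member of the family avoids α as well: take any
-- member y₀ of C; if it meets α in u, continue with the members of C that avoid u.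
module Representatives {N B : ℕ} (name : Fin N → Fin B)
  {U : Fin N → Fin N → Set} (U? : ∀ y u → Dec (U y u))
  (U-name : ∀ {y u v} → U y u → U y v → name u ≡ name v → u ≡ v) where

  mutual
    reps : ∀ s {C : Fin N → Set} → (∀ y → Dec (C y)) → Fin (repSize B s) → Maybe (Fin N)
    reps s C? = repsFrom s C? (any? C?)

    repsFrom : ∀ s {C : Fin N → Set} → (∀ y → Dec (C y)) → Dec (∃ C) → Fin (repSize B s) → Maybe (Fin N)
    repsFrom s       C? (no _)         _       = nothing
    repsFrom zero    C? (yes (y₀ , _)) _       = just y₀
    repsFrom (suc s) C? (yes (y₀ , _)) zero    = just y₀
    repsFrom (suc s) C? (yes (y₀ , _)) (suc i) = repsMeeting s C? y₀ (remQuot (repSize B s) i)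

    repsMeeting : ∀ s {C : Fin N → Set} → (∀ y → Dec (C y)) → Fin N → Fin B × Fin (repSize B s) → Maybe (Fin N)
    repsMeeting s C? y₀ (b , j) = repsAvoiding s C? (any? (λ u → U? y₀ u ×-dec (name u ≟ b))) j

    repsAvoiding : ∀ s {C : Fin N → Set} → (∀ y → Dec (C y)) → ∀ {y₀ b} →
                   Dec (∃[ u ] (U y₀ u × name u ≡ b)) → Fin (repSize B s) → Maybe (Fin N)
    repsAvoiding s C? (no _)        j = nothing
    repsAvoiding s C? (yes (u , _)) j = reps s (λ y → C? y ×-dec ¬? (U? y u)) j

  mutual
    reps-sound : ∀ s {C : Fin N → Set} (C? : ∀ y → Dec (C y)) {i y} → reps s C? i ≡ just y → C y
    reps-sound s C? e = repsFrom-sound s C? (any? C?) e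

    repsFrom-sound : ∀ s {C : Fin N → Set} (C? : ∀ y → Dec (C y)) (d : Dec (∃ C)) {i y} → repsFrom s C? d i ≡ just y → C y
    repsFrom-sound zero    C? (yes (y₀ , c)) refl = c
    repsFrom-sound (suc s) C? (yes (y₀ , c)) {zero} refl = c
    repsFrom-sound (suc s) C? (yes (y₀ , c)) {suc i} e
      with any? (λ u → U? y₀ u ×-dec (name u ≟ proj₁ (remQuot {B} (repSize B s) i)))
    ... | yes (u , _) = proj₁ (reps-sound s (λ y → C? y ×-dec ¬? (U? y u)) e)

  mutual
    reps-complete : ∀ s {C : Fin N → Set} (C? : ∀ y → Dec (C y)) (α : Fin s → Fin N) →
      ∃[ y ] (C y × ∀ k → ¬ U y (α k)) → ∃₂ λ j y → reps s C? j ≡ just y × ∀ k → ¬ U y (α k)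
    reps-complete s C? α w = repsFrom-complete s C? (any? C?) α w

    repsFrom-complete : ∀ s {C : Fin N → Set} (C? : ∀ y → Dec (C y)) (d : Dec (∃ C)) (α : Fin s → Fin N) →
      ∃[ y ] (C y × ∀ k → ¬ U y (α k)) → ∃₂ λ j y → repsFrom s C? d j ≡ just y × ∀ k → ¬ U y (α k)
    repsFrom-complete s       C? (no none)       α (y , c , _) = contradiction (y , c) none
    repsFrom-complete zero    C? (yes (y₀ , c₀)) α _ = zero , y₀ , refl , λ ()
    repsFrom-complete (suc s) C? (yes (y₀ , c₀)) α (y , c , av) with any? (λ k → U? y₀ (α k))
    ... | no disjoint = zero , y₀ , refl , λ k p → disjoint (k , p)
    ... | yes (k₀ , p₀)
      with reps-complete s (λ y → C? y ×-dec ¬? (U? y (α k₀))) (α ∘ punchIn k₀) (y , (c , av k₀) , av ∘ punchIn k₀)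
    ...   | j , y₁ , e , av₁ = suc (combine (name (α k₀)) j) , y₁ , found , avoid
      where
      found : repsFrom (suc s) C? (yes (y₀ , c₀)) (suc (combine (name (α k₀)) j)) ≡ just y₁
      found = trans (cong (repsMeeting s C? y₀) (Fin.remQuot-combine (name (α k₀)) j)) met
        where
        met : repsMeeting s C? y₀ (name (α k₀) , j) ≡ just y₁
        met with any? (λ u → U? y₀ u ×-dec (name u ≟ name (α k₀)))
        ... | no none = contradiction (α k₀ , p₀ , refl) none
        -- Only one vertex of `U y₀` bears this name, so the branch stored under it is the one that
        -- avoids `α k₀`.
        ... | yes (u , p , q) with U-name p p₀ q
        ...   | refl = e
      avoid : ∀ k → ¬ U y₁ (α k)
      avoid k p with k₀ ≟ k
      ... | yes refl = proj₂ (reps-sound s (λ y → C? y ×-dec ¬? (U? y (α k₀))) e) p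
      ... | no ne    = av₁ (punchOut ne) (subst (U y₁ ∘ α) (sym (Fin.punchIn-punchOut ne)) p)

-- Types of tuples and the back-and-forth property

record Coloured (N B c : ℕ) : Set₁ where
  field
    rooted : RootedElim N B
  open RootedElim rooted public
  field
    colour      : Fin N → Fin c
    colour-inc  : ∀ {v v' u w} → colour v ≡ colour v' → Up v u → Up v w → Up w u →
                  ∃₂ λ u' w' → Up v' u' × Up v' w' × Up w' u' × name u' ≡ name u × name w' ≡ name w

module _ {N B c : ℕ} (L : Coloured N B c) where
  open Coloured L

  -- One-sided on purpose: each transfer lemma is proved once and then applied in both directions.
  record Embeds {n : ℕ} (x x' : Fin n → Fin N) : Set where
    field
      colours : ∀ i → colour (x i) ≡ colour (x' i)
      common  : ∀ i j {u} → Up (x i) u → Up (x j) u → ∃[ u' ] (Up (x' i) u' × Up (x' j) u' × name u' ≡ name u)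

  Similar : {n : ℕ} (x x' : Fin n → Fin N) → Set
  Similar x x' = Embeds x x' × Embeds x' x

-- The range of the seven codes packed into `colour²`. There are `K` candidates per colour and
-- anchor, enough to avoid any `n * B` vertices, which is how many the up-sets of an `n`-tuple can
-- contain.
stepColours : ℕ → ℕ → ℕ → ℕ
stepColours B c n = pairs c (pairs (functions B′ nb) (pairs nb (pairs (functions B′ nb) (pairs (functions B nb)
  (pairs (functions c (functions K nb)) (functions c (functions K (functions B′ nb))))))))
  where
  B′ = suc (B * B)
  K  = repSize B (n * B)
  nb = functions B′ 2

module Step {N B c : ℕ} (L : Coloured N B c) (n : ℕ) where
  open Coloured L

  B′ K nb : ℕ
  B′ = suc (B * B)
  K  = repSize B (n * B)
  nb = functions B′ 2

  Up² : Fin N → Fin N → Set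
  Up² v u = ∃[ w ] (Up v w × Up w u)

  abstract
    up²? : ∀ v u → Dec (Up² v u)
    up²? v u = any? (λ w → up? v w ×-dec up? w u)

  up² : ∀ {v u} → Up v u → Up² v u
  up² p = _ , p , up-refl

  -- The lower of the two intermediate vertices lies in the up-set of the higher one. Closedness of
  -- `Up` then leads from `z` to `y` in one step, or in two through `w` when `w` is lower than `z`.
  -- Hence squaring keeps the same elimination order.
  up²-closed : ∀ {v y z} → Up² v y → Up² v z → rank y ≤ rank z → Up² z y
  up²-closed {v} {y} {z} (w , vw , wy) (w' , vw' , w'z) le with ℕ.≤-total (rank w) (rank w')
  ... | inj₁ w≤w' with ℕ.≤-total (rank w) (rank z)
  ...   | inj₁ w≤z = w , up-closed (up-closed vw vw' w≤w') w'z w≤z , wy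
  ...   | inj₂ z≤w = up² (up-closed wy (up-closed w'z (up-closed vw vw' w≤w') z≤w) le)
  up²-closed {v} {y} {z} (w , vw , wy) (w' , vw' , w'z) le | inj₂ w'≤w =
    up² (up-closed (up-closed wy (up-closed vw' vw w'≤w) (ℕ.≤-trans le (up-≤ w'z))) w'z le)

  -- Each end comes with its own intermediate vertex. Equal codes force equal intermediate vertices,
  -- since these are compared inside `Up v`, and then equal ends; so a squared up-set has at most
  -- `B * B` members.
  pathCode : Fin N → Fin N → Fin (B * B)
  pathCode v u with up²? v u
  ... | yes (w , _) = combine (name w) (name u)
  ... | no _        = combine (name v) (name u)

  pathCode-injective : ∀ v u u' → Up² v u → Up² v u' → pathCode v u ≡ pathCode v u' → u ≡ u'
  pathCode-injective v u u' p p' e with up²? v u | up²? v u'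
  ... | no ¬p | _ = contradiction p ¬p
  ... | yes _ | no ¬p' = contradiction p' ¬p'
  ... | yes (w , vw , wu) | yes (w' , vw' , w'u') with name-inj vw vw' (combine-injectiveˡ e)
  ...   | refl = name-inj wu w'u' (combine-injectiveʳ {i = name w} {k = name w} e)

  rooted² : RootedElim N B′
  rooted² = record
    { elim = Greedy.greedy rank rank-inj Up² up²? (up² up-refl)
        (λ { (w , p , q) → ℕ.≤-trans (up-≤ q) (up-≤ p) }) up²-closed (B * B)
        (λ v → injectiveOn⇒∣∣≤ (select (up²? v)) (pathCode v)
          λ u u' p q → pathCode-injective v u u' (∈-select⇒ (up²? v) p) (∈-select⇒ (up²? v) q))
    ; root = root
    ; up-root = up² up-root
    }

  open RootedElim rooted² using () renaming (name to name²; name-inj to name²-inj)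

  Above : Fin N → Fin N → Fin N → Set
  Above a y u = Up y u × rank a < rank u

  Anchored : Fin c → Fin N → Fin N → Set
  Anchored τ a y = colour y ≡ τ × Up y a

  anchored? : ∀ τ a y → Dec (Anchored τ a y)
  anchored? τ a y = (colour y ≟ τ) ×-dec up? y a

  module Reps (a : Fin N) = Representatives name {Above a} (λ y u → up? y u ×-dec (rank a ℕ.<? rank u))
    (λ p q → name-inj (proj₁ p) (proj₁ q))

  abstract
    rep : Fin c → Fin N → Fin K → Maybe (Fin N)
    rep τ a = Reps.reps a (n * B) (anchored? τ a)

    rep-sound : ∀ {τ a j y} → rep τ a j ≡ just y → Anchored τ a y
    rep-sound {τ} {a} = Reps.reps-sound a (n * B) (anchored? τ a)

    rep-complete : ∀ {τ a} (α : Fin (n * B) → Fin N) → ∃[ y ] (Anchored τ a y × ∀ k → ¬ Above a y (α k)) →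
                   ∃₂ λ j y → rep τ a j ≡ just y × ∀ k → ¬ Above a y (α k)
    rep-complete {τ} {a} = Reps.reps-complete a (n * B) (anchored? τ a)

  Defined : Fin c → Fin K → Fin N → Set
  Defined τ j a = ∃[ y ] (rep τ a j ≡ just y)

  -- What the candidates look like from a vertex `u` that they may contain. The anchor lies in
  -- `Up u`, so its squared name suffices to refer to it, and a colour can store this information.
  Member : Fin c → Fin K → Fin B′ → Fin N → Set
  Member τ j d u = ∃₂ λ a y → Up u a × name² a ≡ d × rep τ a j ≡ just y × Above a y u

  _≟ᴹ_ : (x y : Maybe (Fin N)) → Dec (x ≡ y)
  _≟ᴹ_ = Maybe.≡-dec _≟_

  abstract
    defined? : ∀ τ j a → Dec (Defined τ j a)
    defined? τ j a = any? (λ y → rep τ a j ≟ᴹ just y)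

    member? : ∀ τ j d u → Dec (Member τ j d u)
    member? τ j d u = any? λ a → any? λ y →
      up? u a ×-dec ((name² a ≟ d) ×-dec ((rep τ a j ≟ᴹ just y) ×-dec (up? y u ×-dec (rank a ℕ.<? rank u))))

  Below : (Fin N → Fin N → Set) → Fin B′ → Fin N → Fin N → Set
  Below U d v u = ∃[ w ] (Up² v w × name² w ≡ d × U w u)

  abstract
    below? : ∀ {U} → (∀ v u → Dec (U v u)) → ∀ d v u → Dec (Below U d v u)
    below? U? d v u = any? (λ w → up²? v w ×-dec ((name² w ≟ d) ×-dec U? w u))

  module _ {Q : Fin N → Fin N → Set} (Q? : ∀ v u → Dec (Q v u)) where
    private
      near? : ∀ v b → Dec (∃[ u ] (Up² v u × name² u ≡ b × Q v u))
      near? v b = any? (λ u → up²? v u ×-dec ((name² u ≟ b) ×-dec Q? v u))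

    abstract
      near : Fin N → Fin nb
      near v = code (λ b → bit (near? v b))

      -- Inside one squared up-set a name has a single bearer, so the table of names loses nothing
      -- of the relation.
      near-transfer : ∀ {v v' u u'} → near v ≡ near v' → Up² v u → Up² v' u' → name² u ≡ name² u' → Q v u → Q v' u'
      near-transfer {v} {v'} {u} {u'} e p p' q r
        with bit-transfer (near? v (name² u)) (near? v' (name² u)) (code-injective e (name² u)) (u , p , refl , r)
      ... | w , pw , qw , rw = subst (Q v') (name²-inj pw p' (trans qw q)) rw

      near-exists : ∀ {v v' u} → near v ≡ near v' → Up² v u → Q v u → ∃[ u' ] (Up² v' u' × name² u' ≡ name² u × Q v' u')
      near-exists {v} {v'} {u} e p r = bit-transfer (near? v (name² u)) (near? v' (name² u)) (code-injective e (name² u)) (u , p , refl , r)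

  named? : ∀ d (v u : Fin N) → Dec (name u ≡ d)
  named? d v u = name u ≟ d

  code₁ : Fin N → Fin (functions B′ nb)
  code₁ v = code (λ d → near (below? up²? d) v)
  code₂ : Fin N → Fin nb
  code₂ = near up?
  code₃ : Fin N → Fin (functions B′ nb)
  code₃ v = code (λ d → near (below? up? d) v)
  code₄ : Fin N → Fin (functions B nb)
  code₄ v = code (λ d → near (named? d) v)
  code₅ : Fin N → Fin (functions c (functions K nb))
  code₅ v = code (λ τ → code (λ j → near (λ _ → defined? τ j) v))
  code₆ : Fin N → Fin (functions c (functions K (functions B′ nb)))
  code₆ v = code (λ τ → code (λ j → code (λ d → near (λ _ → member? τ j d) v)))

  record SameCodes (v v' : Fin N) : Set where
    field
      eq₀ : colour v ≡ colour v'
      eq₁ : code₁ v ≡ code₁ v'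
      eq₂ : code₂ v ≡ code₂ v'
      eq₃ : code₃ v ≡ code₃ v'
      eq₄ : code₄ v ≡ code₄ v'
      eq₅ : code₅ v ≡ code₅ v'
      eq₆ : code₆ v ≡ code₆ v'

  abstract
    colour² : Fin N → Fin (stepColours B c n)
    colour² v = pair (colour v) (pair (code₁ v) (pair (code₂ v) (pair (code₃ v) (pair (code₄ v) (pair (code₅ v) (code₆ v))))))

    sameCodes : ∀ {v v'} → colour² v ≡ colour² v' → SameCodes v v'
    sameCodes e =
      let (e₀ , e) = pair-injective e ; (e₁ , e) = pair-injective e ; (e₂ , e) = pair-injective e
          (e₃ , e) = pair-injective e ; (e₄ , e) = pair-injective e ; (e₅ , e₆) = pair-injective e
      in record { eq₀ = e₀ ; eq₁ = e₁ ; eq₂ = e₂ ; eq₃ = e₃ ; eq₄ = e₄ ; eq₅ = e₅ ; eq₆ = e₆ }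

  next : Coloured N B′ (stepColours B c n)
  next = record { rooted = rooted² ; colour = colour² ; colour-inc = inc }
    where
    inc : ∀ {v v' u w} → colour² v ≡ colour² v' → Up² v u → Up² v w → Up² w u →
          ∃₂ λ u' w' → Up² v' u' × Up² v' w' × Up² w' u' × name² u' ≡ name² u × name² w' ≡ name² w
    inc {w = w} e vu vw wu
      with near-exists (below? up²? (name² w)) (code-injective (SameCodes.eq₁ (sameCodes e)) (name² w)) vu (w , vw , refl , wu)
    ... | u' , p , q , w' , p' , q' , r = u' , w' , p , p' , r , q , q'

  module Transfer {k} {x x' : Fin k → Fin N} (emb : Embeds next x x') where
    open Embeds emb

    Match : Fin k → Fin N → Fin N → Set
    Match i u u' = Up² (x i) u × Up² (x' i) u' × name² u ≡ name² u'

    codes : ∀ i → SameCodes (x i) (x' i)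
    codes i = sameCodes (colours i)

    match : ∀ {i u} → Up² (x i) u → ∃[ u' ] Match i u u'
    match {i} p with common i i p p
    ... | u' , q , _ , e = u' , p , q , sym e

    -- Squared names are comparable only inside one squared up-set. The field `common` supplies a
    -- partner in the squared up-sets of both `x' i` and `x' j`, and inside the former its name
    -- makes it equal to `u'`.
    across : ∀ {i j u u'} → Match i u u' → Up² (x j) u → Match j u u'
    across {i} {j} (p , p' , e) q with common i j p q
    ... | u″ , r , r' , e' = q , subst (Up² (x' j)) (name²-inj r p' (trans e' e)) r' , e

    match-up : ∀ {i u u'} → Match i u u' → Up (x i) u → Up (x' i) u'
    match-up {i} (p , p' , e) = near-transfer up? (SameCodes.eq₂ (codes i)) p p' e

    match-below : ∀ {i u u' w w'} → Match i u u' → Match i w w' → Up w u → Up w' u'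
    match-below {i} {w = w} (p , p' , e) (q , q' , f) r
      with near-transfer (below? up? (name² w)) (code-injective (SameCodes.eq₃ (codes i)) (name² w)) p p' e (w , q , refl , r)
    ... | w″ , q″ , f″ , r″ = subst (λ w → Up w _) (name²-inj q″ q' (trans f″ f)) r″

    match-name : ∀ {i u u'} → Match i u u' → name u ≡ name u'
    match-name {i} {u} (p , p' , e) =
      sym (near-transfer (named? (name u)) (code-injective (SameCodes.eq₄ (codes i)) (name u)) p p' e refl)

    match-defined : ∀ {i u u'} τ j → Match i u u' → Defined τ j u → Defined τ j u'
    match-defined {i} τ j (p , p' , e) =
      near-transfer (λ _ → defined? τ j) (code-injective (code-injective (SameCodes.eq₅ (codes i)) τ) j) p p' e

    match-member : ∀ {i u u'} τ j d → Match i u u' → Member τ j d u → Member τ j d u'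
    match-member {i} τ j d (p , p' , e) = near-transfer (λ _ → member? τ j d)
      (code-injective (code-injective (code-injective (SameCodes.eq₆ (codes i)) τ) j) d) p p' e

    weaken : Embeds L x x'
    weaken = record
      { colours = λ i → SameCodes.eq₀ (codes i)
      ; common = λ i j p q → let (u' , m) = match (up² p) in
          u' , match-up m p , match-up (across m (up² q)) q , sym (match-name m) }

    module _ {y y' a a' : Fin N} {i₀ : Fin k} (y~y' : colour y ≡ colour y')
             (m : Match i₀ a a') (i₀a : Up (x i₀) a) (ya : Up y a) (y'a' : Up y' a')
             (top : ∀ {i u} → Up y u → Up (x i) u → rank u ≤ rank a) where

      -- A shared `u` is not above `a`, so it lies in `Up a` and in the squared up-set of `x i₀`,
      -- where it has a match. The equal colours of `y` and `y'` give a vertex of the same name in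
      -- `Up a'`; names being unique there, it is that match.
      common-new : ∀ i {u} → Up y u → Up (x i) u → ∃[ u' ] (Up y' u' × Up (x' i) u' × name u' ≡ name u)
      common-new i {u} p q
        with colour-inc y~y' p ya (up-closed p ya (top p q)) | match {i₀} (a , i₀a , up-closed p ya (top p q))
      ... | u₁ , w₁ , p₁ , q₁ , r₁ , e₁ , f₁ | u' , m' =
        u' , subst (Up y') (sym same) p₁ , match-up (across m' (up² q)) q , sym (match-name m')
        where
        w₁≡a' : w₁ ≡ a'
        w₁≡a' = name-inj q₁ y'a' (trans f₁ (match-name m))
        same : u' ≡ u₁
        same = name-inj (match-below m' m (up-closed p ya (top p q))) (subst (λ w → Up w u₁) w₁≡a' r₁)
                 (trans (sym (match-name m')) (sym e₁))

    embeds-extend : ∀ {y y'} → colour y ≡ colour y' →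
      (∀ i {u} → Up y u → Up (x i) u → ∃[ u' ] (Up y' u' × Up (x' i) u' × name u' ≡ name u)) →
      Embeds L (extend y x) (extend y' x')
    embeds-extend {y} {y'} e new = record { colours = cols ; common = com }
      where
      cols : ∀ i → colour (extend y x i) ≡ colour (extend y' x' i)
      cols zero    = e
      cols (suc i) = Embeds.colours weaken i
      com : ∀ i j {u} → Up (extend y x i) u → Up (extend y x j) u →
            ∃[ u' ] (Up (extend y' x' i) u' × Up (extend y' x' j) u' × name u' ≡ name u)
      com zero    zero    p q with colour-inc e p p up-refl
      ... | u' , _ , p' , _ , _ , f , _ = u' , p' , p' , f
      com zero    (suc j) p q = new j p q
      com (suc i) zero    p q with new i q p
      ... | u' , p' , q' , f = u' , q' , p' , f
      com (suc i) (suc j) p q = Embeds.common weaken i j p q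

  match-swap : ∀ {k} {x x' : Fin k → Fin N} (emb : Embeds next x x') (emb' : Embeds next x' x) {i u u'} →
               Transfer.Match emb i u u' → Transfer.Match emb' i u' u
  match-swap _ _ (p , q , e) = q , p , sym e

  private
    pick : ∀ {k} (x : Fin k → Fin N) → Fin k × Fin B → Fin N
    pick x (i , b) with any? (λ u → up? (x i) u ×-dec (name u ≟ b))
    ... | yes (u , _) = u
    -- A vertex lies in its own up-set, so with this default everything listed still lies in an
    -- up-set of the tuple.
    ... | no _        = x i

    pick-sound : ∀ {k} (x : Fin k → Fin N) ib → ∃[ i ] Up (x i) (pick x ib)
    pick-sound x (i , b) with any? (λ u → up? (x i) u ×-dec (name u ≟ b))
    ... | yes (u , p , _) = i , p
    ... | no _            = i , up-refl

    pick-complete : ∀ {k} (x : Fin k → Fin N) {i u} → Up (x i) u → pick x (i , name u) ≡ u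
    pick-complete x {i} {u} p with any? (λ v → up? (x i) v ×-dec (name v ≟ name u))
    ... | yes (v , q , e) = name-inj q p e
    ... | no none = contradiction (u , p , refl) none

  neighbourhood : ∀ {k} → (Fin k → Fin N) → Fin (k * B) → Fin N
  neighbourhood x j = pick x (remQuot B j)

  neighbourhood-sound : ∀ {k} (x : Fin k → Fin N) j → ∃[ i ] Up (x i) (neighbourhood x j)
  neighbourhood-sound x j = pick-sound x (remQuot B j)

  neighbourhood-complete : ∀ {k} (x : Fin k → Fin N) {i u} → Up (x i) u → ∃[ j ] (neighbourhood x j ≡ u)
  neighbourhood-complete x {i} {u} p =
    combine i (name u) , trans (cong (pick x) (Fin.remQuot-combine i (name u))) (pick-complete x p)

  -- Let `a` be the highest vertex of `Up y` shared with the tuple; the index of type `Fin n`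
  -- supplies the root as one. As `y` avoids the tuple above `a`, so does some `j`-th candidate `y₁`
  -- at `a`. The answer is the `j`-th candidate at the partner `a'`. If it met `x'` above `a'`, the
  -- colours would carry this back to a meeting of `y₁` with `x` above `a`.
  forth : {x x' : Fin n → Fin N} → Similar next x x' → Fin n → ∀ y → ∃[ y' ] Similar L (extend y x) (extend y' x')
  forth {x} {x'} (emb , emb') o y
    with argmax (λ u → up? y u ×-dec any? (λ i → up? (x i) u)) rank (root , up-root , o , up-root)
  ... | a , (ya , i₀ , i₀a) , a-max
    with rep-complete (neighbourhood x)
           (y , (refl , ya) , λ k (p , lt) → ℕ.<⇒≱ lt (a-max _ (p , neighbourhood-sound x k)))
       | Transfer.match emb {i₀} (up² i₀a)
  ... | j , y₁ , y₁-rep , y₁-avoids | a' , m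
    with Transfer.match-defined emb (colour y) j m (y₁ , y₁-rep)
  ... | y' , y'-rep = y'
    , Transfer.embeds-extend emb y~y' (Transfer.common-new emb y~y' m i₀a ya y'a' top)
    , Transfer.embeds-extend emb' (sym y~y') (Transfer.common-new emb' (sym y~y') m' i₀a' y'a' ya top')
    where
    m' = match-swap emb emb' m
    sound = rep-sound y'-rep
    y~y' : colour y ≡ colour y'
    y~y' = sym (proj₁ sound)
    y'a' : Up y' a'
    y'a' = proj₂ sound
    i₀a' : Up (x' i₀) a'
    i₀a' = Transfer.match-up emb m i₀a
    top : ∀ {i u} → Up y u → Up (x i) u → rank u ≤ rank a
    top {i} {u} p q = a-max u (p , i , q)
    disjoint : ∀ {i u} → Up (x i) u → ¬ Above a y₁ u
    disjoint q r with neighbourhood-complete x q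
    ... | k , refl = y₁-avoids k r
    top' : ∀ {i u} → Up y' u → Up (x' i) u → rank u ≤ rank a'
    top' {i} {u'} p q = ℕ.≮⇒≥ λ lt → absurd lt (Transfer.match emb' {i} (up² q))
      where
      absurd : rank a' < rank u' → ∃[ u ] Transfer.Match emb' i u' u → ⊥
      absurd lt (u , mu)
        with Transfer.match-member emb' (colour y) j (name² a') mu
               (a' , y' , up-closed y'a' p (ℕ.<⇒≤ lt) , refl , y'-rep , p , lt)
      ... | ã , ỹ , uã , e , ỹ-rep , ỹu , ã<u = disjoint iu (subst₂ (λ b z → Above b z u) ã≡a ỹ≡y₁ (ỹu , ã<u))
        where
        iu : Up (x i) u
        iu = Transfer.match-up emb' mu q
        -- The colour gives only the squared name of the anchor; both anchors lie in the squared
        -- up-set of `x i`, where the name decides.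
        ã≡a : ã ≡ a
        ã≡a = name²-inj (u , iu , uã) (proj₁ (proj₂ (Transfer.across emb' m' (u' , q , up-closed y'a' p (ℕ.<⇒≤ lt)))))
                (trans e (proj₂ (proj₂ m')))
        ỹ≡y₁ : ỹ ≡ y₁
        ỹ≡y₁ = Maybe.just-injective (trans (sym (subst (λ b → rep (colour y) b j ≡ just ỹ) ã≡a ỹ-rep)) y₁-rep)

-- First-order formulas are preserved by similarity

baseColours : ℕ → ℕ → ℕ
baseColours B s = pairs (functions B (functions B 2)) (pairs B (pairs (functions B 2) (functions s 2)))

module Base {N B : ℕ} (R : RootedElim N B) (A : Fin N → Fin N → Bool) (A-sym : ∀ u v → A u v ≡ A v u)
            (A-up : ∀ u v → A u v ≡ true → RootedElim.Up R v u ⊎ RootedElim.Up R u v)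
            {s : ℕ} (pr : Fin s → Fin N → Bool) where
  open RootedElim R

  private
    inc? : ∀ v b d → Dec (∃₂ λ u w → Up v u × Up v w × Up w u × name u ≡ b × name w ≡ d)
    inc? v b d = any? λ u → any? λ w → up? v u ×-dec (up? v w ×-dec (up? w u ×-dec ((name u ≟ b) ×-dec (name w ≟ d))))

    nbr? : ∀ v b → Dec (∃[ u ] (Up v u × name u ≡ b × A v u ≡ true))
    nbr? v b = any? λ u → up? v u ×-dec ((name u ≟ b) ×-dec (A v u Bool.≟ true))

    incCode : Fin N → Fin (functions B (functions B 2))
    incCode v = code (λ b → code (λ d → bit (inc? v b d)))

    nbrCode : Fin N → Fin (functions B 2)
    nbrCode v = code (λ b → bit (nbr? v b))

    prCode : Fin N → Fin (functions s 2)
    prCode v = code (λ i → bit (pr i v Bool.≟ true))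

    abstract
      baseColour : Fin N → Fin (baseColours B s)
      baseColour v = pair (incCode v) (pair (name v) (pair (nbrCode v) (prCode v)))

      decode : ∀ {v v'} → baseColour v ≡ baseColour v' →
               incCode v ≡ incCode v' × name v ≡ name v' × nbrCode v ≡ nbrCode v' × prCode v ≡ prCode v'
      decode e = let (e₀ , e) = pair-injective e ; (e₁ , e) = pair-injective e ; (e₂ , e₃) = pair-injective e in e₀ , e₁ , e₂ , e₃

  base : Coloured N B (baseColours B s)
  base = record
    { rooted = R
    ; colour = baseColour
    ; colour-inc = λ {v} {v'} {u} {w} e p q r →
        let (u' , w' , p' , q' , r' , f , g) = bit-transfer (inc? v (name u) (name w)) (inc? v' (name u) (name w))
              (code-injective (code-injective (proj₁ (decode e)) (name u)) (name w)) (u , w , p , q , r , refl , refl)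
        in u' , w' , p' , q' , r' , f , g
    }

  module _ {n : ℕ} {x x' : Fin n → Fin N} (emb : Embeds base x x') where
    open Embeds emb

    private
      same-name : ∀ i → name (x i) ≡ name (x' i)
      same-name i = proj₁ (proj₂ (decode (colours i)))

      up-transfer : ∀ {i j} → Up (x i) (x j) → Up (x' i) (x' j)
      up-transfer {i} {j} p with common i j p up-refl
      ... | u' , p' , q' , e = subst (Up (x' i)) (name-inj q' up-refl (trans e (same-name j))) p'

      adjacent-up : ∀ {i j} → Up (x i) (x j) → A (x i) (x j) ≡ true → A (x' i) (x' j) ≡ true
      adjacent-up {i} {j} p e
        with bit-transfer (nbr? (x i) (name (x j))) (nbr? (x' i) (name (x j)))
               (code-injective (proj₁ (proj₂ (proj₂ (decode (colours i))))) (name (x j))) (x j , p , refl , e)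
      ... | u' , p' , f , e' = subst (λ u → A (x' i) u ≡ true) (name-inj p' (up-transfer p) (trans f (same-name j))) e'

    ≡-transfer : ∀ i j → x i ≡ x j → x' i ≡ x' j
    ≡-transfer i j e = name-inj (up-transfer (subst (Up (x j)) (sym e) up-refl)) up-refl
      (trans (sym (same-name i)) (trans (cong name e) (same-name j)))

    adjacent-transfer : ∀ i j → A (x i) (x j) ≡ true → A (x' i) (x' j) ≡ true
    adjacent-transfer i j e with A-up (x i) (x j) e
    ... | inj₂ p = adjacent-up p e
    ... | inj₁ p = trans (A-sym (x' i) (x' j)) (adjacent-up p (trans (A-sym (x j) (x i)) e))

    pr-transfer : ∀ i a → pr a (x i) ≡ true → pr a (x' i) ≡ true
    pr-transfer i a = bit-transfer (pr a (x i) Bool.≟ true) (pr a (x' i) Bool.≟ true)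
      (code-injective (proj₂ (proj₂ (proj₂ (decode (colours i))))) a)

namesAt : ℕ → ℕ → ℕ
namesAt B zero    = B
namesAt B (suc q) = suc (namesAt B q * namesAt B q)

coloursAt : ℕ → ℕ → ℕ → ℕ → ℕ
coloursAt B c zero    k = c
coloursAt B c (suc q) k = stepColours (namesAt B q) (coloursAt B c q (suc k)) k

module _ {N B c : ℕ} (L : Coloured N B c) where

  -- Similarity at level q suffices for formulas of quantifier rank q in k free variables.
  abstract
    level : ∀ q k → Coloured N (namesAt B q) (coloursAt B c q k)
    level zero    k = L
    level (suc q) k = Step.next (level q (suc k)) k

    embeds-base : ∀ q k {n} {x x' : Fin n → Fin N} → Embeds (level q k) x x' → Embeds L x x'
    embeds-base zero    k emb = emb
    embeds-base (suc q) k emb = embeds-base q (suc k) (Step.Transfer.weaken (level q (suc k)) k emb)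

    private
      embeds-refl : ∀ {B c} (M : Coloured N B c) {n} {x x' : Fin n → Fin N} → (∀ i → x i ≡ x' i) → Embeds M x x'
      embeds-refl M e = record
        { colours = λ i → cong (Coloured.colour M) (e i)
        ; common = λ i j {u} p q → u , subst (λ v → Coloured.Up M v u) (e i) p , subst (λ v → Coloured.Up M v u) (e j) q , refl }

    level-forth : ∀ q k {x x' : Fin k → Fin N} → Similar (level (suc q) k) x x' → ∀ y →
                  ∃[ y' ] Similar (level q (suc k)) (extend y x) (extend y' x')
    -- With an empty tuple there is no shared vertex for `forth` to start from, but also nothing to
    -- match, so `y` can answer itself.
    level-forth q zero s y = y , embeds-refl (level q 1) (λ { zero → refl }) , embeds-refl (level q 1) (λ { zero → refl })
    level-forth q (suc k) s y = Step.forth (level q (suc (suc k))) (suc k) s zero y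

quantifierRank : ∀ {q k} → Formula q k → ℕ
quantifierRank (_ ≐ _)     = 0
quantifierRank (edge _ _)  = 0
quantifierRank (sim _ _)   = 0
quantifierRank (unary _ _) = 0
quantifierRank (neg φ)     = quantifierRank φ
quantifierRank (φ and ψ)   = quantifierRank φ ⊔ quantifierRank ψ
quantifierRank (ex φ)      = suc (quantifierRank φ)

∧-true⇒ : ∀ {a b} → a ∧ b ≡ true → a ≡ true × b ≡ true
∧-true⇒ {true} {true} _ = refl , refl

⇒∧-true : ∀ {a b} → a ≡ true → b ≡ true → a ∧ b ≡ true
⇒∧-true refl refl = refl

any-tabulate⇒ : ∀ {n} {A : Set} (f : A → Bool) (g : Fin n → A) → any f (List.tabulate g) ≡ true → ∃[ i ] (f (g i) ≡ true)
any-tabulate⇒ {suc n} f g e with f (g zero) in eq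
... | true  = zero , eq
... | false = let (i , h) = any-tabulate⇒ f (g ∘ suc) e in suc i , h

⇒any-tabulate : ∀ {n} {A : Set} (f : A → Bool) (g : Fin n → A) i → f (g i) ≡ true → any f (List.tabulate g) ≡ true
⇒any-tabulate f g zero h rewrite h = refl
⇒any-tabulate f g (suc i) h with f (g zero)
... | true  = refl
... | false = ⇒any-tabulate f (g ∘ suc) i h

module _ (G : Graph) (p m : ℕ) (U : Fin p → V G → Bool) where
  open CopyStructure G p m U

  ex⇒ : ∀ {k} {φ : Formula (p + m) (suc k)} {ρ} → eval (ex φ) ρ ≡ true → ∃[ d ] (eval φ (extend d ρ) ≡ true)
  ex⇒ {φ = φ} {ρ} e with any-tabulate⇒ (λ v → any (λ i → eval φ (extend (v , i) ρ)) (allFin m)) id e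
  ... | v , e' with any-tabulate⇒ (λ i → eval φ (extend (v , i) ρ)) id e'
  ...   | i , h = (v , i) , h

  ⇒ex : ∀ {k} {φ : Formula (p + m) (suc k)} {ρ} d → eval φ (extend d ρ) ≡ true → eval (ex φ) ρ ≡ true
  ⇒ex {φ = φ} {ρ} (v , i) h = ⇒any-tabulate (λ v → any (λ i → eval φ (extend (v , i) ρ)) (allFin m)) id v
                                 (⇒any-tabulate (λ i → eval φ (extend (v , i) ρ)) id i h)

module Preservation (G : Graph) (p m : ℕ) (U : Fin p → V G → Bool) {B : ℕ} (R : Elim (size G) B)
                    (edge-up : ∀ u v → E G u v → Elim.Up R v u ⊎ Elim.Up R u v) where
  open CopyStructure G p m U

  private
    A : Fin (suc (size G)) → Fin (suc (size G)) → Bool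
    A (suc u) (suc v) = adj G u v
    A _       _       = false

    A-sym : ∀ u v → A u v ≡ A v u
    A-sym zero    zero    = refl
    A-sym zero    (suc v) = refl
    A-sym (suc u) zero    = refl
    A-sym (suc u) (suc v) = Graph.sym G u v

    A-up : ∀ u v → A u v ≡ true → RootedElim.Up (addRoot R) v u ⊎ RootedElim.Up (addRoot R) u v
    A-up (suc u) (suc v) e = edge-up u v e

    -- The additional predicate `zero` holds everywhere except at the added root, so a vertex of `G`
    -- is never answered by the root.
    pr : Fin (suc p) → Fin (suc (size G)) → Bool
    pr zero    zero    = false
    pr zero    (suc v) = true
    pr (suc a) zero    = false
    pr (suc a) (suc v) = U a v

  open Base (addRoot R) A A-sym A-up pr public

  Represents : ∀ {k} → (Fin k → Fin (suc (size G))) → (Fin k → Dom) → Set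
  Represents x ρ = ∀ i → x i ≡ suc (proj₁ (ρ i))

  represents-extend : ∀ {k} {x : Fin k → Fin (suc (size G))} {ρ : Fin k → Dom} {v i} → Represents x ρ →
                      Represents (extend (suc v) x) (extend (v , i) ρ)
  represents-extend r zero    = refl
  represents-extend r (suc i) = r i

  module _ {k} {x x' : Fin k → Fin (suc (size G))} {ρ ρ' : Fin k → Dom} (r : Represents x ρ) (r' : Represents x' ρ')
           (copies : ∀ i → proj₂ (ρ i) ≡ proj₂ (ρ' i)) (emb : Embeds base x x') where

    private
      vertex-transfer : ∀ i j → does (proj₁ (ρ i) ≟ proj₁ (ρ j)) ≡ true → does (proj₁ (ρ' i) ≟ proj₁ (ρ' j)) ≡ true
      vertex-transfer i j e = dec-true (proj₁ (ρ' i) ≟ proj₁ (ρ' j)) (Fin.suc-injective (trans (sym (r' i)) (trans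
        (≡-transfer emb i j (trans (r i) (trans (cong suc (does⇒ (proj₁ (ρ i) ≟ proj₁ (ρ j)) e)) (sym (r j))))) (r' j))))

      copy-transfer : ∀ i j → does (proj₂ (ρ i) ≟ proj₂ (ρ j)) ≡ true → does (proj₂ (ρ' i) ≟ proj₂ (ρ' j)) ≡ true
      copy-transfer i j e = subst₂ (λ a b → does (a ≟ b) ≡ true) (copies i) (copies j) e

      unary-transfer : ∀ s i → unaryB′ s (ρ i) ≡ true → unaryB′ s (ρ' i) ≡ true
      unary-transfer (inj₁ a) i e = subst (λ v → pr (suc a) v ≡ true) (r' i)
        (pr-transfer emb i (suc a) (subst (λ v → pr (suc a) v ≡ true) (sym (r i)) e))
      unary-transfer (inj₂ j) i e = subst (λ a → does (a ≟ j) ≡ true) (copies i) e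

    ≐-transfer : ∀ i j → eval (i ≐ j) ρ ≡ true → eval (i ≐ j) ρ' ≡ true
    ≐-transfer i j e = let (a , b) = ∧-true⇒ e in ⇒∧-true (vertex-transfer i j a) (copy-transfer i j b)

    edge-transfer : ∀ i j → eval (edge i j) ρ ≡ true → eval (edge i j) ρ' ≡ true
    edge-transfer i j e = let (a , b) = ∧-true⇒ e in
      ⇒∧-true (subst₂ (λ u v → A u v ≡ true) (r' i) (r' j)
                (adjacent-transfer emb i j (subst₂ (λ u v → A u v ≡ true) (sym (r i)) (sym (r j)) a)))
              (copy-transfer i j b)

    sim-transfer : ∀ i j → eval (sim i j) ρ ≡ true → eval (sim i j) ρ' ≡ true
    sim-transfer = vertex-transfer

    unary-eval-transfer : ∀ c i → eval (unary c i) ρ ≡ true → eval (unary c i) ρ' ≡ true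
    unary-eval-transfer c = unary-transfer (splitAt p c)

  -- Copy indices are kept out of the tuples. Atoms depend on the underlying vertices and on the
  -- indices separately, so a quantified element is answered within the same copy.
  preserved : ∀ {k} (φ : Formula (p + m) k) q → quantifierRank φ ≤ q →
    ∀ {x x' : Fin k → Fin (suc (size G))} {ρ ρ' : Fin k → Dom} → Represents x ρ → Represents x' ρ' →
    (∀ i → proj₂ (ρ i) ≡ proj₂ (ρ' i)) → Similar (level base q k) x x' → eval φ ρ ≡ eval φ ρ'
  preserved (i ≐ j) q le r r' c (s , t) =
    bool-ext (≐-transfer r r' c (embeds-base base q _ s) i j) (≐-transfer r' r (sym ∘ c) (embeds-base base q _ t) i j)
  preserved (edge i j) q le r r' c (s , t) =
    bool-ext (edge-transfer r r' c (embeds-base base q _ s) i j) (edge-transfer r' r (sym ∘ c) (embeds-base base q _ t) i j)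
  preserved (sim i j) q le r r' c (s , t) =
    bool-ext (sim-transfer r r' c (embeds-base base q _ s) i j) (sim-transfer r' r (sym ∘ c) (embeds-base base q _ t) i j)
  preserved (unary a i) q le r r' c (s , t) =
    bool-ext (unary-eval-transfer r r' c (embeds-base base q _ s) a i) (unary-eval-transfer r' r (sym ∘ c) (embeds-base base q _ t) a i)
  preserved (neg φ) q le r r' c s = cong not (preserved φ q le r r' c s)
  preserved (φ and ψ) q le r r' c s =
    cong₂ _∧_ (preserved φ q (ℕ.m⊔n≤o⇒m≤o _ _ le) r r' c s)
              (preserved ψ q (ℕ.m⊔n≤o⇒n≤o (quantifierRank φ) _ le) r r' c s)
  preserved {k} (ex φ) (suc q) (s≤s le) r r' c (s , t) =
    bool-ext (forward r r' c (s , t)) (forward r' r (sym ∘ c) (t , s))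
    where
    forward : ∀ {x x' : Fin k → Fin (suc (size G))} {ρ ρ' : Fin k → Dom} → Represents x ρ → Represents x' ρ' →
      (∀ i → proj₂ (ρ i) ≡ proj₂ (ρ' i)) → Similar (level base (suc q) k) x x' → eval (ex φ) ρ ≡ true → eval (ex φ) ρ' ≡ true
    forward {x} {x'} {ρ} {ρ'} r r' c s e with ex⇒ G p m U {φ = φ} e
    ... | (v , i) , h with level-forth base q k s (suc v)
    ...   | zero , s' with pr-transfer (embeds-base base q (suc k) (proj₁ s')) zero zero refl
    ...     | ()
    forward {x} {x'} {ρ} {ρ'} r r' c s e | (v , i) , h | suc v' , s' =
      ⇒ex G p m U {φ = φ} (v' , i) (trans (sym (preserved φ q le
        (represents-extend {ρ = ρ} {v} {i} r) (represents-extend {ρ = ρ'} {v'} {i} r')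
        (λ { zero → refl ; (suc j) → c j }) s')) h)

-- Graphs whose edges are decided at the meeting point of two up-sets

record Hub (H : Graph) (B c : ℕ) : Set₁ where
  field
    {N}    : ℕ
    rooted : RootedElim N B
  open RootedElim rooted public
  field
    place  : V H → Fin N
    colour : V H → Fin c

  Meet : Fin N → V H → V H → Set
  Meet z x y = (Up (place x) z × Up (place y) z) × ∀ u → Up (place x) u × Up (place y) u → rank u ≤ rank z

  field
    -- Both pairs meet at the same `z`: colours are compared over one fixed vertex only. This lets a
    -- label attached to `z` and two colours decide all pairs meeting there.
    determined : ∀ {z x y x' y'} → x ≢ y → x' ≢ y' → colour x ≡ colour x' → colour y ≡ colour y' →
                 Meet z x y → Meet z x' y' → E H x y → E H x' y'

module _ {N B c : ℕ} (L : Coloured N B c) where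
  open Coloured L

  two : Fin N → Fin N → Fin 2 → Fin N
  two a b zero       = a
  two a b (suc zero) = b

  -- The common part of two up-sets is determined by its largest element and the two colours.
  meet-embeds : ∀ {z a b a' b'} → colour a ≡ colour a' → colour b ≡ colour b' →
    Up a z → Up b z → (∀ u → Up a u × Up b u → rank u ≤ rank z) → Up a' z → Up b' z →
    Embeds L (two a b) (two a' b')
  meet-embeds {z} {a} {b} {a'} {b'} ea eb az bz top a'z b'z = record { colours = cols ; common = com }
    where
    cols : ∀ i → colour (two a b i) ≡ colour (two a' b' i)
    cols zero       = ea
    cols (suc zero) = eb
    self : ∀ {v v' u} → colour v ≡ colour v' → Up v u → ∃[ u' ] (Up v' u' × Up v' u' × name u' ≡ name u)
    self e p with colour-inc e p p up-refl
    ... | u' , _ , p' , _ , _ , f , _ = u' , p' , p' , f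
    -- As `z` lies in both up-sets, the member of `Up v'` with the name of `u` is compared with `u`
    -- inside `Up z`. So up to `z` the two up-sets are literally the same, not merely isomorphic.
    half : ∀ {v v' u} → colour v ≡ colour v' → Up v z → Up v' z → Up v u → rank u ≤ rank z → Up v' u
    half {v} {v'} {u} e vz v'z p le with colour-inc e p vz (up-closed p vz le)
    ... | u' , w' , p' , q' , r' , f , g = subst (Up v') (name-inj (subst (λ w → Up w u') (name-inj q' v'z g) r') (up-closed p vz le) f) p'
    com : ∀ i j {u} → Up (two a b i) u → Up (two a b j) u →
          ∃[ u' ] (Up (two a' b' i) u' × Up (two a' b' j) u' × name u' ≡ name u)
    com zero       zero       p q = self ea p
    com (suc zero) (suc zero) p q = self eb p
    com zero       (suc zero) {u} p q = u , half ea az a'z p (top u (p , q)) , half eb bz b'z q (top u (p , q)) , refl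
    com (suc zero) zero       {u} p q = u , half eb bz b'z p (top u (q , p)) , half ea az a'z q (top u (q , p)) , refl

module _ (G : Graph) (p m : ℕ) (U : Fin p → V G → Bool) {B : ℕ} (R : Elim (size G) B)
         (edge-up : ∀ u v → E G u v → Elim.Up R v u ⊎ Elim.Up R u v) (φ : Formula (p + m) 2) where
  open CopyStructure G p m U
  open Preservation G p m U R edge-up

  module _ (H : Graph) (f : V H → Dom) (value : V H → V H → Bool)
    (value-eval : ∀ u v → ∃[ ρ ] (ρ zero ≡ f u × ρ (suc zero) ≡ f v × value u v ≡ eval φ ρ))
    (edges : ∀ u v → u ≢ v → E H u v ⇔ (value u v ∨ value v u ≡ true)) where

    private
      q = quantifierRank φ
      M = level base q 2
      place : V H → Fin (suc (size G))
      place x = suc (proj₁ (f x))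

    open Coloured M using (rooted; colour; Up; rank)

    private
      value-determined : ∀ {z u v u' v'} → colour (place u) ≡ colour (place u') → colour (place v) ≡ colour (place v') →
        proj₂ (f u) ≡ proj₂ (f u') → proj₂ (f v) ≡ proj₂ (f v') →
        Up (place u) z → Up (place v) z → (∀ w → Up (place u) w × Up (place v) w → rank w ≤ rank z) →
        Up (place u') z → Up (place v') z → (∀ w → Up (place u') w × Up (place v') w → rank w ≤ rank z) →
        value u v ≡ value u' v'
      value-determined {z} {u} {v} {u'} {v'} eu ev cu cv uz vz top u'z v'z top'
        with value-eval u v | value-eval u' v'
      ... | ρ , r₀ , r₁ , e | ρ' , r₀' , r₁' , e' =
        trans e (trans (preserved φ q ℕ.≤-refl {x = two M (place u) (place v)} {two M (place u') (place v')} rep rep' copies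
                   (meet-embeds M eu ev uz vz top u'z v'z , meet-embeds M (sym eu) (sym ev) u'z v'z top' uz vz)) (sym e'))
        where
        rep : Represents (two M (place u) (place v)) ρ
        rep zero       = cong (suc ∘ proj₁) (sym r₀)
        rep (suc zero) = cong (suc ∘ proj₁) (sym r₁)
        rep' : Represents (two M (place u') (place v')) ρ'
        rep' zero       = cong (suc ∘ proj₁) (sym r₀')
        rep' (suc zero) = cong (suc ∘ proj₁) (sym r₁')
        copies : ∀ i → proj₂ (ρ i) ≡ proj₂ (ρ' i)
        copies zero       = trans (cong proj₂ r₀) (trans cu (cong proj₂ (sym r₀')))
        copies (suc zero) = trans (cong proj₂ r₁) (trans cv (cong proj₂ (sym r₁')))

    hubOf : Hub H (namesAt (suc B) q) (pairs (coloursAt (suc B) (baseColours (suc B) (suc p)) q 2) m)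
    hubOf = record
      { rooted = rooted ; place = place ; colour = λ x → pair (colour (place x)) (proj₂ (f x))
      ; determined = λ {z} {x} {y} {x'} {y'} x≢y x'≢y' ex ey ((xz , yz) , top) ((x'z , y'z) , top') e →
          let (ex , cx) = pair-injective ex ; (ey , cy) = pair-injective ey
          in Equivalence.from (edges x' y' x'≢y') (trans (sym (cong₂ _∨_
               (value-determined ex ey cx cy xz yz top x'z y'z top')
               (value-determined ey ex cy cx yz xz (λ u (p , q) → top u (q , p)) y'z x'z (λ u (p , q) → top' u (q , p)))))
             (Equivalence.to (edges x y x≢y) e))
      }

hub : ∀ k (τ : Transduction) → ∃₂ λ B c → ∀ G H → TW≤ G k → H ∈τ (τ , G) → Hub H B c
hub k τ = _ , _ , λ G H D (U , _ , f , _ , _ , _ , edges) →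
  hubOf G p m U (FromTreeDecomposition.elim D) (FromTreeDecomposition.edge-up D) φ H f _
    (λ u v → _ , refl , refl , refl) edges
  where open Transduction τ

-- Bipartite graphs

side : ∀ h {n} (x : Fin (h + n)) → (∃[ a ] (a ↑ˡ n ≡ x)) ⊎ (∃[ t ] (h ↑ʳ t ≡ x))
side h x with splitAt h x in e
... | inj₁ a = inj₁ (a , Fin.splitAt⁻¹-↑ˡ e)
... | inj₂ t = inj₂ (t , Fin.splitAt⁻¹-↑ʳ e)

↑ˡ≢↑ʳ : ∀ {h n} {a : Fin h} {t : Fin n} → a ↑ˡ n ≢ h ↑ʳ t
↑ˡ≢↑ʳ {h} {n} {a} {t} e with trans (sym (Fin.splitAt-↑ˡ h a n)) (trans (cong (splitAt h) e) (Fin.splitAt-↑ʳ h n t))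
... | ()

module _ {h n : ℕ} (N : Fin n → Fin h → Bool) where

  bip-edge : ∀ {t a} → N t a ≡ true → bipAdj h n N (h ↑ʳ t) (a ↑ˡ n) ≡ true
  bip-edge {t} {a} e rewrite Fin.splitAt-↑ʳ h n t | Fin.splitAt-↑ˡ h a n = e

  bip-edge⇒ : ∀ {t a} → bipAdj h n N (h ↑ʳ t) (a ↑ˡ n) ≡ true → N t a ≡ true
  bip-edge⇒ {t} {a} e rewrite Fin.splitAt-↑ʳ h n t | Fin.splitAt-↑ˡ h a n = e

  bip-hidden : ∀ {a y} → bipAdj h n N (a ↑ˡ n) y ≡ true → ∃[ t ] (h ↑ʳ t ≡ y × N t a ≡ true)
  bip-hidden {a} {y} e with side h y
  ... | inj₁ (b , refl) rewrite Fin.splitAt-↑ˡ h a n | Fin.splitAt-↑ˡ h b n = contradiction e λ ()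
  ... | inj₂ (t , refl) rewrite Fin.splitAt-↑ˡ h a n | Fin.splitAt-↑ʳ h n t = t , refl , e

  bip-target : ∀ {t y} → bipAdj h n N (h ↑ʳ t) y ≡ true → ∃[ a ] (a ↑ˡ n ≡ y × N t a ≡ true)
  bip-target {t} {y} e with side h y
  ... | inj₁ (b , refl) rewrite Fin.splitAt-↑ʳ h n t | Fin.splitAt-↑ˡ h b n = b , refl , e
  ... | inj₂ (s , refl) rewrite Fin.splitAt-↑ʳ h n t | Fin.splitAt-↑ʳ h n s = contradiction e λ ()

-- Lacon-decompositions from hubs

-- Hidden vertices are triples (z, c₁, c₂); a target is adjacent to those whose z lies in its
-- up-set and whose pair of colours contains its own.  Pairs with c₁ = c₂ are ordered on top, so
-- that the dominant vertex of two targets carries exactly their colours.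
module HubLacon {H : Graph} {B c : ℕ} (D : Hub H B c) where
  open Hub D renaming (N to M)

  n h : ℕ
  n = size H
  h = M * (c * c)

  abstract
    triple : Fin M → Fin c → Fin c → Fin h
    triple z d e = combine z (combine d e)

    node : Fin h → Fin M
    node a = proj₁ (remQuot {M} (c * c) a)

    c₁ c₂ : Fin h → Fin c
    c₁ a = proj₁ (remQuot {c} c (proj₂ (remQuot {M} (c * c) a)))
    c₂ a = proj₂ (remQuot {c} c (proj₂ (remQuot {M} (c * c) a)))

    triple-η : ∀ a → triple (node a) (c₁ a) (c₂ a) ≡ a
    triple-η a = trans (cong (combine (node a)) (Fin.combine-remQuot {c} c (proj₂ (remQuot {M} (c * c) a)))) (Fin.combine-remQuot {M} (c * c) a)

    node-triple : ∀ z d e → node (triple z d e) ≡ z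
    node-triple z d e = cong proj₁ (Fin.remQuot-combine z (combine d e))

    c₁-triple : ∀ z d e → c₁ (triple z d e) ≡ d
    c₁-triple z d e = trans (cong (λ p → proj₁ (remQuot {c} c (proj₂ p))) (Fin.remQuot-combine z (combine d e))) (cong proj₁ (Fin.remQuot-combine d e))

    c₂-triple : ∀ z d e → c₂ (triple z d e) ≡ e
    c₂-triple z d e = trans (cong (λ p → proj₂ (remQuot {c} c (proj₂ p))) (Fin.remQuot-combine z (combine d e))) (cong proj₂ (Fin.remQuot-combine d e))

  triple-ext : ∀ {a b} → node a ≡ node b → c₁ a ≡ c₁ b → c₂ a ≡ c₂ b → a ≡ b
  triple-ext {a} {b} p q r = trans (sym (triple-η a)) (trans (cong₂ (λ z → uncurry (triple z)) p (cong₂ _,_ q r)) (triple-η b))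

  diagonal : Fin h → ℕ
  diagonal a = if does (c₁ a ≟ c₂ a) then 1 else 0

  diagonal<2 : ∀ a → diagonal a < 2
  diagonal<2 a with does (c₁ a ≟ c₂ a)
  ... | true  = s≤s (s≤s z≤n)
  ... | false = s≤s z≤n

  diagonal⇒ : ∀ {a} → 1 ≤ diagonal a → c₁ a ≡ c₂ a
  diagonal⇒ {a} le with c₁ a ≟ c₂ a
  ... | yes e = e
  ... | no _  = contradiction le λ ()

  ⇒diagonal : ∀ {a} → c₁ a ≡ c₂ a → 1 ≤ diagonal a
  ⇒diagonal {a} e with c₁ a ≟ c₂ a
  ... | yes _ = ℕ.≤-refl
  ... | no ne = contradiction e ne

  πH : Fin h → ℕ
  πH a = (rank (node a) * 2 + diagonal a) * (c * c) + toℕ (combine (c₁ a) (c₂ a))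

  πH-≤⇒ : ∀ {a b} → πH a ≤ πH b → rank (node a) * 2 + diagonal a ≤ rank (node b) * 2 + diagonal b
  πH-≤⇒ {a} {b} = lex-≤⇒≤ (Fin.toℕ<n (combine (c₁ b) (c₂ b)))

  πH-≤⇒rank : ∀ {a b} → πH a ≤ πH b → rank (node a) ≤ rank (node b)
  πH-≤⇒rank {a} {b} le = lex-≤⇒≤ (diagonal<2 b) (πH-≤⇒ {a} {b} le)

  πH-inj : ∀ {a b} → πH a ≡ πH b → a ≡ b
  πH-inj {a} {b} e = triple-ext
    (rank-inj (proj₁ (lex-injective {2} {rank (node a)} {rank (node b)} (diagonal<2 a) (diagonal<2 b) (proj₁ e'))))
    (combine-injectiveˡ same) (combine-injectiveʳ {i = c₁ a} {c₁ b} same)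
    where
    e' = lex-injective {c * c} {rank (node a) * 2 + diagonal a} {rank (node b) * 2 + diagonal b}
           (Fin.toℕ<n (combine (c₁ a) (c₂ a))) (Fin.toℕ<n (combine (c₁ b) (c₂ b))) e
    same : combine (c₁ a) (c₂ a) ≡ combine (c₁ b) (c₂ b)
    same = Fin.toℕ-injective (proj₂ e')

  above : ℕ
  above = proj₁ (upperBound πH)

  π : Fin (h + n) → ℕ
  π x = [ πH , (λ t → above + toℕ t) ]′ (splitAt h x)

  π-hidden : ∀ a → π (a ↑ˡ n) ≡ πH a
  π-hidden a = cong [ πH , (λ t → above + toℕ t) ]′ (Fin.splitAt-↑ˡ h a n)

  π-target : ∀ t → π (h ↑ʳ t) ≡ above + toℕ t
  π-target t = cong [ πH , (λ t → above + toℕ t) ]′ (Fin.splitAt-↑ʳ h n t)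

  π-H<T : ∀ a t → π (a ↑ˡ n) < π (h ↑ʳ t)
  π-H<T a t = subst₂ _<_ (sym (π-hidden a)) (sym (π-target t)) (ℕ.<-≤-trans (proj₂ (upperBound πH) a) (ℕ.m≤m+n above (toℕ t)))

  π-inj : Injective _≡_ _≡_ π
  π-inj {x} {y} e with side h x | side h y
  ... | inj₁ (a , refl) | inj₁ (b , refl) = cong (_↑ˡ n) (πH-inj (trans (sym (π-hidden a)) (trans e (π-hidden b))))
  ... | inj₁ (a , refl) | inj₂ (t , refl) = contradiction e (ℕ.<⇒≢ (π-H<T a t))
  ... | inj₂ (t , refl) | inj₁ (a , refl) = contradiction (sym e) (ℕ.<⇒≢ (π-H<T a t))
  ... | inj₂ (s , refl) | inj₂ (t , refl) = cong (h ↑ʳ_) (Fin.toℕ-injective (ℕ.+-cancelˡ-≡ above _ _ (trans (sym (π-target s)) (trans e (π-target t)))))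

  Adjacent : V H → Fin h → Set
  Adjacent t a = Up (place t) (node a) × (colour t ≡ c₁ a ⊎ colour t ≡ c₂ a)

  adjacent? : ∀ t a → Dec (Adjacent t a)
  adjacent? t a = up? (place t) (node a) ×-dec ((colour t ≟ c₁ a) ⊎-dec (colour t ≟ c₂ a))

  N : V H → Fin h → Bool
  N t a = does (adjacent? t a)

  meeting : ∀ t t' → ∃[ z ] Meet z t t'
  meeting t t' = argmax (λ u → up? (place t) u ×-dec up? (place t') u) rank (root , up-root , up-root)

  joint : ∀ {z t t'} → Meet z t t' → N t (triple z (colour t) (colour t')) ≡ true × N t' (triple z (colour t) (colour t')) ≡ true
  joint {z} {t} {t'} ((p , q) , _) =
    dec-true (adjacent? t _) (subst (Up (place t)) (sym (node-triple z _ _)) p , inj₁ (sym (c₁-triple z _ _))) ,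
    dec-true (adjacent? t' _) (subst (Up (place t')) (sym (node-triple z _ _)) q , inj₂ (sym (c₂-triple z _ _)))

  -- The label is read off an arbitrary pair meeting at the node with these colours; by
  -- `determined`, all such pairs give the same answer.
  Labelled : Fin h → V H → V H → Set
  Labelled a x y = x ≢ y × colour x ≡ c₁ a × colour y ≡ c₂ a × Meet (node a) x y × E H x y

  labelled? : ∀ a → Dec (∃₂ (Labelled a))
  labelled? a = any? λ x → any? λ y → ¬? (x ≟ y) ×-dec ((colour x ≟ c₁ a) ×-dec ((colour y ≟ c₂ a) ×-dec
    (((up? (place x) (node a) ×-dec up? (place y) (node a)) ×-dec
      all? (λ u → (up? (place x) u ×-dec up? (place y) u) →-dec (rank u ℕ.≤? rank (node a))))
     ×-dec (adj H x y Bool.≟ true))))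

  -- The triple built from the meeting point and the two colours is a common neighbour, so the
  -- dominant vertex is not below it; its node, being shared too, is the meeting point. If both
  -- targets have the same colour, that triple is diagonal, which forces the dominant one to be
  -- diagonal as well.
  dominant : ∀ {t t' a} → Dominant N (λ b → π (b ↑ˡ n)) t t' a → Meet (node a) t t' ×
    ((colour t ≡ c₁ a × colour t' ≡ c₂ a) ⊎ (colour t' ≡ c₁ a × colour t ≡ c₂ a))
  dominant {t} {t'} {a} (ta , t'a , top)
    with does⇒ (adjacent? t a) ta | does⇒ (adjacent? t' a) t'a | meeting t t'
  ... | p , ct | p' , ct' | z , meets@((zt , zt') , z-top) = ((p , p') , λ u q → ℕ.≤-trans (z-top u q) z≤a) , cols ct ct'
    where
    b = triple z (colour t) (colour t')
    b≤a : πH b ≤ πH a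
    b≤a = subst₂ _≤_ (π-hidden b) (π-hidden a) (top b (proj₁ (joint meets)) (proj₂ (joint meets)))
    z≤a : rank z ≤ rank (node a)
    z≤a = subst (λ w → rank w ≤ rank (node a)) (node-triple z _ _) (πH-≤⇒rank {b} {a} b≤a)
    node-b : node b ≡ node a
    node-b = trans (node-triple z _ _) (rank-inj (ℕ.≤-antisym z≤a (z-top (node a) (p , p'))))
    diag : colour t ≡ colour t' → c₁ a ≡ c₂ a
    diag e = diagonal⇒ {a} (ℕ.≤-trans (⇒diagonal {b} (trans (c₁-triple z _ _) (trans e (sym (c₂-triple z _ _)))))
      (ℕ.+-cancelˡ-≤ (rank (node b) * 2) _ _ (subst (λ w → rank (node b) * 2 + diagonal b ≤ rank w * 2 + diagonal a) (sym node-b) (πH-≤⇒ {b} {a} b≤a))))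
    cols : colour t ≡ c₁ a ⊎ colour t ≡ c₂ a → colour t' ≡ c₁ a ⊎ colour t' ≡ c₂ a →
           (colour t ≡ c₁ a × colour t' ≡ c₂ a) ⊎ (colour t' ≡ c₁ a × colour t ≡ c₂ a)
    cols (inj₁ e) (inj₁ e') = inj₁ (e , trans e' (diag (trans e (sym e'))))
    cols (inj₁ e) (inj₂ e') = inj₁ (e , e')
    cols (inj₂ e) (inj₁ e') = inj₂ (e' , e)
    cols (inj₂ e) (inj₂ e') = inj₂ (trans e' (sym (diag (trans e (sym e')))) , e)

  meet-swap : ∀ {z t t'} → Meet z t t' → Meet z t' t
  meet-swap ((p , q) , top) = (q , p) , λ u (r , s) → top u (s , r)

  common : ∀ t t' → ∃[ a ] (N t a ≡ true × N t' a ≡ true)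
  common t t' = let (z , m) = meeting t t' in triple z (colour t) (colour t') , joint m

  lacon : LaconDecomposition H
  lacon = record
    { h = h ; N = N ; label = λ a → does (labelled? a) ; π = π ; π-inj = π-inj ; π-H<T = π-H<T ; common = common
    ; edges = λ t t' t≢t' → mk⇔ (to t t' t≢t') (from t t' t≢t') }
    where
    to : ∀ t t' → t ≢ t' → E H t t' → ∃[ a ] (Dominant N (λ b → π (b ↑ˡ n)) t t' a × does (labelled? a) ≡ true)
    to t t' t≢t' e with argmax (λ a → (N t a Bool.≟ true) ×-dec (N t' a Bool.≟ true)) (λ b → π (b ↑ˡ n)) (common t t')
    ... | a , (ta , t'a) , top = a , dom , dec-true (labelled? a) (label-of (dominant dom))
      where
      dom : Dominant N (λ b → π (b ↑ˡ n)) t t' a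
      dom = ta , t'a , λ b p q → top b (p , q)
      label-of : Meet (node a) t t' × ((colour t ≡ c₁ a × colour t' ≡ c₂ a) ⊎ (colour t' ≡ c₁ a × colour t ≡ c₂ a)) → ∃₂ (Labelled a)
      label-of (m , inj₁ (p , q)) = t , t' , t≢t' , p , q , m , e
      label-of (m , inj₂ (p , q)) = t' , t , t≢t' ∘ sym , p , q , meet-swap m , trans (Graph.sym H t' t) e
    from : ∀ t t' → t ≢ t' → ∃[ a ] (Dominant N (λ b → π (b ↑ˡ n)) t t' a × does (labelled? a) ≡ true) → E H t t'
    from t t' t≢t' (a , dom , l) with dominant dom | does⇒ (labelled? a) l
    ... | m , inj₁ (p , q) | x , y , x≢y , p' , q' , m' , e = determined x≢y t≢t' (trans p' (sym p)) (trans q' (sym q)) m' m e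
    ... | m , inj₂ (p , q) | x , y , x≢y , p' , q' , m' , e =
      trans (Graph.sym H t t') (determined x≢y (t≢t' ∘ sym) (trans p' (sym p)) (trans q' (sym q)) m' (meet-swap m) e)

  -- `Star Up x z` makes `z` an ancestor of `x` in the elimination tree. The ancestors of `x` form a
  -- chain, so the lower of two is an ancestor of the other.
  star-up : ∀ {x y z} → Up x y → Star Up x z → rank z ≤ rank y → Star Up y z
  star-up {y = y} xy ε le = subst (Star Up y) (rank-inj (ℕ.≤-antisym (up-≤ xy) le)) ε
  star-up {y = y} xy (_◅_ {j = x'} xx' s) le with ℕ.≤-total (rank y) (rank x')
  ... | inj₁ y≤x' = star-up (up-closed xy xx' y≤x') s le
  ... | inj₂ x'≤y = up-closed xx' xy x'≤y ◅ s

  star-≤ : ∀ {x z} → Star Up x z → rank z ≤ rank x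
  star-≤ ε = ℕ.≤-refl
  star-≤ (p ◅ s) = ℕ.≤-trans (star-≤ s) (up-≤ p)

  star-low : ∀ {x z u} → Star Up x z → Up x u → rank u ≤ rank z → Up z u
  star-low ε xu le = xu
  star-low (p ◅ s) xu le = star-low s (up-closed xu p (ℕ.≤-trans le (star-≤ s))) le

  A : Fin (h + n) → Fin (h + n) → Bool
  A = bipAdj h n N

  module _ {v : Fin (h + n)} {z : Fin M} {u : Fin h} (low : ∀ b → π v ≤ π (b ↑ˡ n) → rank z ≤ rank (node b))
           (u≤z : rank (node u) ≤ rank z) where
    mutual
      -- Invariant along the walk: `z` is an ancestor of the current place. Hidden vertices passed
      -- on the way are not below `z`, so `star-up` renews it; once `u` is met, `star-low` puts its
      -- node into `Up z`.
      from-hidden : ∀ {a x y l} → Walk A (Allowed A π v (u ↑ˡ n)) x y l → a ↑ˡ n ≡ x → u ↑ˡ n ≡ y → Star Up (node a) z → Up z (node u)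
      from-hidden {a} (stay _) refl e s with Fin.↑ˡ-injective n u a e
      ... | refl = star-low s up-refl u≤z
      from-hidden (step _ e w) refl eq s with bip-hidden N e
      ... | t , refl , ta = from-target w refl eq (proj₁ (does⇒ (adjacent? t _) ta) ◅ s)

      from-target : ∀ {t x y l} → Walk A (Allowed A π v (u ↑ˡ n)) x y l → h ↑ʳ t ≡ x → u ↑ˡ n ≡ y → Star Up (place t) z → Up z (node u)
      from-target (stay _) refl e s = contradiction e ↑ˡ≢↑ʳ
      from-target {t} (step _ e w) refl eq s with bip-target N e
      ... | b , refl , tb with walk-head w
      ...   | inj₁ b≡u = star-low s (subst (λ a → Up (place t) (node a)) (Fin.↑ˡ-injective n b u b≡u) (proj₁ (does⇒ (adjacent? t b) tb))) u≤z
      ...   | inj₂ v≤b = from-hidden w refl eq (star-up (proj₁ (does⇒ (adjacent? t b) tb)) s (low b v≤b))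

  reach-hidden : ∀ v → ∃[ x ] (∀ u → Reachable∞ A π v (u ↑ˡ n) → Up x (node u))
  reach-hidden v with side h v
  ... | inj₁ (a , refl) = node a , λ u (le , _ , w) →
          from-hidden (λ b p → πH-≤⇒rank {a} {b} (subst₂ _≤_ (π-hidden a) (π-hidden b) p))
                      (πH-≤⇒rank {u} {a} (subst₂ _≤_ (π-hidden u) (π-hidden a) le)) w refl refl ε
  -- All hidden vertices precede the targets, so the first hidden vertex on a walk from a target is
  -- already its end `u`.
  ... | inj₂ (t , refl) = place t , λ u (_ , _ , w) → direct w refl
    where
    direct : ∀ {u y l} → Walk A (Allowed A π (h ↑ʳ t) (u ↑ˡ n)) (h ↑ʳ t) y l → u ↑ˡ n ≡ y → Up (place t) (node u)
    direct (stay _) e = contradiction e ↑ˡ≢↑ʳ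
    direct {u} (step _ e w) _ with bip-target N e
    ... | b , refl , tb with walk-head w
    ...   | inj₁ b≡u = subst (λ a → Up (place t) (node a)) (Fin.↑ˡ-injective n b u b≡u) (proj₁ (does⇒ (adjacent? t b) tb))
    ...   | inj₂ v≤b = contradiction v≤b (ℕ.<⇒≱ (π-H<T b t))

  reach-target : ∀ v s → Reachable∞ A π v (h ↑ʳ s) → h ↑ʳ s ≡ v
  reach-target v s (le , _ , w) with side h v
  ... | inj₁ (a , refl) = contradiction le (ℕ.<⇒≱ (π-H<T a s))
  ... | inj₂ (t , refl) = direct w refl
    where
    direct : ∀ {y l} → Walk A (Allowed A π (h ↑ʳ t) (h ↑ʳ s)) (h ↑ʳ t) y l → h ↑ʳ s ≡ y → h ↑ʳ s ≡ h ↑ʳ t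
    direct (stay _) e = e
    direct (step _ e w) _ with bip-target N e
    ... | b , refl , tb with walk-head w
    ...   | inj₁ b≡s = contradiction b≡s ↑ˡ≢↑ʳ
    ...   | inj₂ v≤b = contradiction v≤b (ℕ.<⇒≱ (π-H<T b t))

  slot : Fin (h + n) → Fin (suc (B * (c * c)))
  slot x = [ (λ a → suc (combine (name (node a)) (combine (c₁ a) (c₂ a)))) , (λ _ → zero) ]′ (splitAt h x)

  slot-hidden : ∀ a → slot (a ↑ˡ n) ≡ suc (combine (name (node a)) (combine (c₁ a) (c₂ a)))
  slot-hidden a = cong [ _ , _ ]′ (Fin.splitAt-↑ˡ h a n)

  slot-target : ∀ t → slot (h ↑ʳ t) ≡ zero
  slot-target t = cong [ _ , _ ]′ (Fin.splitAt-↑ʳ h n t)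

  col∞ : Col∞≤ A π (suc (B * (c * c)))
  col∞ v S reach = injectiveOn⇒∣∣≤ S slot inj
    where
    inj : ∀ x y → x ∈ S → y ∈ S → slot x ≡ slot y → x ≡ y
    inj x y x∈ y∈ e with side h x | side h y
    ... | inj₁ (a , refl) | inj₁ (b , refl) = cong (_↑ˡ n) (triple-ext
            (name-inj (proj₂ (reach-hidden v) a (reach _ x∈)) (proj₂ (reach-hidden v) b (reach _ y∈)) (combine-injectiveˡ e'))
            (combine-injectiveˡ e″) (combine-injectiveʳ {i = c₁ a} {c₁ b} e″))
      where
      e' = Fin.suc-injective (trans (sym (slot-hidden a)) (trans e (slot-hidden b)))
      e″ = combine-injectiveʳ {i = name (node a)} {name (node b)} e'
    ... | inj₁ (a , refl) | inj₂ (t , refl) = contradiction (trans (sym (slot-hidden a)) (trans e (slot-target t))) λ ()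
    ... | inj₂ (t , refl) | inj₁ (a , refl) = contradiction (trans (sym (slot-hidden a)) (trans (sym e) (slot-target t))) λ ()
    ... | inj₂ (s , refl) | inj₂ (t , refl) = trans (reach-target v s (reach _ x∈)) (sym (reach-target v t (reach _ y∈)))

structural⇒lacon : ∀ 𝒢 → StructurallyBoundedTreewidth 𝒢 → LaconCondition 𝒢
structural⇒lacon 𝒢 (𝒢' , (k , tw) , τ , covered) =
  let (B , c , hubs) = hub k τ in suc (suc (B * (c * c))) , λ G g →
  let (G' , g' , G∈) = covered G g ; D = hubs G' G (tw G' g') G∈ in HubLacon.lacon D , HubLacon.col∞ D

-- Elimination structures from generalised colouring numbers

-- Vertices are eliminated in order of decreasing π; the i-th fill-in joins the neighbours of
-- those with π w + i ≥ M.
module FillIn {N : ℕ} (A : Fin N → Fin N → Bool) (A-sym : ∀ u v → A u v ≡ A v u)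
              (π : Fin N → ℕ) (π-inj : Injective _≡_ _≡_ π) {c : ℕ} (col : Col∞≤ A π c) where

  M : ℕ
  M = proj₁ (upperBound π)

  π<M : ∀ v → π v < M
  π<M = proj₂ (upperBound π)

  Fill : ℕ → Fin N → Fin N → Set
  Fill zero    v u = A v u ≡ true
  Fill (suc i) v u = Fill i v u ⊎ ∃[ w ] (suc (π w + i) ≡ M × Fill i v w × Fill i w u)

  fill? : ∀ i v u → Dec (Fill i v u)
  fill? zero    v u = A v u Bool.≟ true
  fill? (suc i) v u = fill? i v u ⊎-dec any? (λ w → (suc (π w + i) ℕ.≟ M) ×-dec (fill? i v w ×-dec fill? i w u))

  fill-sym : ∀ i {v u} → Fill i v u → Fill i u v
  fill-sym zero    e = trans (A-sym _ _) e
  fill-sym (suc i) (inj₁ f) = inj₁ (fill-sym i f)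
  fill-sym (suc i) (inj₂ (w , e , f , g)) = inj₂ (w , e , fill-sym i g , fill-sym i f)

  fill-mono : ∀ {i j v u} → i ≤ j → Fill i v u → Fill j v u
  fill-mono {j = zero}  z≤n f = f
  fill-mono {j = suc j} le f with ℕ.m≤n⇒m<n∨m≡n le
  ... | inj₁ (s≤s le') = inj₁ (fill-mono le' f)
  ... | inj₂ refl      = f

  -- Each fill edge is unfolded into a walk through the vertex whose elimination created it; all
  -- interior vertices have been eliminated before round `i`.
  fill-walk : ∀ i {P : Fin N → Set} → (∀ w → M ≤ π w + i → P w) → ∀ {v u} → Fill i v u → P v → P u → ∃[ l ] Walk A P v u l
  fill-walk zero    h e pv pu = 1 , step pv e (stay pu)
  fill-walk (suc i) h (inj₁ f) pv pu = fill-walk i (λ w le → h w (ℕ.≤-trans le (ℕ.+-monoʳ-≤ (π w) (ℕ.n≤1+n i)))) f pv pu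
  fill-walk (suc i) {P} h (inj₂ (w , e , f , g)) pv pu = _ , proj₂ (fill-walk i h' f pv pw) ++ʷ proj₂ (fill-walk i h' g pw pu)
    where
    h' : ∀ w → M ≤ π w + i → P w
    h' w le = h w (ℕ.≤-trans le (ℕ.+-monoʳ-≤ (π w) (ℕ.n≤1+n i)))
    pw : P w
    pw = h w (ℕ.≤-reflexive (trans (sym e) (sym (ℕ.+-suc (π w) i))))

  stage : Fin N → ℕ
  stage v = M ∸ suc (π v)

  stage-+ : ∀ v → suc (π v) + stage v ≡ M
  stage-+ v = ℕ.m+[n∸m]≡n (π<M v)

  Up : Fin N → Fin N → Set
  Up v u = u ≡ v ⊎ (π u < π v × Fill (stage v) v u)

  up? : ∀ v u → Dec (Up v u)
  up? v u = (u ≟ v) ⊎-dec ((π u ℕ.<? π v) ×-dec fill? (stage v) v u)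

  up-≤ : ∀ {v u} → Up v u → π u ≤ π v
  up-≤ (inj₁ refl)     = ℕ.≤-refl
  up-≤ (inj₂ (lt , _)) = ℕ.<⇒≤ lt

  -- Eliminating `v` joins its neighbours `y` and `z`. Since `z` precedes `v` in `π`, this happens
  -- before the stage of `z`, at which `Up z` is read off.
  up-closed : ∀ {v y z} → Up v y → Up v z → π y ≤ π z → Up z y
  up-closed p (inj₁ refl) le = p
  up-closed (inj₁ refl) (inj₂ (lt , _)) le = contradiction le (ℕ.<⇒≱ lt)
  up-closed {v} {y} {z} (inj₂ (_ , f)) (inj₂ (z<v , g)) le with ℕ.m≤n⇒m<n∨m≡n le
  ... | inj₂ e   = inj₁ (π-inj e)
  ... | inj₁ y<z = inj₂ (y<z , fill-mono later (inj₂ (v , stage-+ v , fill-sym (stage v) g , f)))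
    where
    later : suc (stage v) ≤ stage z
    later = ℕ.m+n≤o⇒m≤o∸n (suc (stage v)) (ℕ.≤-trans (ℕ.+-monoʳ-≤ (suc (stage v)) z<v)
      (ℕ.≤-reflexive (trans (cong suc (ℕ.+-comm (stage v) (π v))) (stage-+ v))))

  up-reachable : ∀ {v u} → Up v u → Reachable∞ A π v u
  up-reachable (inj₁ refl) = ℕ.≤-refl , 0 , stay (inj₁ refl)
  up-reachable {v} {u} (inj₂ (lt , f)) = ℕ.<⇒≤ lt , fill-walk (stage v)
    (λ w le → inj₂ (ℕ.<⇒≤ (ℕ.+-cancelʳ-≤ (stage v) _ _ (ℕ.≤-trans (ℕ.≤-reflexive (stage-+ v)) le)))) f (inj₂ ℕ.≤-refl) (inj₁ refl)

  elim : Elim N (suc c)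
  elim = Greedy.greedy π π-inj Up up? (inj₁ refl) up-≤ up-closed c
    (λ v → col v (select (up? v)) (λ u u∈ → up-reachable (∈-select⇒ (up? v) u∈)))

  edge-up : ∀ {v u} → A v u ≡ true → π u < π v → Up v u
  edge-up e lt = inj₂ (lt , fill-mono z≤n e)

-- Elimination structures of lacon-decompositions

module LaconElim {G : Graph} (𝓛 : LaconDecomposition G) {c : ℕ}
  (col : Col∞≤ (adj (LaconDecomposition.L 𝓛)) (LaconDecomposition.π 𝓛) c) where
  open LaconDecomposition 𝓛 public using (h; N; label; common; edges; L; π-H<T; π-inj)

  n : ℕ
  n = size G

  private
    module Fill = FillIn (adj L) (Graph.sym L) (LaconDecomposition.π 𝓛) π-inj col

  open RootedElim (addRoot Fill.elim) public using (root; Up; up-refl; up-root; up-closed; name; name-inj)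

  rooted : RootedElim (suc (h + n)) (suc (suc c))
  rooted = addRoot Fill.elim

  hidden : Fin h → Fin (suc (h + n))
  hidden a = suc (a ↑ˡ n)

  target : Fin n → Fin (suc (h + n))
  target t = suc (h ↑ʳ t)

  π : Fin h → ℕ
  π a = LaconDecomposition.π 𝓛 (a ↑ˡ n)

  π-injective : ∀ {a b} → π a ≡ π b → a ≡ b
  π-injective e = Fin.↑ˡ-injective n _ _ (π-inj e)

  target-up : ∀ {t a} → N t a ≡ true → Up (target t) (hidden a)
  target-up {t} {a} e = Fill.edge-up (bip-edge N e) (π-H<T a t)

  name-unique : ∀ {t a b} → N t a ≡ true → N t b ≡ true → name (hidden a) ≡ name (hidden b) → a ≡ b
  name-unique p q e = Fin.↑ˡ-injective n _ _ (Fin.suc-injective (name-inj (target-up p) (target-up q) e))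

  up-hidden : ∀ {t a b} → N t a ≡ true → N t b ≡ true → π b ≤ π a → Up (hidden a) (hidden b)
  up-hidden p q le = up-closed (target-up q) (target-up p) (s≤s le)

  top : ∀ t t' → ∃[ a ] Dominant N π t t' a
  top t t' with argmax (λ a → (N t a Bool.≟ true) ×-dec (N t' a Bool.≟ true)) π (common t t')
  ... | a , (p , q) , mx = a , p , q , λ b r s → mx b (r , s)

  edge⇔label : ∀ {t t' a} → t ≢ t' → Dominant N π t t' a → E G t t' ⇔ (label a ≡ true)
  edge⇔label {t} {t'} {a} ne dom@(p , q , mx) = mk⇔
    (λ e → let (b , (p' , q' , mx') , l) = Equivalence.to (edges t t' ne) e in
           subst (λ a → label a ≡ true) (π-injective (ℕ.≤-antisym (mx b p' q') (mx' a p q))) l)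
    (λ l → Equivalence.from (edges t t' ne) (a , dom , l))

-- Shrub-decompositions from lacon-decompositions

-- Each target t gets a pendant leaf, and every hidden neighbour a of t is joined to t by a path
-- of length ℓ + 4 · #{neighbours of t above a} + label a.  Among the common neighbours of t and
-- t', the dominant one therefore gives the shortest connection, and its label can be read off
-- the distance modulo 4.  All paths are embedded in copies of one long path, started at
-- different positions; unused ones lead to the root.
module LaconShrub {G : Graph} (𝓛 : LaconDecomposition G) {c : ℕ}
  (col : Col∞≤ (adj (LaconDecomposition.L 𝓛)) (LaconDecomposition.π 𝓛) c) where
  open LaconElim 𝓛 col

  -- `ℓ` is a multiple of 4 that no bonus exceeds. A connection thus has length between `ℓ` and
  -- `2 * ℓ`, and two of them at most `4 * ℓ`, which is no more than a detour of four connections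
  -- over a further target. Paths of this `depth` make a way over the root longer than that as well.
  B ℓ depth M : ℕ
  B     = suc (suc c)
  ℓ     = 4 * suc B
  depth = suc (suc (3 * ℓ))
  M     = suc (h + n)

  higher? : ∀ t a b → Dec (N t b ≡ true × π a < π b)
  higher? t a b = (N t b Bool.≟ true) ×-dec (π a ℕ.<? π b)

  count : Fin n → Fin h → ℕ
  count t a = ∣ select (higher? t a) ∣

  count≤ : ∀ t a → count t a ≤ B
  count≤ t a = injectiveOn⇒∣∣≤ (select (higher? t a)) (name ∘ hidden) λ x y x∈ y∈ →
    name-unique (proj₁ (∈-select⇒ (higher? t a) x∈)) (proj₁ (∈-select⇒ (higher? t a) y∈))

  count-< : ∀ {t a b} → N t b ≡ true → π a < π b → count t b < count t a
  count-< {t} {a} {b} p lt = Subset.p⊂q⇒∣p∣<∣q∣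
    ( (λ x∈ → let (q , lt') = ∈-select⇒ (higher? t b) x∈ in ⇒∈-select (higher? t a) (q , ℕ.<-trans lt lt'))
    , b , ⇒∈-select (higher? t a) (p , lt) , λ b∈ → ℕ.<-irrefl refl (proj₂ (∈-select⇒ (higher? t b) b∈)))

  mark : Bool → ℕ
  mark false = 0
  mark true  = 1

  mark≤1 : ∀ b → mark b ≤ 1
  mark≤1 false = z≤n
  mark≤1 true  = ℕ.≤-refl

  bonus : Fin n → Fin h → ℕ
  bonus t a = 4 * count t a + mark (label a)

  bonus≤ : ∀ t a → bonus t a ≤ ℓ
  bonus≤ t a = begin
    4 * count t a + mark (label a) ≤⟨ ℕ.+-mono-≤ (ℕ.*-monoʳ-≤ 4 (count≤ t a)) (ℕ.≤-trans (mark≤1 (label a)) (s≤s z≤n)) ⟩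
    4 * B + 4                      ≡⟨ trans (ℕ.+-comm (4 * B) 4) (sym (ℕ.*-suc 4 B)) ⟩
    ℓ                              ∎
    where open ℕ.≤-Reasoning

  -- One more higher neighbour costs 4, which outweighs the difference of at most 1 made by the
  -- label.
  bonus-≤ : ∀ {t a b} → N t b ≡ true → π a ≤ π b → bonus t b ≤ bonus t a
  bonus-≤ {t} {a} {b} p le with ℕ.m≤n⇒m<n∨m≡n le
  ... | inj₂ e rewrite π-injective e = ℕ.≤-refl
  ... | inj₁ lt = begin
    4 * count t b + mark (label b) ≤⟨ ℕ.+-monoʳ-≤ (4 * count t b) (ℕ.≤-trans (mark≤1 (label b)) (s≤s z≤n)) ⟩
    4 * count t b + 4              ≡⟨ trans (ℕ.+-comm (4 * count t b) 4) (sym (ℕ.*-suc 4 (count t b))) ⟩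
    4 * suc (count t b)            ≤⟨ ℕ.*-monoʳ-≤ 4 (count-< p lt) ⟩
    4 * count t a                  ≤⟨ ℕ.m≤m+n _ _ ⟩
    bonus t a                      ∎
    where open ℕ.≤-Reasoning

  len : Fin n → Fin h → ℕ
  len t a = ℓ + bonus t a

  ℓ≤len : ∀ t a → ℓ ≤ len t a
  ℓ≤len t a = ℕ.m≤m+n ℓ (bonus t a)

  len≤ : ∀ t a → len t a ≤ ℓ + ℓ
  len≤ t a = ℕ.+-monoʳ-≤ ℓ (bonus≤ t a)

  3ℓ : 3 * ℓ ≡ ℓ + ℓ + ℓ
  3ℓ = trans (cong (λ x → ℓ + (ℓ + x)) (ℕ.+-identityʳ ℓ)) (sym (ℕ.+-assoc ℓ ℓ ℓ))

  2ℓ≤3ℓ : ℓ + ℓ ≤ 3 * ℓ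
  2ℓ≤3ℓ = ℕ.≤-trans (ℕ.m≤m+n (ℓ + ℓ) ℓ) (ℕ.≤-reflexive (sym 3ℓ))

  len≤3ℓ : ∀ t a → len t a ≤ 3 * ℓ
  len≤3ℓ t a = ℕ.≤-trans (len≤ t a) 2ℓ≤3ℓ

  3ℓ≤depth : 3 * ℓ ≤ suc depth
  3ℓ≤depth = ℕ.m≤n+m (3 * ℓ) 3

  link′ : Fin B → Fin h ⊎ Fin n → Maybe (Fin n × Fin h)
  link′ b (inj₁ _) = nothing
  link′ b (inj₂ t) with any? (λ a → (N t a Bool.≟ true) ×-dec (name (hidden a) ≟ b))
  ... | yes (a , _) = just (t , a)
  ... | no _        = nothing

  link : Fin M → Fin B → Maybe (Fin n × Fin h)
  link zero    b = nothing
  link (suc y) b = link′ b (splitAt h y)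

  link-complete : ∀ {t a} → N t a ≡ true → link (target t) (name (hidden a)) ≡ just (t , a)
  link-complete {t} {a} p = trans (cong (link′ (name (hidden a))) (Fin.splitAt-↑ʳ h n t)) found
    where
    found : link′ (name (hidden a)) (inj₂ t) ≡ just (t , a)
    found with any? (λ a' → (N t a' Bool.≟ true) ×-dec (name (hidden a') ≟ name (hidden a)))
    ... | yes (a' , q , e) = cong (λ x → just (t , x)) (name-unique q p e)
    ... | no none = contradiction (a , p , refl) none

  link-sound : ∀ s b {t a} → link s b ≡ just (t , a) → target t ≡ s × N t a ≡ true
  link-sound (suc y) b e with splitAt h y in eq
  ... | inj₂ t with any? (λ a → (N t a Bool.≟ true) ×-dec (name (hidden a) ≟ b)) | e
  ...   | yes (a , q , _) | refl = cong suc (Fin.splitAt⁻¹-↑ʳ eq) , q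

  ptr′ : Maybe (Fin n × Fin h) → Fin M
  ptr′ nothing        = root
  ptr′ (just (t , a)) = hidden a

  start′ : Maybe (Fin n × Fin h) → ℕ
  start′ nothing        = 0
  start′ (just (t , a)) = suc depth ∸ len t a

  ptr : Fin M → Fin B → Fin M
  ptr s b = ptr′ (link s b)

  start : Fin M → Fin B → ℕ
  start s b = start′ (link s b)

  start′< : ∀ m → start′ m < depth
  start′< nothing = ℕ.0<1+n
  start′< (just (t , a)) = ℕ.∸-monoʳ-< {suc depth} {len t a} {1} (ℕ.≤-trans (s≤s (s≤s z≤n)) (ℓ≤len t a)) (ℕ.≤-trans (len≤3ℓ t a) 3ℓ≤depth)

  start< : ∀ s b → start s b < depth
  start< s b = start′< (link s b)

  weight : Maybe (Fin n × Fin h) → ℕ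
  weight m = suc (depth ∸ start′ m)

  weight-link : ∀ t a → weight (just (t , a)) ≡ len t a
  weight-link t a = trans (sym (ℕ.+-∸-assoc 1 (ℕ.<⇒≤ (start′< (just (t , a)))))) (ℕ.m∸[m∸n]≡n (ℕ.≤-trans (len≤3ℓ t a) 3ℓ≤depth))

  -- The graph of the shrub-decomposition

  data Node : Set where
    leaf : Fin n → Node
    cen  : Fin M → Node
    pth  : Fin M → Fin B → Fin depth → Node

  -- A centre is joined to all positions up to `start`, not only to that one: otherwise the initial
  -- part of the path would be a dead end and produce an unwanted vertex of degree one.
  Half : Node → Node → Set
  Half (leaf t)    (cen s)        = target t ≡ s
  Half (cen s)     (pth s' b j)   = s ≡ s' × toℕ j ≤ start s b
  Half (pth s b j) (pth s' b' j') = s ≡ s' × b ≡ b' × toℕ j' ≡ suc (toℕ j)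
  Half (pth s b j) (cen p)        = suc (toℕ j) ≡ depth × ptr s b ≡ p
  Half _           _              = ⊥

  half? : ∀ x y → Dec (Half x y)
  half? (leaf t)    (cen s)        = target t ≟ s
  half? (cen s)     (pth s' b j)   = (s ≟ s') ×-dec (toℕ j ℕ.≤? start s b)
  half? (pth s b j) (pth s' b' j') = (s ≟ s') ×-dec ((b ≟ b') ×-dec (toℕ j' ℕ.≟ suc (toℕ j)))
  half? (pth s b j) (cen p)        = (suc (toℕ j) ℕ.≟ depth) ×-dec (ptr s b ≟ p)
  half? (leaf _)    (leaf _)       = no λ ()
  half? (leaf _)    (pth _ _ _)    = no λ ()
  half? (cen _)     (leaf _)       = no λ ()
  half? (cen _)     (cen _)        = no λ ()
  half? (pth _ _ _) (leaf _)       = no λ ()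

  half-irreflexive : ∀ x → ¬ Half x x
  half-irreflexive (pth s b j) (_ , _ , e) = ℕ.1+n≢n (sym e)

  Adj : Node → Node → Set
  Adj x y = Half x y ⊎ Half y x

  adj? : ∀ x y → Dec (Adj x y)
  adj? x y = half? x y ⊎-dec half? y x

  adj-sym : ∀ {x y} → Adj x y → Adj y x
  adj-sym = [ inj₂ , inj₁ ]′

  sizeF : ℕ
  sizeF = n + (M + M * (B * depth))

  abstract
    encode : Node → Fin sizeF
    encode (leaf t)    = t ↑ˡ _
    encode (cen s)     = n ↑ʳ (s ↑ˡ _)
    encode (pth s b j) = n ↑ʳ (M ↑ʳ combine s (combine b j))

    private
      decodePth : Fin (M * (B * depth)) → Node
      decodePth x = let (s , r) = remQuot {M} (B * depth) x ; (b , j) = remQuot {B} depth r in pth s b j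

    decode : Fin sizeF → Node
    decode x = [ leaf , (λ y → [ cen , decodePth ]′ (splitAt M y)) ]′ (splitAt n x)

    decode-encode : ∀ x → decode (encode x) ≡ x
    decode-encode (leaf t) rewrite Fin.splitAt-↑ˡ n t (M + M * (B * depth)) = refl
    decode-encode (cen s)
      rewrite Fin.splitAt-↑ʳ n (M + M * (B * depth)) (s ↑ˡ _) | Fin.splitAt-↑ˡ M s (M * (B * depth)) = refl
    decode-encode (pth s b j)
      rewrite Fin.splitAt-↑ʳ n (M + M * (B * depth)) (M ↑ʳ combine s (combine b j))
            | Fin.splitAt-↑ʳ M (M * (B * depth)) (combine s (combine b j)) =
      trans (cong (λ p → let (b , j) = remQuot {B} depth (proj₂ p) in pth (proj₁ p) b j) (Fin.remQuot-combine s (combine b j)))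
            (cong (λ p → pth s (proj₁ p) (proj₂ p)) (Fin.remQuot-combine b j))

    encode-decode : ∀ x → encode (decode x) ≡ x
    encode-decode x with splitAt n x in e
    ... | inj₁ t = Fin.splitAt⁻¹-↑ˡ e
    ... | inj₂ y with splitAt M y in f
    ...   | inj₁ s = trans (cong (n ↑ʳ_) (Fin.splitAt⁻¹-↑ˡ f)) (Fin.splitAt⁻¹-↑ʳ e)
    ...   | inj₂ z = trans (cong (λ w → n ↑ʳ (M ↑ʳ w)) (trans
                       (cong (combine (proj₁ (remQuot {M} (B * depth) z))) (Fin.combine-remQuot {B} depth (proj₂ (remQuot {M} (B * depth) z))))
                       (Fin.combine-remQuot {M} (B * depth) z)))
                     (trans (cong (n ↑ʳ_) (Fin.splitAt⁻¹-↑ʳ f)) (Fin.splitAt⁻¹-↑ʳ e))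

  encode-injective : ∀ {x y} → encode x ≡ encode y → x ≡ y
  encode-injective {x} {y} e = trans (sym (decode-encode x)) (trans (cong decode e) (decode-encode y))

  decode-injective : ∀ {x y} → decode x ≡ decode y → x ≡ y
  decode-injective {x} {y} e = trans (sym (encode-decode x)) (trans (cong encode e) (encode-decode y))

  F : Graph
  F = record
    { size = sizeF
    ; adj  = λ x y → does (adj? (decode x) (decode y))
    ; sym  = λ x y → does-cong (adj? (decode x) (decode y)) (adj? (decode y) (decode x)) adj-sym adj-sym
    ; irr  = λ x → dec-false (adj? (decode x) (decode x)) [ half-irreflexive (decode x) , half-irreflexive (decode x) ]′
    }

  edgeF : ∀ {x y} → Adj x y → E F (encode x) (encode y)
  edgeF {x} {y} a = dec-true (adj? _ _) (subst₂ Adj (sym (decode-encode x)) (sym (decode-encode y)) a)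

  edgeF⇒ : ∀ {x y} → E F x y → Adj (decode x) (decode y)
  edgeF⇒ = does⇒ (adj? _ _)

  data Path : Node → Node → ℕ → Set where
    []  : ∀ {x} → Path x x 0
    _∷_ : ∀ {x y z l} → Adj x y → Path y z l → Path x z (suc l)

  path-walk : ∀ {x y l} → Path x y l → Walk (adj F) Anywhere (encode x) (encode y) l
  path-walk []      = stay tt
  path-walk (a ∷ p) = step tt (edgeF a) (path-walk p)

  _++ᵖ_ : ∀ {x y z k l} → Path x y k → Path y z l → Path x z (k + l)
  []      ++ᵖ q = q
  (a ∷ p) ++ᵖ q = a ∷ (p ++ᵖ q)

  run : ∀ s b k (j : Fin depth) → k + suc (toℕ j) ≡ depth → Path (pth s b j) (cen (ptr s b)) (suc k)
  run s b zero    j e = inj₁ (e , refl) ∷ []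
  run s b (suc k) j e = inj₁ (refl , refl , Fin.toℕ-fromℕ< j+1<) ∷
    run s b k (fromℕ< j+1<) (trans (cong (λ x → k + suc x) (Fin.toℕ-fromℕ< j+1<)) (trans (ℕ.+-suc k _) e))
    where
    j+1< : suc (toℕ j) < depth
    j+1< = ℕ.≤-trans (ℕ.m≤n+m (suc (suc (toℕ j))) k) (ℕ.≤-reflexive (trans (ℕ.+-suc k _) e))

  run∸ : ∀ s b (j : Fin depth) → Path (pth s b j) (cen (ptr s b)) (depth ∸ toℕ j)
  run∸ s b j = subst (Path _ _) (sym (ℕ.+-∸-assoc 1 (Fin.toℕ<n j)))
    (run s b (depth ∸ suc (toℕ j)) j (ℕ.m∸n+n≡m (Fin.toℕ<n j)))

  hop : ∀ s b → Path (cen s) (cen (ptr s b)) (weight (link s b))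
  hop s b = _∷_ {y = pth s b (fromℕ< (start< s b))} (inj₁ (refl , ℕ.≤-reflexive (Fin.toℕ-fromℕ< (start< s b))))
    (subst (λ k → Path (pth s b (fromℕ< (start< s b))) (cen (ptr s b)) (depth ∸ k)) (Fin.toℕ-fromℕ< (start< s b))
      (run∸ s b (fromℕ< (start< s b))))

  out : ∀ {t a} → N t a ≡ true → Path (leaf t) (cen (hidden a)) (suc (len t a))
  out {t} {a} p = inj₁ refl ∷ subst₂ (λ q k → Path (cen (target t)) (cen q) k)
    (cong ptr′ (link-complete p)) (trans (cong weight (link-complete p)) (weight-link t a)) (hop (target t) (name (hidden a)))

  link-hidden : ∀ a b → link (hidden a) b ≡ nothing
  link-hidden a b = cong (link′ b) (Fin.splitAt-↑ˡ h a n)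

  -- Targets point to hidden vertices or to the root, everything else only to the root; so two hops
  -- always suffice, which bounds the diameter.
  ptr-ptr : ∀ s b b' → ptr (ptr s b) b' ≡ root
  ptr-ptr s b b' with link s b
  ... | nothing = refl
  ... | just (t , a) = cong ptr′ (link-hidden a b')

  weight≤ : ∀ m → weight m ≤ suc depth
  weight≤ m = s≤s (ℕ.m∸n≤m depth (start′ m))

  home : Node → Fin M
  home (leaf t)    = target t
  home (cen s)     = s
  home (pth s _ _) = s

  toRoot : ∀ s → ∃[ l ] (l ≤ suc depth + suc depth × Path (cen s) (cen root) l)
  toRoot s = _ , ℕ.+-mono-≤ (weight≤ (link s zero)) (weight≤ (link (ptr s zero) zero)) ,
    (hop s zero ++ᵖ subst (λ q → Path (cen (ptr s zero)) (cen q) (weight (link (ptr s zero) zero))) (ptr-ptr s zero zero) (hop (ptr s zero) zero))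

  radius : ℕ
  radius = suc depth + (suc depth + suc depth)

  node-toRoot : ∀ x → ∃[ l ] (l ≤ radius × Path x (cen root) l)
  node-toRoot (leaf t) = let (l , le , p) = toRoot (target t) in suc l , s≤s (ℕ.m≤n⇒m≤o+n depth le) , inj₁ refl ∷ p
  node-toRoot (cen s) = let (l , le , p) = toRoot s in l , ℕ.m≤n⇒m≤o+n (suc depth) le , p
  node-toRoot (pth s b j) = let (l , le , p) = toRoot (ptr s b) in
    _ , ℕ.+-mono-≤ (ℕ.m≤n⇒m≤1+n (ℕ.m∸n≤m depth (toℕ j))) le , run∸ s b j ++ᵖ p

  diameter : ∀ x y → ∃[ l ] (l ≤ radius + radius × Walk (adj F) Anywhere x y l)
  diameter x y =
    let (k , k≤ , p) = node-toRoot (decode x) ; (l , l≤ , q) = node-toRoot (decode y) in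
    k + l , ℕ.+-mono-≤ k≤ l≤ ,
    subst₂ (λ a b → Walk (adj F) Anywhere a b (k + l)) (encode-decode x) (encode-decode y)
      (path-walk p ++ʷ walk-reverse (Graph.sym F) (path-walk q))

  -- The potential below is 1-Lipschitz on F, so it bounds distances from the leaf at t₀.
  module Potential (t₀ : Fin n) where

    -- A hidden vertex not adjacent to `t₀` is reached only over at least three connections of
    -- length at least `ℓ`, or over the still longer paths at the root; hence the default `3 * ℓ`.
    gh : Fin h → ℕ
    gh a = if N t₀ a then len t₀ a else 3 * ℓ

    gh≤ : ∀ a → gh a ≤ 3 * ℓ
    gh≤ a with N t₀ a
    ... | true  = len≤3ℓ t₀ a
    ... | false = ℕ.≤-refl

    ℓ≤gh : ∀ a → ℓ ≤ gh a
    ℓ≤gh a with N t₀ a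
    ... | true  = ℓ≤len t₀ a
    ... | false = ℕ.m≤m+n ℓ _

    gh-neighbour : ∀ {a} → N t₀ a ≡ true → gh a ≡ len t₀ a
    gh-neighbour {a} p = cong (λ b → if b then len t₀ a else 3 * ℓ) p

    nearest : ∀ t → ∃[ a ] (N t a ≡ true × ∀ b → N t b ≡ true → gh a + len t a ≤ gh b + len t b)
    nearest t = argmin (λ a → N t a Bool.≟ true) (λ a → gh a + len t a) (let (a , p , _) = common t t in a , p)

    via : Fin n → ℕ
    via t = gh (proj₁ (nearest t)) + len t (proj₁ (nearest t))

    gt : Fin n → ℕ
    gt t = if does (t ≟ t₀) then 0 else via t

    g′ : Fin h ⊎ Fin n → ℕ
    g′ = [ gh , gt ]′

    g : Fin M → ℕ
    g zero    = 3 * ℓ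
    g (suc y) = g′ (splitAt h y)

    g-hidden : ∀ a → g (hidden a) ≡ gh a
    g-hidden a = cong g′ (Fin.splitAt-↑ˡ h a n)

    g-target : ∀ t → g (target t) ≡ gt t
    g-target t = cong g′ (Fin.splitAt-↑ʳ h n t)

    g-bounded : ∀ s → g s ≤ 3 * ℓ + suc depth
    g-bounded zero = ℕ.m≤m+n _ _
    g-bounded (suc y) with splitAt h y
    ... | inj₁ a = ℕ.≤-trans (gh≤ a) (ℕ.m≤m+n _ _)
    ... | inj₂ t with does (t ≟ t₀)
    ...   | true  = z≤n
    ...   | false = ℕ.+-mono-≤ (gh≤ (proj₁ (nearest t))) (ℕ.≤-trans (len≤3ℓ t _) 3ℓ≤depth)

    Close : ℕ → ℕ → ℕ → Set
    Close k a b = a ≤ b + k × b ≤ a + k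

    close-target : ∀ {t a} → N t a ≡ true → Close (len t a) (gt t) (gh a)
    close-target {t} {a} p with t ≟ t₀
    ... | yes refl = z≤n , ℕ.≤-reflexive (gh-neighbour p)
    ... | no _ = proj₂ (proj₂ (nearest t)) a p , (begin
      gh a            ≤⟨ gh≤ a ⟩
      3 * ℓ           ≡⟨ 3ℓ ⟩
      ℓ + ℓ + ℓ       ≤⟨ ℕ.+-mono-≤ (ℕ.+-mono-≤ (ℓ≤gh (proj₁ (nearest t))) (ℓ≤len t _)) (ℓ≤len t a) ⟩
      via t + len t a ∎)
      where open ℕ.≤-Reasoning

    close-link : ∀ s b m → link s b ≡ m → Close (weight m) (g s) (g (ptr′ m))
    close-link s b nothing e = g-bounded s , ℕ.≤-trans 3ℓ≤depth (ℕ.m≤n+m _ (g s))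
    close-link s b (just (t , a)) e with link-sound s b e
    ... | refl , p = subst₂ (λ k x → Close k x (g (hidden a))) (sym (weight-link t a)) (sym (g-target t))
                       (subst (Close (len t a) (gt t)) (sym (g-hidden a)) (close-target p))

    close : ∀ s b → Close (weight (link s b)) (g s) (g (ptr s b))
    close s b = close-link s b (link s b) refl

    suc-∸-≤ : ∀ m k → suc m ∸ k ≤ suc (m ∸ k)
    suc-∸-≤ m       zero    = ℕ.≤-refl
    suc-∸-≤ zero    (suc k) = ℕ.≤-trans (ℕ.m∸n≤m 0 k) z≤n
    suc-∸-≤ (suc m) (suc k) = suc-∸-≤ m k

    -- The cheaper of coming from either end of the path. The first term is constant up to `start`,
    -- since the centre is joined to all of these positions.
    Φpth : Fin M → Fin B → ℕ → ℕ
    Φpth s b j = suc (g s + (j ∸ start s b)) ⊓ (g (ptr s b) + (depth ∸ j))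

    Φ : Node → ℕ
    Φ (leaf t)    = if does (t ≟ t₀) then 0 else suc (suc (gt t))
    Φ (cen s)     = suc (g s)
    Φ (pth s b j) = suc (Φpth s b (toℕ j))

    Lipschitz : Node → Node → Set
    Lipschitz x y = Φ x ≤ suc (Φ y) × Φ y ≤ suc (Φ x)

    lipschitz : ∀ x y → Half x y → Lipschitz x y
    lipschitz (leaf t) (cen s) refl rewrite g-target t with t ≟ t₀
    ... | yes _ = z≤n , ℕ.≤-refl
    ... | no _  = ℕ.≤-refl , s≤s (ℕ.m≤n⇒m≤1+n (ℕ.n≤1+n _))
    lipschitz (cen s) (pth s b j) (refl , le) =
      s≤s (ℕ.⊓-glb {y = suc (suc (g s + (toℕ j ∸ start s b)))} {z = suc (g (ptr s b) + (depth ∸ toℕ j))}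
        (ℕ.m≤n⇒m≤1+n (ℕ.m≤n⇒m≤1+n (ℕ.m≤m+n (g s) _)))
        (ℕ.≤-trans (proj₁ (close s b)) (ℕ.≤-trans (ℕ.≤-reflexive (ℕ.+-suc _ _)) (s≤s (ℕ.+-monoʳ-≤ (g (ptr s b)) (ℕ.∸-monoʳ-≤ depth le)))))) ,
      s≤s (ℕ.≤-trans (ℕ.m⊓n≤m _ _) (ℕ.≤-reflexive (cong suc (trans (cong (g s +_) (ℕ.m≤n⇒m∸n≡0 le)) (ℕ.+-identityʳ (g s))))))
    lipschitz (pth s b j) (pth s b j') (refl , refl , e) rewrite e =
      s≤s (ℕ.⊓-mono-≤ {y = suc (suc (g s + (suc (toℕ j) ∸ start s b)))} {v = suc (g (ptr s b) + (depth ∸ suc (toℕ j)))}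
        (s≤s (ℕ.m≤n⇒m≤1+n (ℕ.+-monoʳ-≤ (g s) (ℕ.∸-monoˡ-≤ (start s b) (ℕ.n≤1+n (toℕ j))))))
        (ℕ.≤-trans (ℕ.+-monoʳ-≤ (g (ptr s b)) (ℕ.≤-reflexive (ℕ.+-∸-assoc 1 (Fin.toℕ<n j)))) (ℕ.≤-reflexive (ℕ.+-suc _ _)))) ,
      s≤s (ℕ.⊓-mono-≤ {y = suc (suc (g s + (toℕ j ∸ start s b)))} {v = suc (g (ptr s b) + (depth ∸ toℕ j))}
        (s≤s (ℕ.≤-trans (ℕ.+-monoʳ-≤ (g s) (suc-∸-≤ (toℕ j) (start s b))) (ℕ.≤-reflexive (ℕ.+-suc _ _))))
        (ℕ.m≤n⇒m≤1+n (ℕ.+-monoʳ-≤ (g (ptr s b)) (ℕ.∸-monoʳ-≤ depth (ℕ.n≤1+n (toℕ j))))))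
    lipschitz (pth s b j) (cen p) (e , refl) =
      s≤s (ℕ.≤-trans (ℕ.m⊓n≤n (suc (g s + (toℕ j ∸ start s b))) _) (ℕ.≤-reflexive (trans (cong (g (ptr s b) +_) last) (ℕ.+-comm _ 1)))) ,
      s≤s (ℕ.⊓-glb {y = suc (suc (g s + (toℕ j ∸ start s b)))} {z = suc (g (ptr s b) + (depth ∸ toℕ j))}
        (ℕ.≤-trans (proj₂ (close s b)) (ℕ.≤-trans (ℕ.+-monoʳ-≤ (g s) (s≤s near)) (ℕ.≤-reflexive (trans (ℕ.+-suc _ _) (cong suc (ℕ.+-suc _ _))))))
        (ℕ.m≤n⇒m≤1+n (ℕ.m≤m+n (g (ptr s b)) _)))
      where
      last : depth ∸ toℕ j ≡ 1
      last = trans (ℕ.+-∸-assoc 1 (Fin.toℕ<n j)) (cong suc (trans (cong (depth ∸_) e) (ℕ.n∸n≡0 depth)))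
      near : depth ∸ start s b ≤ suc (toℕ j ∸ start s b)
      near = subst (λ d → d ∸ start s b ≤ suc (toℕ j ∸ start s b)) e (suc-∸-≤ (toℕ j) (start s b))

    walk-Φ : ∀ {x y l} → Walk (adj F) Anywhere x y l → Φ (decode y) ≤ Φ (decode x) + l
    walk-Φ (stay _) = ℕ.≤-reflexive (sym (ℕ.+-identityʳ _))
    walk-Φ (step {x} {y} {z} {l} _ e w) = begin
      Φ (decode z)           ≤⟨ walk-Φ w ⟩
      Φ (decode y) + l       ≤⟨ ℕ.+-monoˡ-≤ l (forward (edgeF⇒ e)) ⟩
      suc (Φ (decode x) + l) ≡⟨ sym (ℕ.+-suc _ l) ⟩
      Φ (decode x) + suc l   ∎
      where
      open ℕ.≤-Reasoning
      forward : Adj (decode x) (decode y) → Φ (decode y) ≤ suc (Φ (decode x))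
      forward (inj₁ p) = proj₂ (lipschitz _ _ p)
      forward (inj₂ p) = proj₁ (lipschitz _ _ p)

    Φ-start : Φ (leaf t₀) ≡ 0
    Φ-start = cong (λ b → if b then 0 else suc (suc (gt t₀))) (dec-true (t₀ ≟ t₀) refl)

    lower : ∀ {t a l} → t₀ ≢ t → Dominant N π t₀ t a → Walk (adj F) Anywhere (encode (leaf t₀)) (encode (leaf t)) l →
            suc (suc (len t₀ a + len t a)) ≤ l
    lower {t} {a} {l} ne (p₀ , p , top) w = begin
      suc (suc (len t₀ a + len t a)) ≤⟨ s≤s (s≤s (shortest (proj₁ (nearest t)) (proj₁ (proj₂ (nearest t))))) ⟩
      suc (suc (via t))              ≡⟨ cong (λ b → suc (suc (if b then 0 else via t))) (sym far) ⟩
      suc (suc (gt t))               ≡⟨ cong (λ b → if b then 0 else suc (suc (gt t))) (sym far) ⟩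
      Φ (leaf t)                     ≡⟨ cong Φ (sym (decode-encode (leaf t))) ⟩
      Φ (decode (encode (leaf t)))   ≤⟨ walk-Φ w ⟩
      Φ (decode (encode (leaf t₀))) + l ≡⟨ cong (_+ l) (trans (cong Φ (decode-encode (leaf t₀))) Φ-start) ⟩
      l                              ∎
      where
      open ℕ.≤-Reasoning
      far : does (t ≟ t₀) ≡ false
      far = dec-false (t ≟ t₀) (ne ∘ sym)
      shortest : ∀ b → N t b ≡ true → len t₀ a + len t a ≤ gh b + len t b
      shortest b q with N t₀ b in e
      ... | true  = ℕ.+-mono-≤ (ℕ.+-monoʳ-≤ ℓ (bonus-≤ p₀ (top b e q))) (ℕ.+-monoʳ-≤ ℓ (bonus-≤ p (top b e q)))
      -- Here `b` is not adjacent to `t₀`: `3 * ℓ` plus one more connection is at least `4 * ℓ`, and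
      -- the two connections of `a` never exceed this.
      ... | false = ℕ.≤-trans (ℕ.+-mono-≤ (len≤ t₀ a) (len≤ t a)) (ℕ.≤-trans (ℕ.≤-reflexive (sym (ℕ.+-assoc (ℓ + ℓ) ℓ ℓ)))
                      (ℕ.+-mono-≤ (ℕ.≤-reflexive (sym 3ℓ)) (ℓ≤len t b)))

  upper : ∀ {t t' a} → Dominant N π t t' a → Walk (adj F) Anywhere (encode (leaf t)) (encode (leaf t')) (suc (suc (len t a + len t' a)))
  upper {t} {t'} {a} (p , p' , _) = subst (Walk (adj F) Anywhere _ _) (cong suc (ℕ.+-suc (len t a) (len t' a)))
    (path-walk (out p) ++ʷ walk-reverse (Graph.sym F) (path-walk (out p')))

  distance : ∀ {t t' a l} → t ≢ t' → Dominant N π t t' a → Dist F (encode (leaf t)) (encode (leaf t')) l →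
             l ≡ suc (suc (len t a + len t' a))
  distance {t} ne dom (w , least) = ℕ.≤-antisym (ℕ.≮⇒≥ λ lt → least _ lt (upper dom)) (Potential.lower t ne dom w)

  -- Vertices of degree one

  two⇒≢1 : ∀ {x y z} → E F x y → E F x z → y ≢ z → ∣ tabulate (adj F x) ∣ ≢ 1
  two⇒≢1 {x} {y} {z} p q ne e = ℕ.<⇒≱ {1} (injectiveInto⇒≤∣∣ (tabulate (adj F x)) f inj ∈f) (ℕ.≤-reflexive e)
    where
    f : Fin 2 → V F
    f zero       = y
    f (suc zero) = z
    inj : Injective _≡_ _≡_ f
    inj {zero}     {zero}     _ = refl
    inj {zero}     {suc zero} e = contradiction e ne
    inj {suc zero} {zero}     e = contradiction (sym e) ne
    inj {suc zero} {suc zero} _ = refl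
    ∈f : ∀ i → f i ∈ tabulate (adj F x)
    ∈f zero       = ⇒∈-tabulate p
    ∈f (suc zero) = ⇒∈-tabulate q

  two-neighbours : ∀ {x y z} → Adj x y → Adj x z → y ≢ z → ∣ tabulate (adj F (encode x)) ∣ ≢ 1
  two-neighbours p q ne = two⇒≢1 (edgeF p) (edgeF q) (ne ∘ encode-injective)

  prev : ∀ s b (j : Fin depth) → ∃[ x ] (Adj (pth s b j) x × (x ≡ cen s × j ≡ zero ⊎ ∃[ i ] (x ≡ pth s b i × suc (toℕ i) ≡ toℕ j)))
  prev s b zero    = cen s , inj₂ (refl , z≤n) , inj₁ (refl , refl)
  prev s b (suc j) = pth s b (inject₁ j) , inj₂ (refl , refl , cong suc (sym (Fin.toℕ-inject₁ j))) , inj₂ (inject₁ j , refl , cong suc (Fin.toℕ-inject₁ j))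

  after : ∀ s b (j : Fin depth) → ∃[ x ] (Adj (pth s b j) x × (suc (toℕ j) ≡ depth × x ≡ cen (ptr s b) ⊎ ∃[ i ] (x ≡ pth s b i × toℕ i ≡ suc (toℕ j))))
  after s b j with ℕ.m≤n⇒m<n∨m≡n (Fin.toℕ<n j)
  ... | inj₂ e  = cen (ptr s b) , inj₁ (e , refl) , inj₁ (e , refl)
  ... | inj₁ lt = pth s b (fromℕ< lt) , inj₁ (refl , refl , Fin.toℕ-fromℕ< lt) , inj₂ (fromℕ< lt , refl , Fin.toℕ-fromℕ< lt)

  many : ∀ x → (∃[ t ] (x ≡ leaf t)) ⊎ (∣ tabulate (adj F (encode x)) ∣ ≢ 1)
  many (leaf t) = inj₁ (t , refl)
  -- `B` is at least 2, so every centre, including the root, starts two different paths.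
  many (cen s) = inj₂ (two-neighbours {cen s} {pth s zero zero} {pth s (suc zero) zero} (inj₁ (refl , z≤n)) (inj₁ (refl , z≤n)) λ ())
  many (pth s b j) with prev s b j | after s b j
  ... | x , ax , x-is | y , ay , y-is = inj₂ (two-neighbours ax ay (distinct x-is y-is))
    where
    distinct : ∀ {x y} → x ≡ cen s × j ≡ zero ⊎ ∃[ i ] (x ≡ pth s b i × suc (toℕ i) ≡ toℕ j) →
               suc (toℕ j) ≡ depth × y ≡ cen (ptr s b) ⊎ ∃[ i ] (y ≡ pth s b i × toℕ i ≡ suc (toℕ j)) → x ≢ y
    distinct (inj₁ (refl , refl)) (inj₁ (() , refl))
    distinct (inj₁ (refl , _)) (inj₂ (_ , refl , _)) ()
    distinct (inj₂ (_ , refl , _)) (inj₁ (_ , refl)) ()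
    distinct (inj₂ (i , refl , e)) (inj₂ (.i , refl , f)) refl = ℕ.m≢1+m+n (toℕ i) {1} (trans f (trans (cong suc (sym e)) (cong suc (ℕ.+-comm 1 (toℕ i)))))

  leaf-degree : ∀ t → ∣ tabulate (adj F (encode (leaf t))) ∣ ≡ 1
  leaf-degree t = ⇒∣∣≡1 _ (encode (cen (target t))) (⇒∈-tabulate (edgeF {leaf t} {cen (target t)} (inj₁ refl))) (λ _ → only)
    where
    neighbour : ∀ {w x} → Adj w x → w ≡ leaf t → x ≡ cen (target t)
    neighbour {x = cen s} (inj₁ refl) refl = refl
    neighbour {x = leaf _} (inj₁ ()) refl
    neighbour {x = leaf _} (inj₂ ()) refl
    neighbour {x = cen _} (inj₂ ()) refl
    neighbour {x = pth _ _ _} (inj₁ ()) refl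
    neighbour {x = pth _ _ _} (inj₂ ()) refl
    only : ∀ {x} → x ∈ tabulate (adj F (encode (leaf t))) → x ≡ encode (cen (target t))
    only x∈ = decode-injective (trans (neighbour (edgeF⇒ (∈-tabulate⇒ x∈)) (decode-encode (leaf t))) (sym (decode-encode _)))

  leaves : ∀ x → ∣ tabulate (adj F x) ∣ ≡ 1 ⇔ (∃[ t ] (encode (leaf t) ≡ x))
  leaves x = mk⇔ to (λ { (t , refl) → leaf-degree t })
    where
    to : ∣ tabulate (adj F x) ∣ ≡ 1 → ∃[ t ] (encode (leaf t) ≡ x)
    to e with many (decode x)
    ... | inj₁ (t , eq) = t , trans (cong encode (sym eq)) (encode-decode x)
    ... | inj₂ ne = contradiction (subst (λ y → ∣ tabulate (adj F y) ∣ ≡ 1) (sym (encode-decode x)) e) ne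

  -- Treewidth of the shrub graph

  slots : ℕ
  slots = 2 + B * depth

  slot : Node → Fin slots
  slot (leaf _)    = zero
  slot (cen _)     = suc zero
  slot (pth _ b j) = suc (suc (combine b j))

  placed : ∀ x y → home x ≡ home y → slot x ≡ slot y → x ≡ y
  placed (leaf s) (leaf t) e _ = cong leaf (Fin.↑ʳ-injective h s t (Fin.suc-injective e))
  placed (cen s) (cen .s) refl _ = refl
  placed (pth s b j) (pth .s b' j') refl e = cong₂ (pth s) (combine-injectiveˡ e') (combine-injectiveʳ {i = b} {b'} e')
    where
    e' : combine b j ≡ combine b' j'
    e' = Fin.suc-injective (Fin.suc-injective e)

  ptr-up : ∀ s b → Up s (ptr s b)
  ptr-up s b with link s b in e
  ... | nothing = up-root {s}
  ... | just (t , a) with link-sound s b e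
  ...   | refl , p = target-up p

  together : ∀ x y → Half x y → ∃[ i ] (Up i (home x) × Up i (home y))
  together (leaf t)    (cen s)        refl = s , up-refl {s} , up-refl {s}
  together (cen s)     (pth s b j)    (refl , _) = s , up-refl {s} , up-refl {s}
  together (pth s b j) (pth s' b' j') (refl , _) = s , up-refl {s} , up-refl {s}
  together (pth s b j) (cen p)        (_ , refl) = s , up-refl {s} , ptr-up s b

  treewidth : TW≤ F (B * slots)
  treewidth = EliminationTree.blowUp rooted F (home ∘ decode) (slot ∘ decode)
    (λ x y p q → decode-injective (placed (decode x) (decode y) p q))
    (λ x y e → [ together (decode x) (decode y) , (λ p → let (i , u , v) = together (decode y) (decode x) p in i , v , u) ]′ (edgeF⇒ e))

-- The sum of the diameter and treewidth bounds, because a single number has to serve for both.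
bound : ℕ → ℕ
bound c = (radius + radius) + B * slots
  where
  B = suc (suc c)
  depth = suc (suc (3 * (4 * suc B)))
  radius = suc depth + (suc depth + suc depth)
  slots = 2 + B * depth

signature? : ∀ c l → Dec (1 ≤ l × l ≤ bound c × l % 4 ≡ 0)
signature? c l = (1 ℕ.≤? l) ×-dec ((l ℕ.≤? bound c) ×-dec (l % 4 ℕ.≟ 0))

signature : ℕ → Fin 1 → Fin 1 → ℕ → Bool
signature c _ _ l = does (signature? c l)

module _ {G : Graph} (𝓛 : LaconDecomposition G) {c : ℕ}
  (col : Col∞≤ (adj (LaconDecomposition.L 𝓛)) (LaconDecomposition.π 𝓛) c) where
  open LaconElim 𝓛 col
  open LaconShrub 𝓛 col

  -- `ℓ` and the counts contribute multiples of 4, the two pendant edges contribute 2, and the label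
  -- enters twice. The distance is therefore 0 modulo 4 for label "1" and 2 for label "0", which is
  -- what the signature tests.
  residue : ∀ t t' a → suc (suc (len t a + len t' a)) % 4 ≡ suc (suc (mark (label a) + mark (label a))) % 4
  residue t t' a = trans (cong (λ x → suc (suc x) % 4) regroup) (ℕ.[m+kn]%n≡m%n (suc (suc (mark (label a) + mark (label a)))) k 4)
    where
    k = (suc B + count t a) + (suc B + count t' a)
    m = mark (label a)
    part : ∀ t → len t a ≡ m + (suc B + count t a) * 4
    part t = trans (sym (ℕ.+-assoc ℓ (4 * count t a) m)) (trans (ℕ.+-comm _ m)
      (cong (m +_) (trans (sym (ℕ.*-distribˡ-+ 4 (suc B) (count t a))) (ℕ.*-comm 4 (suc B + count t a)))))
    regroup : len t a + len t' a ≡ m + m + k * 4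
    regroup = trans (cong₂ _+_ (part t) (part t')) (trans (interchange m _ m _)
      (cong (m + m +_) (sym (ℕ.*-distribʳ-+ 4 (suc B + count t a) (suc B + count t' a)))))
      where
      interchange : (a b c d : ℕ) → (a + b) + (c + d) ≡ (a + c) + (b + d)
      interchange = solve-∀

  shrub : ShrubDecomposition 1 (bound c) G (signature c)
  shrub = record
    { F = F
    ; diam = λ x y → let (l , le , w) = diameter x y in l , ℕ.≤-trans le (ℕ.m≤m+n _ _) , w
    ; ι = encode ∘ leaf
    ; ι-inj = λ e → leaf-injective (encode-injective e)
    ; leaves = leaves
    ; colour = λ _ → zero
    ; S-range = λ _ _ l e → let (p , q , _) = does⇒ (signature? c l) e in p , q
    ; S-sym = λ _ _ _ → refl
    ; edges = edgesF
    }
    where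
    leaf-injective : ∀ {s t} → leaf s ≡ leaf t → s ≡ t
    leaf-injective refl = refl
    edgesF : ∀ u v l → u ≢ v → Dist F (encode (leaf u)) (encode (leaf v)) l → E G u v ⇔ (signature c zero zero l ≡ true)
    edgesF u v l ne d with top u v
    ... | a , dom with distance ne dom d
    ...   | refl = mk⇔
            (λ e → dec-true (signature? c l) (s≤s z≤n , l≤ , trans (residue u v a) (cong (λ b → suc (suc (mark b + mark b)) % 4) (Equivalence.to (edge⇔label ne dom) e))))
            (λ s → Equivalence.from (edge⇔label ne dom) (label-true (trans (sym (residue u v a)) (proj₂ (proj₂ (does⇒ (signature? c l) s))))))
      where
      l≤ : l ≤ bound c
      l≤ with diameter (encode (leaf u)) (encode (leaf v))
      ... | k , k≤ , w = ℕ.≤-trans (ℕ.≮⇒≥ λ k<l → proj₂ d k k<l w) (ℕ.≤-trans k≤ (ℕ.m≤m+n _ _))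
      label-true : suc (suc (mark (label a) + mark (label a))) % 4 ≡ 0 → label a ≡ true
      label-true with label a
      ... | true  = λ _ → refl
      ... | false = λ ()

  shrub-treewidth : TW≤ F (bound c)
  shrub-treewidth = TW-mono {F} (ℕ.m≤n+m (B * slots) (radius + radius)) treewidth

lacon⇒shrub : ∀ 𝒢 → LaconCondition 𝒢 → ShrubCondition 𝒢
lacon⇒shrub 𝒢 (t , decomposed) = bound (t ∸ 1) , signature (t ∸ 1) , λ G g →
  let (D , col) = decomposed G g in shrub D col , shrub-treewidth D col

-- Transductions back to structurally bounded treewidth

-- Without free variables there are no atoms, so a closed formula is combined with its own negation;
-- this remains correct over the empty graph.
truth falsity : ∀ {q k} → Formula q k
truth   = neg (ex (zero ≐ zero) and neg (ex (zero ≐ zero)))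
falsity = neg truth

_or_ : ∀ {q k} → Formula q k → Formula q k → Formula q k
φ or ψ = neg (neg φ and neg ψ)

module Holds (G : Graph) (p : ℕ) (U : Fin p → V G → Bool) where
  open CopyStructure G p 1 U

  at : ∀ {k} → (Fin k → Dom) → Fin k → V G
  at ρ x = proj₁ (ρ x)

  _⊨_ : ∀ {k} → (Fin k → Dom) → Formula (p + 1) k → Set
  ρ ⊨ φ = eval φ ρ ≡ true

  ⊨? : ∀ {k} (ρ : Fin k → Dom) φ → Dec (ρ ⊨ φ)
  ⊨? ρ φ = eval φ ρ Bool.≟ true

  same : (i j : Fin 1) → does (i ≟ j) ≡ true
  same zero zero = refl

  ⊨-truth : ∀ {k} {ρ : Fin k → Dom} → ρ ⊨ truth
  ⊨-truth {ρ = ρ} with eval (ex (zero ≐ zero)) ρ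
  ... | true  = refl
  ... | false = refl

  ⊨-neg⇒ : ∀ {k φ} {ρ : Fin k → Dom} → ρ ⊨ neg φ → ¬ (ρ ⊨ φ)
  ⊨-neg⇒ e f = contradiction (trans (sym e) (cong not f)) λ ()

  ⇒⊨-neg : ∀ {k φ} {ρ : Fin k → Dom} → ¬ (ρ ⊨ φ) → ρ ⊨ neg φ
  ⇒⊨-neg {φ = φ} {ρ} f with eval φ ρ
  ... | true  = contradiction refl f
  ... | false = refl

  ⊨-falsity⇒ : ∀ {k} {ρ : Fin k → Dom} → ¬ (ρ ⊨ falsity)
  ⊨-falsity⇒ {ρ = ρ} e = ⊨-neg⇒ {φ = truth} {ρ} e (⊨-truth {ρ = ρ})

  ⊨-or⇒ : ∀ {k φ ψ} {ρ : Fin k → Dom} → ρ ⊨ (φ or ψ) → ρ ⊨ φ ⊎ ρ ⊨ ψ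
  ⊨-or⇒ {φ = φ} {ψ} {ρ} e with eval φ ρ | eval ψ ρ
  ... | true  | _    = inj₁ refl
  ... | false | true = inj₂ refl

  ⇒⊨-or : ∀ {k φ ψ} {ρ : Fin k → Dom} → ρ ⊨ φ ⊎ ρ ⊨ ψ → ρ ⊨ (φ or ψ)
  ⇒⊨-or {φ = φ} {ψ} {ρ} s with eval φ ρ | eval ψ ρ | s
  ... | true  | _     | _ = refl
  ... | false | true  | _ = refl
  ... | false | false | inj₁ ()
  ... | false | false | inj₂ ()

  ⊨-≐⇒ : ∀ {k} {x y} {ρ : Fin k → Dom} → ρ ⊨ (x ≐ y) → at ρ x ≡ at ρ y
  ⊨-≐⇒ {x = x} {y} {ρ} e = does⇒ (at ρ x ≟ at ρ y) (proj₁ (∧-true⇒ e))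

  ⇒⊨-≐ : ∀ {k} {x y} {ρ : Fin k → Dom} → at ρ x ≡ at ρ y → ρ ⊨ (x ≐ y)
  ⇒⊨-≐ {x = x} {y} {ρ} e = ⇒∧-true (dec-true (at ρ x ≟ at ρ y) e) (same (proj₂ (ρ x)) (proj₂ (ρ y)))

  ⊨-edge⇒ : ∀ {k} {x y} {ρ : Fin k → Dom} → ρ ⊨ edge x y → E G (at ρ x) (at ρ y)
  ⊨-edge⇒ e = proj₁ (∧-true⇒ e)

  ⇒⊨-edge : ∀ {k} {x y} {ρ : Fin k → Dom} → E G (at ρ x) (at ρ y) → ρ ⊨ edge x y
  ⇒⊨-edge {x = x} {y} {ρ} e = ⇒∧-true e (same (proj₂ (ρ x)) (proj₂ (ρ y)))

  ⊨-ex⇒ : ∀ {k φ} {ρ : Fin k → Dom} → ρ ⊨ ex φ → ∃[ d ] (extend d ρ ⊨ φ)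
  ⊨-ex⇒ {φ = φ} = ex⇒ G p 1 U {φ = φ}

  ⇒⊨-ex : ∀ {k φ} {ρ : Fin k → Dom} d → extend d ρ ⊨ φ → ρ ⊨ ex φ
  ⇒⊨-ex {φ = φ} = ⇒ex G p 1 U {φ = φ}

-- Formulas for walks, distances and degree one

walkFormula : ∀ {q k} → ℕ → Fin k → Fin k → Formula q k
walkFormula zero    x y = x ≐ y
walkFormula (suc l) x y = ex (edge (suc x) zero and walkFormula l zero (suc y))

noShorterWalk : ∀ {q k} → ℕ → Fin k → Fin k → Formula q k
noShorterWalk zero    x y = truth
noShorterWalk (suc l) x y = neg (walkFormula l x y) and noShorterWalk l x y

distanceIn : ∀ {q k} → (ℕ → Bool) → ℕ → Fin k → Fin k → Formula q k
distanceIn S zero    x y = falsity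
distanceIn S (suc l) x y =
  (if S l then walkFormula l x y and noShorterWalk l x y else falsity) or distanceIn S l x y

degreeOne : ∀ {q k} → Fin k → Formula q k
degreeOne x = ex (edge (suc x) zero and neg (ex (edge (suc (suc x)) zero and neg (zero ≐ suc zero))))

module _ (G : Graph) (p : ℕ) (U : Fin p → V G → Bool) where
  open CopyStructure G p 1 U using (Dom)
  open Holds G p U

  ⊨-walk⇒ : ∀ l {k} {x y : Fin k} {ρ : Fin k → Dom} → ρ ⊨ walkFormula l x y → Walk (adj G) Anywhere (at ρ x) (at ρ y) l
  ⊨-walk⇒ zero {x = x} {y} {ρ} e = subst (λ z → Walk (adj G) Anywhere (at ρ x) z 0) (⊨-≐⇒ {x = x} {y} {ρ} e) (stay tt)
  ⊨-walk⇒ (suc l) {x = x} {y} {ρ} e with ⊨-ex⇒ {φ = edge (suc x) zero and walkFormula l zero (suc y)} {ρ} e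
  ... | d , h = step tt (⊨-edge⇒ {x = suc x} {zero} {extend d ρ} (proj₁ (∧-true⇒ h))) (⊨-walk⇒ l (proj₂ (∧-true⇒ h)))

  ⇒⊨-walk : ∀ l {k} {x y : Fin k} {ρ : Fin k → Dom} → Walk (adj G) Anywhere (at ρ x) (at ρ y) l → ρ ⊨ walkFormula l x y
  ⇒⊨-walk zero {x = x} {y} {ρ} w = ⇒⊨-≐ {x = x} {y} {ρ} (trivial w)
    where
    trivial : ∀ {a b} → Walk (adj G) Anywhere a b 0 → a ≡ b
    trivial (stay _) = refl
  ⇒⊨-walk (suc l) {x = x} {y} {ρ} (step {y = z} _ e w) = ⇒⊨-ex {φ = edge (suc x) zero and walkFormula l zero (suc y)} {ρ} (z , zero)
    (⇒∧-true (⇒⊨-edge {x = suc x} {zero} {extend (z , zero) ρ} e) (⇒⊨-walk l w))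

  ⊨-noShorter⇒ : ∀ l {k} {x y : Fin k} {ρ : Fin k → Dom} → ρ ⊨ noShorterWalk l x y →
                  ∀ l' → l' < l → ¬ Walk (adj G) Anywhere (at ρ x) (at ρ y) l'
  ⊨-noShorter⇒ (suc l) {x = x} {y} {ρ} e l' (s≤s le) w with ℕ.m≤n⇒m<n∨m≡n le
  ... | inj₁ lt   = ⊨-noShorter⇒ l (proj₂ (∧-true⇒ e)) l' lt w
  ... | inj₂ refl = ⊨-neg⇒ {φ = walkFormula l x y} {ρ} (proj₁ (∧-true⇒ e)) (⇒⊨-walk l w)

  ⇒⊨-noShorter : ∀ l {k} {x y : Fin k} {ρ : Fin k → Dom} → (∀ l' → l' < l → ¬ Walk (adj G) Anywhere (at ρ x) (at ρ y) l') →
                  ρ ⊨ noShorterWalk l x y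
  ⇒⊨-noShorter zero {ρ = ρ} _ = ⊨-truth {ρ = ρ}
  ⇒⊨-noShorter (suc l) {x = x} {y} {ρ} f = ⇒∧-true (⇒⊨-neg {φ = walkFormula l x y} {ρ} (λ w → f l ℕ.≤-refl (⊨-walk⇒ l w)))
    (⇒⊨-noShorter l (λ l' lt → f l' (ℕ.m≤n⇒m≤1+n lt)))

  private
    exactly : ∀ {k} → (ℕ → Bool) → ℕ → Fin k → Fin k → Formula (p + 1) k
    exactly S l x y = if S l then walkFormula l x y and noShorterWalk l x y else falsity

  ⊨-distance⇒ : ∀ S l {k} {x y : Fin k} {ρ : Fin k → Dom} → ρ ⊨ distanceIn S l x y →
                 ∃[ l' ] (S l' ≡ true × Dist G (at ρ x) (at ρ y) l')
  ⊨-distance⇒ S zero {ρ = ρ} e = contradiction e (⊨-falsity⇒ {ρ = ρ})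
  ⊨-distance⇒ S (suc l) {x = x} {y} {ρ} e with ⊨-or⇒ {φ = exactly S l x y} {distanceIn S l x y} {ρ} e
  ... | inj₂ f = ⊨-distance⇒ S l f
  ... | inj₁ f with S l in s
  ...   | true  = l , s , ⊨-walk⇒ l (proj₁ (∧-true⇒ f)) , ⊨-noShorter⇒ l (proj₂ (∧-true⇒ f))
  ...   | false = contradiction f (⊨-falsity⇒ {ρ = ρ})

  ⇒⊨-distance : ∀ S l {k} {x y : Fin k} {ρ : Fin k → Dom} {l'} → l' < l → S l' ≡ true → Dist G (at ρ x) (at ρ y) l' →
                 ρ ⊨ distanceIn S l x y
  ⇒⊨-distance S (suc l) {x = x} {y} {ρ} (s≤s le) s d with ℕ.m≤n⇒m<n∨m≡n le
  ... | inj₁ lt = ⇒⊨-or {φ = exactly S l x y} {distanceIn S l x y} {ρ} (inj₂ (⇒⊨-distance S l lt s d))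
  ... | inj₂ refl = ⇒⊨-or {φ = exactly S l x y} {distanceIn S l x y} {ρ} (inj₁ here-l)
    where
    here-l : ρ ⊨ exactly S l x y
    here-l rewrite s = ⇒∧-true (⇒⊨-walk l (proj₁ d)) (⇒⊨-noShorter l (proj₂ d))

  ⊨-degreeOne⇒ : ∀ {k} {x : Fin k} {ρ : Fin k → Dom} → ρ ⊨ degreeOne x → ∣ tabulate (adj G (at ρ x)) ∣ ≡ 1
  ⊨-degreeOne⇒ {x = x} {ρ} e with ⊨-ex⇒ {φ = edge (suc x) zero and neg (ex (edge (suc (suc x)) zero and neg (zero ≐ suc zero)))} {ρ} e
  ... | d , h = ⇒∣∣≡1 _ (proj₁ d) (⇒∈-tabulate (⊨-edge⇒ {x = suc x} {zero} {extend d ρ} (proj₁ (∧-true⇒ h)))) only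
    where
    only : ∀ y → y ∈ tabulate (adj G (at ρ x)) → y ≡ proj₁ d
    only y y∈ with y ≟ proj₁ d
    ... | yes eq = eq
    ... | no ne = contradiction (⇒⊨-ex {φ = edge (suc (suc x)) zero and neg (zero ≐ suc zero)} {extend d ρ} (y , zero)
          (⇒∧-true (⇒⊨-edge {x = suc (suc x)} {zero} {extend (y , zero) (extend d ρ)} (∈-tabulate⇒ y∈))
                   (⇒⊨-neg {φ = zero ≐ suc zero} {extend (y , zero) (extend d ρ)} (ne ∘ ⊨-≐⇒ {x = zero} {suc zero} {extend (y , zero) (extend d ρ)}))))
          (⊨-neg⇒ {φ = ex (edge (suc (suc x)) zero and neg (zero ≐ suc zero))} {extend d ρ} (proj₂ (∧-true⇒ h)))

  ⇒⊨-degreeOne : ∀ {k} {x : Fin k} {ρ : Fin k → Dom} → ∣ tabulate (adj G (at ρ x)) ∣ ≡ 1 → ρ ⊨ degreeOne x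
  ⇒⊨-degreeOne {x = x} {ρ} e with ∣∣≡1⇒ _ e
  ... | y , y∈ , only = ⇒⊨-ex {φ = edge (suc x) zero and neg (ex (edge (suc (suc x)) zero and neg (zero ≐ suc zero)))} {ρ} (y , zero)
    (⇒∧-true (⇒⊨-edge {x = suc x} {zero} {extend (y , zero) ρ} (∈-tabulate⇒ y∈))
      (⇒⊨-neg {φ = ex (edge (suc (suc x)) zero and neg (zero ≐ suc zero))} {extend (y , zero) ρ} λ h → absurd (⊨-ex⇒ {φ = edge (suc (suc x)) zero and neg (zero ≐ suc zero)} {extend (y , zero) ρ} h)))
    where
    absurd : ¬ (∃[ d ] (extend d (extend (y , zero) ρ) ⊨ (edge (suc (suc x)) zero and neg (zero ≐ suc zero))))
    absurd (d , h) = ⊨-neg⇒ {φ = zero ≐ suc zero} {extend d (extend (y , zero) ρ)} (proj₂ (∧-true⇒ h))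
      (⇒⊨-≐ {x = zero} {suc zero} {extend d (extend (y , zero) ρ)}
        (only (proj₁ d) (⇒∈-tabulate (⊨-edge⇒ {x = suc (suc x)} {zero} {extend d (extend (y , zero) ρ)} (proj₁ (∧-true⇒ h))))))

  shortest : ∀ n {x y l} → l < n → Walk (adj G) Anywhere x y l → ∃[ l' ] (l' ≤ l × Dist G x y l')
  shortest (suc n) {x} {y} {l} (s≤s l≤n) w with any? {n = l} (λ i → walk? (toℕ i))
    where
    ρ : Fin 2 → Dom
    ρ zero       = x , zero
    ρ (suc zero) = y , zero
    -- Evaluating the formula in `G` decides the existence of a walk of given length.
    walk? : ∀ l → Dec (Walk (adj G) Anywhere x y l)
    walk? l = map′ (⊨-walk⇒ l {x = zero} {suc zero} {ρ}) (⇒⊨-walk l {x = zero} {suc zero} {ρ}) (⊨? ρ (walkFormula l zero (suc zero)))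
  ... | yes (i , w') = let (l' , le , d) = shortest n (ℕ.<-≤-trans (Fin.toℕ<n i) l≤n) w' in
                       l' , ℕ.≤-trans le (ℕ.<⇒≤ (Fin.toℕ<n i)) , d
  ... | no none = l , ℕ.≤-refl , w , λ l' lt w' →
        none (fromℕ< lt , subst (Walk (adj G) Anywhere x y) (sym (Fin.toℕ-fromℕ< lt)) w')

∨-left : ∀ {a b} → a ≡ true → a ∨ b ≡ true
∨-left refl = refl

∨-true⇒ : ∀ {a b} → a ∨ b ≡ true → a ≡ true ⊎ b ≡ true
∨-true⇒ {true}  _ = inj₁ refl
∨-true⇒ {false} e = inj₂ e

shrub⇒structural : ∀ 𝒢 → ShrubCondition 𝒢 → StructurallyBoundedTreewidth 𝒢
shrub⇒structural 𝒢 (t , S , decomposed) =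
  (λ F → TW≤ F t) , (t , λ _ tw → tw) , τ , λ G g → let (D , tw) = decomposed G g in ShrubDecomposition.F D , tw , inside G D
  where
  S₀ : ℕ → Bool
  S₀ = S zero zero
  τ : Transduction
  τ = record { p = 0 ; m = 1 ; χ = truth ; ν = degreeOne zero ; φ = distanceIn S₀ (suc t) zero (suc zero) }
  inside : ∀ G (D : ShrubDecomposition 1 t G S) → G ∈τ (τ , ShrubDecomposition.F D)
  inside G D = U , Holds.⊨-truth F 0 U {ρ = cnoVars {F} {1}} , (λ u → ι u , zero) , (λ e → ι-inj (cong proj₁ e))
    , (λ u → ⇒⊨-degreeOne F 0 U {1} {zero} {λ _ → ι u , zero} (Equivalence.from (leaves (ι u)) (u , refl)))
    , (λ { (x , zero) e → let (u , eq) = Equivalence.to (leaves x) (⊨-degreeOne⇒ F 0 U {1} {zero} {λ _ → x , zero} e) in u , cong (_, zero) eq })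
    , λ u v ne → mk⇔
        (λ e → let (l , lt , s , d) = to u v ne e in ∨-left (⇒⊨-distance F 0 U S₀ (suc t) {x = zero} {suc zero} lt s d))
        (λ h → [ (λ h → from u v ne (⊨-distance⇒ F 0 U S₀ (suc t) {x = zero} {suc zero} h))
               , (λ h → trans (Graph.sym G u v) (from v u (ne ∘ sym) (⊨-distance⇒ F 0 U S₀ (suc t) {x = zero} {suc zero} h))) ]′ (∨-true⇒ h))
    where
    open ShrubDecomposition D
    U : Fin 0 → V F → Bool
    U ()
    one : ∀ u v l → S (colour u) (colour v) l ≡ S₀ l
    one u v l with colour u | colour v
    ... | zero | zero = refl
    to : ∀ u v → u ≢ v → E G u v → ∃[ l ] (l < suc t × S₀ l ≡ true × Dist F (ι u) (ι v) l)
    to u v ne e with diam (ι u) (ι v)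
    ... | l , l≤t , w with shortest F 0 U _ ℕ.≤-refl w
    ...   | l' , l'≤l , d = l' , s≤s (ℕ.≤-trans l'≤l l≤t) , trans (sym (one u v l')) (Equivalence.to (edges u v l' ne d) e) , d
    from : ∀ u v → u ≢ v → ∃[ l ] (S₀ l ≡ true × Dist F (ι u) (ι v) l) → E G u v
    from u v ne (l , s , d) = Equivalence.from (edges u v l ne d) (trans (one u v l) s)

-- Parities, and a formula for odd common neighbourhoods

parity : ℕ → Bool
parity zero    = false
parity (suc n) = not (parity n)

parity⇒odd : ∀ n → parity n ≡ true → n % 2 ≡ 1
parity⇒odd (suc zero)    _ = refl
parity⇒odd (suc (suc n)) e = parity⇒odd n (trans (sym (Bool.not-involutive (parity n))) e)

odd⇒parity : ∀ n → n % 2 ≡ 1 → parity n ≡ true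
odd⇒parity (suc zero)    _ = refl
odd⇒parity (suc (suc n)) e = trans (Bool.not-involutive (parity n)) (odd⇒parity n e)

remove : ∀ {n} → Subset n → Fin n → Subset n
remove (s ∷ S) zero    = false ∷ S
remove (s ∷ S) (suc x) = s ∷ remove S x

∣remove∣ : ∀ {n} (S : Subset n) {x} → x ∈ S → ∣ S ∣ ≡ suc ∣ remove S x ∣
∣remove∣ (true  ∷ S) {zero}  here      = refl
∣remove∣ (true  ∷ S) {suc x} (there p) = cong suc (∣remove∣ S p)
∣remove∣ (false ∷ S) {suc x} (there p) = ∣remove∣ S p

∈-remove⇒ : ∀ {n} (S : Subset n) {x y} → y ∈ remove S x → y ∈ S × y ≢ x
∈-remove⇒ (s ∷ S) {zero}  {suc y} (there p) = there p , λ ()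
∈-remove⇒ (s ∷ S) {suc x} {zero}  here      = here , λ ()
∈-remove⇒ (s ∷ S) {suc x} {suc y} (there p) = let (q , ne) = ∈-remove⇒ S p in there q , ne ∘ Fin.suc-injective

⇒∈-remove : ∀ {n} (S : Subset n) {x y} → y ∈ S → y ≢ x → y ∈ remove S x
⇒∈-remove (s ∷ S) {zero}  {zero}  p         ne = contradiction refl ne
⇒∈-remove (s ∷ S) {zero}  {suc y} (there p) ne = there p
⇒∈-remove (s ∷ S) {suc x} {zero}  here      ne = here
⇒∈-remove (s ∷ S) {suc x} {suc y} (there p) ne = there (⇒∈-remove S p (ne ∘ cong suc))

pad : ∀ {h} n → Subset h → Subset (h + n)
pad n S = S Vec.++ Vec.replicate n false

∣pad∣ : ∀ {h} n (S : Subset h) → ∣ pad n S ∣ ≡ ∣ S ∣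
∣pad∣ zero    []          = refl
∣pad∣ (suc n) []          = ∣pad∣ n []
∣pad∣ n       (true  ∷ S) = cong suc (∣pad∣ n S)
∣pad∣ n       (false ∷ S) = ∣pad∣ n S

∈-pad⇒ : ∀ {h n} (S : Subset h) {x} → x ∈ pad n S → ∃[ a ] (a ↑ˡ n ≡ x × a ∈ S)
∈-pad⇒ {n = suc n} [] {suc x} (there p) with ∈-pad⇒ [] p
... | () , _
∈-pad⇒ (true ∷ S) {zero} here = zero , refl , here
∈-pad⇒ (s ∷ S) {suc x} (there p) = let (a , e , q) = ∈-pad⇒ S p in suc a , cong suc e , there q

⇒∈-pad : ∀ {h n} (S : Subset h) {a} → a ∈ S → a ↑ˡ n ∈ pad n S
⇒∈-pad (s ∷ S) here      = here
⇒∈-pad (s ∷ S) (there p) = there (⇒∈-pad S p)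

-- An odd number of common neighbours lies outside of es iff removing some such neighbour leaves
-- an even number; the formula is correct as long as that number is at most the first argument.
fresh : ∀ {q k} → List (Fin k) → Formula q (suc k)
fresh List.[]       = truth
fresh (e List.∷ es) = neg (zero ≐ suc e) and fresh es

oddlyMany : ∀ {q k} → ℕ → Fin k → Fin k → List (Fin k) → Formula q k
oddlyMany zero    x y es = falsity
oddlyMany (suc f) x y es = ex ((edge (suc x) zero and edge (suc y) zero) and
  (fresh es and neg (oddlyMany f (suc x) (suc y) (zero List.∷ List.map suc es))))

module _ (G : Graph) (p : ℕ) (U : Fin p → V G → Bool) where
  open CopyStructure G p 1 U using (Dom; eval)
  open Holds G p U

  Outside : ∀ {k} → (Fin k → Dom) → List (Fin k) → V G → Set
  Outside ρ es z = ∀ e → e ∈ˡ es → z ≢ at ρ e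

  ⊨-fresh⇒ : ∀ {k} {ρ : Fin k → Dom} {d} es → extend d ρ ⊨ fresh es → Outside ρ es (proj₁ d)
  ⊨-fresh⇒ {ρ = ρ} {d} (e List.∷ es) h .e (here refl) eq =
    ⊨-neg⇒ {φ = zero ≐ suc e} {extend d ρ} (proj₁ (∧-true⇒ h)) (⇒⊨-≐ {x = zero} {suc e} {extend d ρ} eq)
  ⊨-fresh⇒ (e List.∷ es) h e' (there e'∈) = ⊨-fresh⇒ es (proj₂ (∧-true⇒ h)) e' e'∈

  ⇒⊨-fresh : ∀ {k} {ρ : Fin k → Dom} {d} es → Outside ρ es (proj₁ d) → extend d ρ ⊨ fresh es
  ⇒⊨-fresh {ρ = ρ} {d} List.[] _ = ⊨-truth {ρ = extend d ρ}
  ⇒⊨-fresh {ρ = ρ} {d} (e List.∷ es) out = ⇒∧-true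
    (⇒⊨-neg {φ = zero ≐ suc e} {extend d ρ} (out e (here refl) ∘ ⊨-≐⇒ {x = zero} {suc e} {extend d ρ}))
    (⇒⊨-fresh es (λ e' e'∈ → out e' (there e'∈)))

  Remaining : ∀ {k} → (Fin k → Dom) → Fin k → Fin k → List (Fin k) → V G → Set
  Remaining ρ x y es z = E G (at ρ x) z × E G (at ρ y) z × Outside ρ es z

  -- `S` collects the common neighbours not yet set aside in `es`. Whichever of them the quantifier
  -- picks, its removal flips the parity, so the outcome does not depend on the choice; if none is
  -- left, the formula is false and the count even.
  eval-oddlyMany : ∀ f {k} {ρ : Fin k → Dom} {x y} es (S : Subset (size G)) →
    (∀ z → z ∈ S → Remaining ρ x y es z) → (∀ z → Remaining ρ x y es z → z ∈ S) → ∣ S ∣ ≤ f →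
    eval (oddlyMany f x y es) ρ ≡ parity ∣ S ∣
  eval-oddlyMany zero {ρ = ρ} es S _ _ le with ∣ S ∣ | le
  ... | zero | z≤n = bool-ext (λ e → contradiction e (⊨-falsity⇒ {ρ = ρ})) λ ()
  eval-oddlyMany (suc f) {k} {ρ} {x} {y} es S sound complete le = bool-ext to from
    where
    rest = oddlyMany f (suc x) (suc y) (zero List.∷ List.map suc es)
    body = (edge (suc x) zero and edge (suc y) zero) and (fresh es and neg rest)

    outside-suc : ∀ {d z} → Outside (extend d ρ) (zero List.∷ List.map suc es) z → z ≢ proj₁ d × Outside ρ es z
    outside-suc out = out zero (here refl) , λ e e∈ → out (suc e) (there (∈-map⁺ suc e∈))

    suc-outside : ∀ {d z} → z ≢ proj₁ d → Outside ρ es z → Outside (extend d ρ) (zero List.∷ List.map suc es) z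
    suc-outside ne out .zero (here refl) = ne
    suc-outside ne out e (there e∈) with ∈-map⁻ suc e∈
    ... | e' , e'∈ , refl = out e' e'∈

    eval-rest : ∀ d → proj₁ d ∈ S → eval rest (extend d ρ) ≡ parity ∣ remove S (proj₁ d) ∣
    eval-rest d d∈ = eval-oddlyMany f (zero List.∷ List.map suc es) (remove S (proj₁ d))
      (λ z z∈ → let (z∈S , ne) = ∈-remove⇒ S z∈ ; (e , e' , out) = sound z z∈S in e , e' , suc-outside {d} ne out)
      (λ z (e , e' , out) → let (ne , out') = outside-suc {d} out in ⇒∈-remove S (complete z (e , e' , out')) ne)
      (ℕ.s≤s⁻¹ (ℕ.≤-trans (ℕ.≤-reflexive (sym (∣remove∣ S d∈))) le))

    parity-S : ∀ z → z ∈ S → parity ∣ S ∣ ≡ not (parity ∣ remove S z ∣)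
    parity-S z z∈ = cong parity (∣remove∣ S z∈)

    to : eval (oddlyMany (suc f) x y es) ρ ≡ true → parity ∣ S ∣ ≡ true
    to e with ⊨-ex⇒ {φ = body} {ρ} e
    ... | d , h with ∧-true⇒ h
    ...   | adjacent , h' = trans (parity-S (proj₁ d) d∈) (trans (cong not (sym (eval-rest d d∈))) (proj₂ (∧-true⇒ h')))
      where
      d∈ : proj₁ d ∈ S
      d∈ = complete (proj₁ d) (⊨-edge⇒ {x = suc x} {zero} {extend d ρ} (proj₁ (∧-true⇒ {eval (edge (suc x) zero) (extend d ρ)} adjacent)) ,
             ⊨-edge⇒ {x = suc y} {zero} {extend d ρ} (proj₂ (∧-true⇒ {eval (edge (suc x) zero) (extend d ρ)} adjacent)) , ⊨-fresh⇒ es (proj₁ (∧-true⇒ h')))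

    from : parity ∣ S ∣ ≡ true → eval (oddlyMany (suc f) x y es) ρ ≡ true
    from e with any? (λ z → Subset._∈?_ z S)
    ... | no none = contradiction (trans (sym e) (cong parity empty)) λ ()
      where
      empty : ∣ S ∣ ≡ 0
      empty = ℕ.n≤0⇒n≡0 (ℕ.≮⇒≥ λ lt → none (nth S (fromℕ< lt) , nth-∈ S _))
    ... | yes (z , z∈) with sound z z∈
    ...   | e₁ , e₂ , out = ⇒⊨-ex {φ = body} {ρ} (z , zero)
      (⇒∧-true (⇒∧-true (⇒⊨-edge {x = suc x} {zero} {extend (z , zero) ρ} e₁) (⇒⊨-edge {x = suc y} {zero} {extend (z , zero) ρ} e₂))
        (⇒∧-true (⇒⊨-fresh es out) (trans (cong not (eval-rest (z , zero) z∈)) (trans (sym (parity-S z z∈)) e))))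

parity⇒structural : ∀ 𝒢 → ParityCondition 𝒢 → StructurallyBoundedTreewidth 𝒢
parity⇒structural 𝒢 (d , 𝒢' , bounded , decomposed) =
  𝒢' , bounded , τ , λ G g → let (D , P∈) = decomposed G g in ParityDecomposition.P D , P∈ , inside G D
  where
  τ : Transduction
  τ = record { p = 1 ; m = 1 ; χ = truth ; ν = unary zero zero ; φ = oddlyMany d zero (suc zero) List.[] }
  inside : ∀ G (D : ParityDecomposition d G) → G ∈τ (τ , ParityDecomposition.P D)
  inside G D = U , Holds.⊨-truth P 1 U {ρ = cnoVars {P} {1}} , (λ t → h ↑ʳ t , zero)
    , (λ e → Fin.↑ʳ-injective h _ _ (cong proj₁ e)) , U-target
    , (λ { (x , zero) e → let (t , eq) = target-of x e in t , cong (_, zero) eq })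
    , λ u v ne → mk⇔
        (λ e → ∨-left (trans (value u v refl refl) (odd⇒parity ∣ S u v ∣ (Equivalence.to (parity-edge u v ne) e))))
        (λ e → [ (λ e → Equivalence.from (parity-edge u v ne) (parity⇒odd ∣ S u v ∣ (trans (sym (value u v refl refl)) e)))
               , (λ e → trans (Graph.sym G u v) (Equivalence.from (parity-edge v u (ne ∘ sym)) (parity⇒odd ∣ S v u ∣ (trans (sym (value v u refl refl)) e)))) ]′
               (∨-true⇒ e))
    where
    open ParityDecomposition D renaming (parity to parity-edge)
    open CopyStructure P 1 1 using (eval)
    n = size G
    isTarget : V P → Bool
    isTarget x = [ (λ _ → false) , (λ _ → true) ]′ (splitAt h x)
    U : Fin 1 → V P → Bool
    U _ = isTarget
    U-target : ∀ t → isTarget (h ↑ʳ t) ≡ true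
    U-target t = cong [ (λ _ → false) , (λ _ → true) ]′ (Fin.splitAt-↑ʳ h n t)
    target-of : ∀ x → isTarget x ≡ true → ∃[ t ] (h ↑ʳ t ≡ x)
    target-of x e with side h x
    ... | inj₂ t = t
    ... | inj₁ (a , refl) = contradiction (trans (sym e) (cong [ (λ _ → false) , (λ _ → true) ]′ (Fin.splitAt-↑ˡ h a n))) λ ()
    S : V G → V G → Subset h
    S u v = tabulate (N u) ∩ tabulate (N v)
    value : ∀ u v {ρ : Fin 2 → V P × Fin 1} → proj₁ (ρ zero) ≡ h ↑ʳ u → proj₁ (ρ (suc zero)) ≡ h ↑ʳ v →
            eval U (oddlyMany d zero (suc zero) List.[]) ρ ≡ parity ∣ S u v ∣
    value u v {ρ} e₁ e₂ = trans (eval-oddlyMany P 1 U d {ρ = ρ} {zero} {suc zero} List.[] (pad n (S u v)) sound complete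
                (ℕ.≤-trans (ℕ.≤-reflexive (∣pad∣ n (S u v))) (ℕ.≤-trans (Subset.∣p∩q∣≤∣p∣ (tabulate (N u)) (tabulate (N v))) (degree u))))
              (cong parity (∣pad∣ n (S u v)))
      where
      sound : ∀ z → z ∈ pad n (S u v) → Remaining P 1 U ρ zero (suc zero) List.[] z
      sound z z∈ with ∈-pad⇒ (S u v) z∈
      ... | a , refl , a∈ with Subset.x∈p∩q⁻ (tabulate (N u)) (tabulate (N v)) a∈
      ...   | p , q = subst (λ x → E P x (a ↑ˡ n)) (sym e₁) (bip-edge N (∈-tabulate⇒ p))
                    , subst (λ x → E P x (a ↑ˡ n)) (sym e₂) (bip-edge N (∈-tabulate⇒ q)) , λ _ ()
      complete : ∀ z → Remaining P 1 U ρ zero (suc zero) List.[] z → z ∈ pad n (S u v)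
      complete z (p , q , _) with bip-target N (subst (λ x → E P x z) e₁ p)
      ... | a , refl , ua = ⇒∈-pad (S u v) (Subset.x∈p∩q⁺ (⇒∈-tabulate ua , ⇒∈-tabulate (bip-edge⇒ N (subst (λ x → E P x (a ↑ˡ n)) e₂ q))))

-- Sums modulo 2

xorSum : ∀ n → (Fin n → Bool) → Bool
xorSum zero    f = false
xorSum (suc n) f = f zero xor xorSum n (f ∘ suc)

xorSum-cong : ∀ n {f g : Fin n → Bool} → (∀ i → f i ≡ g i) → xorSum n f ≡ xorSum n g
xorSum-cong zero    e = refl
xorSum-cong (suc n) e = cong₂ _xor_ (e zero) (xorSum-cong n (e ∘ suc))

xorSum-false : ∀ n {f : Fin n → Bool} → (∀ i → f i ≡ false) → xorSum n f ≡ false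
xorSum-false zero    e = refl
xorSum-false (suc n) e = cong₂ _xor_ (e zero) (xorSum-false n (e ∘ suc))

xorSum-single : ∀ n {f : Fin n → Bool} i → f i ≡ true → (∀ j → j ≢ i → f j ≡ false) → xorSum n f ≡ true
xorSum-single (suc n) zero    e others = cong₂ _xor_ e (xorSum-false n (λ j → others (suc j) λ ()))
xorSum-single (suc n) (suc i) e others =
  cong₂ _xor_ (others zero λ ()) (xorSum-single n i e (λ j ne → others (suc j) (ne ∘ Fin.suc-injective)))

xorSum-+ : ∀ m n (f : Fin (m + n) → Bool) → xorSum (m + n) f ≡ xorSum m (f ∘ (_↑ˡ n)) xor xorSum n (f ∘ (m ↑ʳ_))
xorSum-+ zero    n f = refl
xorSum-+ (suc m) n f = trans (cong (f zero xor_) (xorSum-+ m n (f ∘ suc))) (sym (Bool.xor-assoc (f zero) _ _))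

xorSum-* : ∀ m n (f : Fin (m * n) → Bool) → xorSum (m * n) f ≡ xorSum m (λ i → xorSum n (λ j → f (combine i j)))
xorSum-* zero    n f = refl
xorSum-* (suc m) n f = trans (xorSum-+ n (m * n) f) (cong (xorSum n (f ∘ (_↑ˡ (m * n))) xor_) (xorSum-* m n (f ∘ (n ↑ʳ_))))

parity-∩ : ∀ n (f g : Fin n → Bool) → parity ∣ tabulate f ∩ tabulate g ∣ ≡ xorSum n (λ i → f i ∧ g i)
parity-∩ zero    f g = refl
parity-∩ (suc n) f g with f zero ∧ g zero
... | true  = cong not (parity-∩ n (f ∘ suc) (g ∘ suc))
... | false = parity-∩ n (f ∘ suc) (g ∘ suc)

xorSets : ∀ n → (Subset n → Bool) → Bool
xorSets zero    f = f []
xorSets (suc n) f = xorSets n (f ∘ (false ∷_)) xor xorSets n (f ∘ (true ∷_))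

xorSets-cong : ∀ n {f g : Subset n → Bool} → (∀ S → f S ≡ g S) → xorSets n f ≡ xorSets n g
xorSets-cong zero    e = e []
xorSets-cong (suc n) e = cong₂ _xor_ (xorSets-cong n (e ∘ (false ∷_))) (xorSets-cong n (e ∘ (true ∷_)))

xorSets-false : ∀ n → xorSets n (λ _ → false) ≡ false
xorSets-false zero    = refl
xorSets-false (suc n) = cong₂ _xor_ (xorSets-false n) (xorSets-false n)

xor-interchange : ∀ a b c d → (a xor b) xor (c xor d) ≡ (a xor c) xor (b xor d)
xor-interchange false false c     d = refl
xor-interchange false true  false d = refl
xor-interchange false true  true  d = refl
xor-interchange true  false false d = refl
xor-interchange true  false true  d = Bool.not-involutive d
xor-interchange true  true  false d = sym (Bool.not-involutive d)
xor-interchange true  true  true  d = refl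

xorSets-xor : ∀ n (f g : Subset n → Bool) → xorSets n (λ S → f S xor g S) ≡ xorSets n f xor xorSets n g
xorSets-xor zero    f g = refl
xorSets-xor (suc n) f g = trans
  (cong₂ _xor_ (xorSets-xor n (f ∘ (false ∷_)) (g ∘ (false ∷_))) (xorSets-xor n (f ∘ (true ∷_)) (g ∘ (true ∷_))))
  (xor-interchange (xorSets n (f ∘ (false ∷_))) _ _ _)

xorSets-pair : ∀ n (b : Fin n) (f : Subset n → Bool) →
  xorSets n f ≡ xorSets n (λ S → if lookup S b then false else f S xor f (S Vec.[ b ]≔ true))
xorSets-pair (suc n) zero f = sym (trans
  (cong₂ _xor_ (xorSets-xor n (f ∘ (false ∷_)) (f ∘ (true ∷_))) (xorSets-false n)) (Bool.xor-identityʳ _))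
xorSets-pair (suc n) (suc b) f = cong₂ _xor_ (xorSets-pair n b (f ∘ (false ∷_))) (xorSets-pair n b (f ∘ (true ∷_)))

isEmpty : ∀ {n} → Subset n → Bool
isEmpty []          = true
isEmpty (true  ∷ S) = false
isEmpty (false ∷ S) = isEmpty S

isEmpty⇒ : ∀ {n} (S : Subset n) → isEmpty S ≡ true → ∀ b → lookup S b ≡ false
isEmpty⇒ (false ∷ S) e zero    = refl
isEmpty⇒ (false ∷ S) e (suc b) = isEmpty⇒ S e b

nonempty⇒ : ∀ {n} (S : Subset n) → isEmpty S ≡ false → ∃[ b ] (lookup S b ≡ true)
nonempty⇒ (true  ∷ S) e = zero , refl
nonempty⇒ (false ∷ S) e = let (b , p) = nonempty⇒ S e in suc b , p

xorSets-isEmpty : ∀ n l → xorSets n (λ S → isEmpty S ∧ l) ≡ l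
xorSets-isEmpty zero    l = refl
xorSets-isEmpty (suc n) l = trans (cong₂ _xor_ (xorSets-isEmpty n l) (xorSets-false n)) (Bool.xor-identityʳ l)

nthSubset : ∀ n → Fin (2 ^ n) → Subset n
nthSubset zero    _ = []
nthSubset (suc n) i = does (proj₁ (remQuot {2} (2 ^ n) i) ≟ suc zero) ∷ nthSubset n (proj₂ (remQuot {2} (2 ^ n) i))

xorSum-nthSubset : ∀ n (f : Subset n → Bool) → xorSum (2 ^ n) (f ∘ nthSubset n) ≡ xorSets n f
xorSum-nthSubset zero    f = Bool.xor-identityʳ (f [])
xorSum-nthSubset (suc n) f = trans (xorSum-* 2 (2 ^ n) (f ∘ nthSubset (suc n)))
  (cong₂ _xor_ (half zero) (trans (Bool.xor-identityʳ _) (half (suc zero))))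
  where
  half : ∀ q → xorSum (2 ^ n) (λ j → f (nthSubset (suc n) (combine q j))) ≡ xorSets n (f ∘ (does (q ≟ suc zero) ∷_))
  half q = trans (xorSum-cong (2 ^ n) (λ j → cong (λ p → f (does (proj₁ p ≟ suc zero) ∷ nthSubset n (proj₂ p))) (Fin.remQuot-combine q j)))
                 (xorSum-nthSubset n (f ∘ (does (q ≟ suc zero) ∷_)))

abstract
  subsets : ℕ → ℕ
  subsets n = 2 ^ n

  subsetAt : ∀ n → Fin (subsets n) → Subset n
  subsetAt = nthSubset

  xorSum-subsets : ∀ n (f : Subset n → Bool) → xorSum (subsets n) (f ∘ subsetAt n) ≡ xorSets n f
  xorSum-subsets = xorSum-nthSubset

-- Parity-decompositions from lacon-decompositions

module LeastLabels {h B : ℕ} (nm : Fin h → Fin B) (π : Fin h → ℕ) (π-injective : ∀ {a b} → π a ≡ π b → a ≡ b)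
                   (label : Fin h → Bool) where

  module _ (χ : Fin h → Bool) where

    Member : Subset B → Fin h → Set
    Member S a = χ a ≡ true × lookup S (nm a) ≡ true

    member? : ∀ S a → Dec (Member S a)
    member? S a = (χ a Bool.≟ true) ×-dec (lookup S (nm a) Bool.≟ true)

    Realised : Subset B → Set
    Realised S = ∀ b → lookup S b ≡ true → ∃[ a ] (χ a ≡ true × nm a ≡ b)

    LeastLabelled : Subset B → Set
    LeastLabelled S = ∃[ v ] (Member S v × label v ≡ true × ∀ a → Member S a → π v ≤ π a)

    Valid : Subset B → Fin h → Set
    Valid S u = Member S u × (∀ a → Member S a → π a ≤ π u) × Realised S × LeastLabelled S

    abstract
      valid? : ∀ S u → Dec (Valid S u)
      valid? S u = member? S u ×-dec (all? (λ a → member? S a →-dec (π a ℕ.≤? π u)) ×-dec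
        (all? (λ b → (lookup S b Bool.≟ true) →-dec any? (λ a → (χ a Bool.≟ true) ×-dec (nm a ≟ b))) ×-dec
         any? (λ v → member? S v ×-dec ((label v Bool.≟ true) ×-dec all? (λ a → member? S a →-dec (π v ℕ.≤? π a))))))

    valid-unique : ∀ {S u u'} → Valid S u → Valid S u' → u ≡ u'
    valid-unique (m , top , _) (m' , top' , _) = π-injective (ℕ.≤-antisym (top' _ m) (top _ m'))

    count : Subset B → Bool
    count S = xorSum h (λ u → does (valid? S u))

    count-valid : ∀ {S u} → Valid S u → count S ≡ true
    count-valid {S} {u} v = xorSum-single h u (dec-true (valid? S u) v) (λ u' ne → dec-false (valid? S u') (λ v' → ne (valid-unique {S} v' v)))

    count-invalid : ∀ {S} → (∀ u → ¬ Valid S u) → count S ≡ false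
    count-invalid {S} none = xorSum-false h (λ u → dec-false (valid? S u) (none u))

    count-true⇒ : ∀ {S} → count S ≡ true → ∃ (Valid S)
    count-true⇒ {S} e with any? (valid? S)
    ... | yes v = v
    ... | no ¬v = ⊥-elim (true≢false e (count-invalid (λ u v → ¬v (u , v))))

    module _ (unique : ∀ {a b} → χ a ≡ true → χ b ≡ true → nm a ≡ nm b → a ≡ b)
             {z : Fin h} (z∈ : χ z ≡ true) (z-top : ∀ a → χ a ≡ true → π a ≤ π z) where

      with-z : Subset B → Subset B
      with-z S = S Vec.[ nm z ]≔ true

      lookup-z : ∀ S → lookup (with-z S) (nm z) ≡ true
      lookup-z S = Vec.lookup∘update (nm z) S true

      lookup-other : ∀ S {b} → b ≢ nm z → lookup (with-z S) b ≡ lookup S b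
      lookup-other S ne = Vec.lookup∘update′ ne S true

      ⊆-with-z : ∀ S {b} → lookup S b ≡ true → lookup (with-z S) b ≡ true
      ⊆-with-z S {b} e with b ≟ nm z
      ... | yes refl = lookup-z S
      ... | no ne    = trans (lookup-other S ne) e

      member-with-z : ∀ {S a} → Member (with-z S) a → a ≡ z ⊎ Member S a
      member-with-z {S} {a} (p , q) with nm a ≟ nm z
      ... | yes e = inj₁ (unique p z∈ e)
      ... | no ne = inj₂ (p , trans (sym (lookup-other S ne)) q)

      count-empty : ∀ S → isEmpty S ≡ true → count S ≡ false
      count-empty S e = count-invalid λ u ((_ , q) , _) → true≢false q (isEmpty⇒ S e (nm u))

      only-z : ∀ {S} → isEmpty S ≡ true → ∀ {a} → Member (with-z S) a → a ≡ z
      only-z {S} e m with member-with-z {S} m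
      ... | inj₁ eq      = eq
      ... | inj₂ (_ , q) = ⊥-elim (true≢false q (isEmpty⇒ S e _))

      count-singleton : ∀ S → isEmpty S ≡ true → count (with-z S) ≡ label z
      count-singleton S e = bool-ext to from
        where
        to : count (with-z S) ≡ true → label z ≡ true
        to p with count-true⇒ {with-z S} p
        ... | _ , _ , _ , _ , v , m , l , _ = subst (λ a → label a ≡ true) (only-z {S} e m) l
        from : label z ≡ true → count (with-z S) ≡ true
        from l = count-valid {with-z S} {z} ((z∈ , lookup-z S) , (λ a m → z-top a (proj₁ m)) , real ,
                   z , (z∈ , lookup-z S) , l , λ a m → ℕ.≤-reflexive (cong π (sym (only-z {S} e m))))
          where
          real : Realised (with-z S)
          real b q with b ≟ nm z
          ... | yes eq = z , z∈ , sym eq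
          ... | no ne  = ⊥-elim (true≢false (trans (sym (lookup-other S ne)) q) (isEmpty⇒ S e b))

      count-toggle : ∀ S → lookup S (nm z) ≡ false → isEmpty S ≡ false → count S ≡ count (with-z S)
      count-toggle S z∉ ne = bool-ext to from
        where
        b₁ = proj₁ (nonempty⇒ S ne)
        b₁∈ = proj₂ (nonempty⇒ S ne)
        to : count S ≡ true → count (with-z S) ≡ true
        to p with count-true⇒ {S} p
        ... | u , _ , _ , real , v , m , l , least = count-valid {with-z S} {z}
              ((z∈ , lookup-z S) , (λ a m → z-top a (proj₁ m)) , real' , v , (proj₁ m , ⊆-with-z S (proj₂ m)) , l , least')
          where
          real' : Realised (with-z S)
          real' b q with b ≟ nm z
          ... | yes eq = z , z∈ , sym eq
          ... | no ne  = real b (trans (sym (lookup-other S ne)) q)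
          least' : ∀ a → Member (with-z S) a → π v ≤ π a
          least' a m' with member-with-z {S} m'
          ... | inj₁ refl = z-top v (proj₁ m)
          ... | inj₂ m″   = least a m″
        from : count (with-z S) ≡ true → count S ≡ true
        from p with count-true⇒ {with-z S} p
        ... | _ , _ , _ , real , v , m , l , least with real b₁ (⊆-with-z S b₁∈)
        ...   | a₁ , p₁ , e₁ with argmax (member? S) π (a₁ , p₁ , subst (λ b → lookup S b ≡ true) (sym e₁) b₁∈)
        ...     | u , mu , top = count-valid {S} {u} (mu , top , (λ b q → real b (⊆-with-z S q)) ,
                    v , v∈ (member-with-z {S} m) , l , λ a m' → least a (proj₁ m' , ⊆-with-z S (proj₂ m')))
          where
          -- If the least member were `z`, the highest vertex of all, then it would coincide with
          -- `a₁`, whose name is in `S` although that of `z` is not.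
          v∈ : v ≡ z ⊎ Member S v → Member S v
          v∈ (inj₂ m') = m'
          v∈ (inj₁ refl) = ⊥-elim (true≢false a₁∈ (subst (λ a → lookup S (nm a) ≡ false) z≡a₁ z∉))
            where
            a₁∈ : lookup S (nm a₁) ≡ true
            a₁∈ = subst (λ b → lookup S b ≡ true) (sym e₁) b₁∈
            z≡a₁ : z ≡ a₁
            z≡a₁ = π-injective (ℕ.≤-antisym (least a₁ (p₁ , ⊆-with-z S a₁∈)) (z-top a₁ p₁))

      total : xorSets B count ≡ label z
      total = trans (xorSets-pair B (nm z) count) (trans (xorSets-cong B paired) (xorSets-isEmpty B (label z)))
        where
        xor-self : ∀ b → b xor b ≡ false
        xor-self true  = refl
        xor-self false = refl
        paired : ∀ S → (if lookup S (nm z) then false else count S xor count (with-z S)) ≡ isEmpty S ∧ label z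
        paired S with lookup S (nm z) in e | isEmpty S in f
        ... | true  | true  = ⊥-elim (true≢false e (isEmpty⇒ S f (nm z)))
        ... | true  | false = refl
        ... | false | true  = cong₂ _xor_ (count-empty S f) (count-singleton S f)
        ... | false | false = trans (cong (count S xor_) (sym (count-toggle S e f))) (xor-self (count S))

-- Hidden vertices are the nonempty sets I of old hidden vertices whose least element is labelled
-- "1", and t is adjacent to I iff I ⊆ N(t).  Let z be the dominant vertex of t and t'.  Toggling z
-- pairs up the nonempty I ⊆ N(t) ∩ N(t') other than {z} without changing the least element,
-- so the number of common neighbours is odd iff z is labelled "1".  To keep the treewidth bounded,
-- I is represented by its largest element and its set of names.
module LaconParity {G : Graph} (𝓛 : LaconDecomposition G) {c : ℕ}
  (col : Col∞≤ (adj (LaconDecomposition.L 𝓛)) (LaconDecomposition.π 𝓛) c) where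
  open LaconElim 𝓛 col

  B : ℕ
  B = suc (suc c)

  nm : Fin h → Fin B
  nm a = name (hidden a)

  open LeastLabels nm π π-injective label

  both : Fin n → Fin n → Fin h → Bool
  both t t' a = N t a ∧ N t' a

  -- The same names might denote different vertices in `N t` and `N t'`. But both sets have the
  -- largest element `u`, a neighbour of both targets, so all their members lie in the up-set of
  -- `u`, where names are unique; thus the two sets coincide.
  valid-both : ∀ {t t' S u} → Valid (N t) S u → Valid (N t') S u → Valid (both t t') S u
  valid-both {t} {t'} {S} {u} ((p , q) , top , real , v , m , l , least) ((p' , _) , top' , real' , _) =
    (⇒∧-true p p' , q) , (λ a (r , s) → top a (proj₁ (∧-true⇒ r) , s)) ,
    (λ b s → let (a , r , e) = real b s in a , ⇒∧-true r (across (r , subst (λ b → lookup S b ≡ true) (sym e) s)) , e) ,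
    v , (⇒∧-true (proj₁ m) (across m) , proj₂ m) , l , λ a (r , s) → least a (proj₁ (∧-true⇒ r) , s)
    where
    across : ∀ {a} → Member (N t) S a → N t' a ≡ true
    across {a} (r , s) with real' (nm a) s
    ... | a' , r' , e = subst (λ a → N t' a ≡ true)
            (Fin.↑ˡ-injective n a' a (Fin.suc-injective (name-inj
              (up-hidden p' r' (top' a' (r' , subst (λ b → lookup S b ≡ true) (sym e) s))) (up-hidden p r (top a (r , s))) e))) r'

  valid-grow : ∀ {χ t S u} → (∀ a → χ a ≡ true → N t a ≡ true) → Valid χ S u → Valid (N t) S u
  valid-grow {χ} {t} {S} sub ((p , q) , top , real , v , m , l , least) =
    (sub _ p , q) , (λ a m → top a (shrink m)) , (λ b s → let (a , r , e) = real b s in a , sub a r , e) ,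
    v , (sub v (proj₁ m) , proj₂ m) , l , λ a m → least a (shrink m)
    where
    shrink : ∀ {a} → Member (N t) S a → Member χ S a
    shrink {a} (r , s) with real (nm a) s
    ... | a' , r' , e = subst (λ a → χ a ≡ true) (name-unique (sub a' r') r e) r' , s

  size′ : ℕ
  size′ = subsets B * h

  N′ : V G → Fin size′ → Bool
  N′ t x = does (valid? (N t) (subsetAt B (proj₁ (remQuot {subsets B} h x))) (proj₂ (remQuot {subsets B} h x)))

  N′⇒ : ∀ {t x} → N′ t x ≡ true → Valid (N t) (subsetAt B (proj₁ (remQuot {subsets B} h x))) (proj₂ (remQuot {subsets B} h x))
  N′⇒ {t} {x} = does⇒ (valid? (N t) (subsetAt B (proj₁ (remQuot {subsets B} h x))) (proj₂ (remQuot {subsets B} h x)))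

  remQuot-ext : ∀ {x y : Fin size′} → proj₁ (remQuot {subsets B} h x) ≡ proj₁ (remQuot {subsets B} h y) →
                proj₂ (remQuot {subsets B} h x) ≡ proj₂ (remQuot {subsets B} h y) → x ≡ y
  remQuot-ext {x} {y} p q = trans (sym (Fin.combine-remQuot {subsets B} h x)) (trans (cong₂ combine p q) (Fin.combine-remQuot {subsets B} h y))

  common-count : ∀ t t' → parity ∣ tabulate (N′ t) ∩ tabulate (N′ t') ∣ ≡ xorSets B (count (both t t'))
  common-count t t' = trans (parity-∩ size′ (N′ t) (N′ t')) (trans (xorSum-* (subsets B) h _)
    (trans (xorSum-cong (subsets B) (λ i → xorSum-cong h (λ u → cell i u))) (xorSum-subsets B (count (both t t')))))
    where
    conj : ∀ S u → does (valid? (N t) S u) ∧ does (valid? (N t') S u) ≡ does (valid? (both t t') S u)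
    conj S u = bool-ext
      (λ e → let (p , q) = ∧-true⇒ e in dec-true (valid? (both t t') S u)
        (valid-both {t} {t'} {S} (does⇒ (valid? (N t) S u) p) (does⇒ (valid? (N t') S u) q)))
      (λ e → let v = does⇒ (valid? (both t t') S u) e in ⇒∧-true
        (dec-true (valid? (N t) S u) (valid-grow {both t t'} {t} {S} (λ a r → proj₁ (∧-true⇒ r)) v))
        (dec-true (valid? (N t') S u) (valid-grow {both t t'} {t'} {S} (λ a r → proj₂ (∧-true⇒ {N t a} r)) v)))
    cell : ∀ i u → N′ t (combine i u) ∧ N′ t' (combine i u) ≡ does (valid? (both t t') (subsetAt B i) u)
    cell i u = trans (cong (λ p → does (valid? (N t) (subsetAt B (proj₁ p)) (proj₂ p)) ∧ does (valid? (N t') (subsetAt B (proj₁ p)) (proj₂ p)))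
                 (Fin.remQuot-combine i u)) (conj (subsetAt B i) u)

  common-parity : ∀ {t t' z} → Dominant N π t t' z → parity ∣ tabulate (N′ t) ∩ tabulate (N′ t') ∣ ≡ label z
  common-parity {t} {t'} (p , p' , top) = trans (common-count t t') (total (both t t')
    (λ r s → name-unique (proj₁ (∧-true⇒ r)) (proj₁ (∧-true⇒ s))) (⇒∧-true p p')
    (λ a r → top a (proj₁ (∧-true⇒ r)) (proj₂ (∧-true⇒ {N t a} r))))

  parityDecomposition : ParityDecomposition (subsets B) G
  parityDecomposition = record
    { h = size′
    ; N = N′
    -- For a fixed target the set of names already determines the largest element, so the degree is
    -- at most the number of such sets.
    ; degree = λ t → injectiveOn⇒∣∣≤ (tabulate (N′ t)) (proj₁ ∘ remQuot {subsets B} h) λ x y x∈ y∈ e →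
        remQuot-ext e (valid-unique (N t) {subsetAt B (proj₁ (remQuot {subsets B} h x))} (N′⇒ {t} {x} (∈-tabulate⇒ x∈))
          (subst (λ i → Valid (N t) (subsetAt B i) (proj₂ (remQuot {subsets B} h y))) (sym e) (N′⇒ {t} {y} (∈-tabulate⇒ y∈))))
    ; parity = λ t t' ne → let (z , dom) = top t t' in mk⇔
        (λ e → parity⇒odd ∣ tabulate (N′ t) ∩ tabulate (N′ t') ∣ (trans (common-parity dom) (Equivalence.to (edge⇔label ne dom) e)))
        (λ e → Equivalence.from (edge⇔label ne dom) (trans (sym (common-parity dom)) (odd⇒parity ∣ tabulate (N′ t) ∩ tabulate (N′ t') ∣ e)))
    }

  P : Graph
  P = ParityDecomposition.P parityDecomposition

  home : V P → Fin (suc (h + n))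
  home x = [ (λ y → hidden (proj₂ (remQuot {subsets B} h y))) , target ]′ (splitAt size′ x)

  slot : V P → Fin (suc (subsets B))
  slot x = [ (λ y → suc (proj₁ (remQuot {subsets B} h y))) , (λ _ → zero) ]′ (splitAt size′ x)

  placed : ∀ x y → home x ≡ home y → slot x ≡ slot y → x ≡ y
  placed x y e f with splitAt size′ x in ex | splitAt size′ y in ey
  ... | inj₁ a | inj₁ b = trans (sym (Fin.splitAt⁻¹-↑ˡ ex)) (trans (cong (_↑ˡ n)
          (remQuot-ext (Fin.suc-injective f) (Fin.↑ˡ-injective n _ _ (Fin.suc-injective e)))) (Fin.splitAt⁻¹-↑ˡ ey))
  ... | inj₂ s | inj₂ t = trans (sym (Fin.splitAt⁻¹-↑ʳ ex)) (trans (cong (size′ ↑ʳ_)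
          (Fin.↑ʳ-injective h _ _ (Fin.suc-injective e))) (Fin.splitAt⁻¹-↑ʳ ey))

  together′ : ∀ s s' → bipAdj′ N′ s s' ≡ true → ∃[ i ]
    (Up i ([ (λ y → hidden (proj₂ (remQuot {subsets B} h y))) , target ]′ s) × Up i ([ (λ y → hidden (proj₂ (remQuot {subsets B} h y))) , target ]′ s'))
  together′ (inj₁ a) (inj₂ t) e = target t , target-up (proj₁ (proj₁ (N′⇒ {t} {a} e))) , up-refl {target t}
  together′ (inj₂ t) (inj₁ a) e = target t , up-refl {target t} , target-up (proj₁ (proj₁ (N′⇒ {t} {a} e)))

  treewidth : TW≤ P (B * suc (subsets B))
  treewidth = EliminationTree.blowUp rooted P home slot placed (λ x y → together′ (splitAt size′ x) (splitAt size′ y))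

lacon⇒parity : ∀ 𝒢 → LaconCondition 𝒢 → ParityCondition 𝒢
lacon⇒parity 𝒢 (t , decomposed) =
  subsets B , (λ P → TW≤ P k) , (k , λ _ tw → tw) , λ G g →
  let (D , col) = decomposed G g in LaconParity.parityDecomposition D col , LaconParity.treewidth D col
  where
  B = suc (suc (t ∸ 1))
  k = B * suc (subsets B)

theorem8 : (𝒢 : GraphClass)
    → (StructurallyBoundedTreewidth 𝒢 ⇔ LaconCondition 𝒢)
    × (StructurallyBoundedTreewidth 𝒢 ⇔ ShrubCondition 𝒢)
    × (StructurallyBoundedTreewidth 𝒢 ⇔ ParityCondition 𝒢)
theorem8 𝒢 =
  mk⇔ (structural⇒lacon 𝒢) (shrub⇒structural 𝒢 ∘ lacon⇒shrub 𝒢) ,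
  mk⇔ (lacon⇒shrub 𝒢 ∘ structural⇒lacon 𝒢) (shrub⇒structural 𝒢) ,
  mk⇔ (lacon⇒parity 𝒢 ∘ structural⇒lacon 𝒢) (parity⇒structural 𝒢)
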